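{- For every integer $d$ there exists a nontrivial snark $G$ with oddness $\omega(G)=2$ and colouring defect $\operatorname{df}(G)\ge d$. That is, there exist nontrivial snarks of oddness $2$ with arbitrarily large colouring defect.
   Context: Graphs are finite; multiple edges and loops are permitted. A snark is a $2$-connected cubic graph that admits no proper $3$-edge-colouring. A cubic graph is cyclically $k$-edge-connected if the removal of fewer than $k$ edges cannot create a graph with at least two components containing circuits. A snark is nontrivial if it is cyclically $4$-edge-connected and has girth at least $5$. The oddness $\omega(G)$ of a bridgeless cubic graph $G$ is the minimum number of odd circuits in a $2$-factor of $G$. The colouring defect $\operatorname{df}(G)$ of a cubic graph $G$ is the minimum, over all collections $\{M_1,M_2,M_3\}$ of three (not necessarily distinct) perfect matchings of $G$, of the number of edges of $G$ belonging to none of $M_1,M_2,M_3$. -}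

module Defs where

open import Data.Nat using (ℕ; zero; suc; _+_; _≤_; _<_)
open import Data.Fin using (Fin; zero; suc; inject₁; fromℕ; _≟_)
open import Data.Bool using (Bool; true; false; if_then_else_; not; _∨_; _∧_)
open import Data.List using (map; allFin)
open import Data.Nat.ListAction using (sum)
open import Data.Product using (Σ; _×_; _,_; proj₁; proj₂; ∃; ∃-syntax)
open import Data.Sum using (_⊎_)
open import Relation.Nullary using (¬_; does)
open import Relation.Binary.PropositionalEquality using (_≡_; _≢_)
open import Function.Definitions using (Injective)

-- Finite multigraphs (multiple edges and loops allowed).
-- Vertices are Fin n, edges are Fin m, each edge has an (unordered) pair
-- of ends; a loop is an edge whose two ends coincide.

record Graph : Set where
  field
    n    : ℕ
    m    : ℕ
    ends : Fin m → Fin n × Fin n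

open Graph public

EdgeSet : Graph → Set
EdgeSet G = Fin (m G) → Bool

allEdges : (G : Graph) → EdgeSet G
allEdges G _ = true

countF : (k : ℕ) → (Fin k → Bool) → ℕ
countF k P = sum (map (λ i → if P i then 1 else 0) (allFin k))

-- number of ends of edge e at vertex v (a loop at v contributes 2)
endsAt : (G : Graph) → Fin (m G) → Fin (n G) → ℕ
endsAt G e v =
  (if does (proj₁ (ends G e) ≟ v) then 1 else 0) +
  (if does (proj₂ (ends G e) ≟ v) then 1 else 0)

degIn : (G : Graph) → EdgeSet G → Fin (n G) → ℕ
degIn G D v = sum (map (λ e → if D e then endsAt G e v else 0) (allFin (m G)))

deg : (G : Graph) → Fin (n G) → ℕ
deg G = degIn G (allEdges G)

Cubic : Graph → Set
Cubic G = ∀ v → deg G v ≡ 3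

Joins : (G : Graph) → Fin (m G) → Fin (n G) → Fin (n G) → Set
Joins G e u v = (ends G e ≡ (u , v)) ⊎ (ends G e ≡ (v , u))

data Reach (G : Graph) (W : Fin (n G) → Bool) (F : EdgeSet G) :
           Fin (n G) → Fin (n G) → Set where
  here : ∀ {u} → W u ≡ true → Reach G W F u u
  step : ∀ {u w v} (e : Fin (m G)) → W u ≡ true → F e ≡ true →
         Joins G e u w → Reach G W F w v → Reach G W F u v

allV : (G : Graph) → Fin (n G) → Bool
allV G _ = true

Connected : Graph → Set
Connected G = ∀ u v → Reach G (allV G) (allEdges G) u v

-- k-connected in the sense of Diestel for k = 2:
-- more than 2 vertices, and G - x is connected for every vertex x.
TwoConnected : Graph → Set
TwoConnected G =
  (2 < n G) × Connected G ×
  (∀ (x u v : Fin (n G)) → u ≢ x → v ≢ x →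
     Reach G (λ w → not (does (w ≟ x))) (allEdges G) u v)

-- Circuits using only edges from F.  A circuit of length (suc k) is a
-- cyclic sequence of distinct vertices vs 0 .. vs k and distinct edges
-- es 0 .. es k, where es i joins vs i and vs (i+1), and es k joins vs k and
-- vs 0.  (Length 1 = loop, length 2 = pair of parallel edges.)

record Circuit (G : Graph) (F : EdgeSet G) : Set where
  field
    k      : ℕ
    vs     : Fin (suc k) → Fin (n G)
    es     : Fin (suc k) → Fin (m G)
    vs-inj : Injective _≡_ _≡_ vs
    es-inj : Injective _≡_ _≡_ es
    es-in  : ∀ i → F (es i) ≡ true
    links  : ∀ (i : Fin k) → Joins G (es (inject₁ i)) (vs (inject₁ i)) (vs (suc i))
    close  : Joins G (es (fromℕ k)) (vs (fromℕ k)) (vs zero)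

  len : ℕ
  len = suc k

open Circuit public

GirthAtLeast : Graph → ℕ → Set
GirthAtLeast G g = (C : Circuit G (allEdges G)) → g ≤ len C

-- cyclically c-edge-connected: removing any set R of fewer than c edges
-- leaves at most one component containing circuits, i.e. any two
-- circuits of G - R lie in the same component of G - R.
CyclicallyEdgeConnected : Graph → ℕ → Set
CyclicallyEdgeConnected G c =
  ∀ (R : EdgeSet G) → countF (m G) R < c →
  (C₁ C₂ : Circuit G (λ e → not (R e))) →
  Reach G (allV G) (λ e → not (R e)) (vs C₁ zero) (vs C₂ zero)

-- Proper 3-edge-colourings: each vertex meets at most one edge-end of
-- each colour (so loops are never properly coloured).

Proper3EdgeColouring : (G : Graph) → (Fin (m G) → Fin 3) → Set
Proper3EdgeColouring G c =
  ∀ (v : Fin (n G)) (i : Fin 3) → degIn G (λ e → does (c e ≟ i)) v ≤ 1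

ThreeEdgeColourable : Graph → Set
ThreeEdgeColourable G = Σ (Fin (m G) → Fin 3) (Proper3EdgeColouring G)

Snark : Graph → Set
Snark G = TwoConnected G × Cubic G × ¬ ThreeEdgeColourable G

NontrivialSnark : Graph → Set
NontrivialSnark G = Snark G × CyclicallyEdgeConnected G 4 × GirthAtLeast G 5

TwoFactor : (G : Graph) → EdgeSet G → Set
TwoFactor G D = ∀ v → degIn G D v ≡ 2

oddᵇ : ℕ → Bool
oddᵇ zero = false
oddᵇ (suc zero) = true
oddᵇ (suc (suc x)) = oddᵇ x

-- A 2-factor D has exactly `o` odd circuits: D splits into r circuits
-- (using edges of D), pairwise vertex-disjoint and covering all vertices
-- (these are the components of D), of which exactly o have odd length.
HasOddCircuits : (G : Graph) → EdgeSet G → ℕ → Set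
HasOddCircuits G D o =
  Σ ℕ λ r → Σ (Fin r → Circuit G D) λ cs →
    (∀ (v : Fin (n G)) → ∃[ j ] ∃[ i ] vs (cs j) i ≡ v) ×
    (∀ (j j' : Fin r) i i' → vs (cs j) i ≡ vs (cs j') i' → j ≡ j') ×
    (countF r (λ j → oddᵇ (len (cs j))) ≡ o)

OddnessIs : Graph → ℕ → Set
OddnessIs G w =
  (Σ (EdgeSet G) λ D → TwoFactor G D × HasOddCircuits G D w) ×
  (∀ (D : EdgeSet G) o → TwoFactor G D → HasOddCircuits G D o → w ≤ o)

PerfectMatching : (G : Graph) → EdgeSet G → Set
PerfectMatching G M = ∀ v → degIn G M v ≡ 1

uncovered : (G : Graph) → EdgeSet G → EdgeSet G → EdgeSet G → ℕ
uncovered G M₁ M₂ M₃ = countF (m G) (λ e → not (M₁ e ∨ M₂ e ∨ M₃ e))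

-- df(G) ≥ d : every triple of perfect matchings leaves ≥ d edges uncovered
-- (and G has a perfect matching, so the minimum exists)
DefectAtLeast : Graph → ℕ → Set
DefectAtLeast G d =
  (Σ (EdgeSet G) (PerfectMatching G)) ×
  (∀ M₁ M₂ M₃ → PerfectMatching G M₁ → PerfectMatching G M₂ →
     PerfectMatching G M₃ → d ≤ uncovered G M₁ M₂ M₃)

{-# OPTIONS --safe #-}
module Submission where

-- Removing two nonadjacent vertices from the Petersen graph leaves a piece with two triples of outer
-- edges. For a perfect matching M, the parity of the number of edges of M in a triple is the same for
-- both triples. If three perfect matchings cover all edges of the piece, they 3-edge-colour it, and
-- exactly one of the three parities is odd: otherwise all are, the colours in each triple are
-- distinct, and the colouring extends to the Petersen graph.
--
-- Replace each edge of a hexagon of the Petersen graph by a long chain ("strip") of such pieces; the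
-- parities are constant along a strip. If every strip contained a fully covered piece, every strip
-- would have exactly one odd parity, and these parities would give a 3-edge-colouring of the Petersen
-- graph. So some strip has an uncovered edge in each of its pieces, and the defect is at least the
-- length of the strips.
--
-- Two disjoint 5-circuits of the Petersen graph lift to a 2-factor with exactly two odd circuits.
-- Fewer are impossible: the number of odd circuits is even, and a 2-factor without odd circuits gives
-- three perfect matchings that cover everything.

open import Defs
open import Data.Nat as ℕ using (ℕ; zero; suc; _+_; _*_; _∸_; _≤_; _<_; z≤n; s≤s; s≤s⁻¹; _≡ᵇ_; _≤ᵇ_)
open import Data.Nat.Properties hiding (_≟_) renaming (suc-injective to ℕ-suc-injective)
open import Data.Nat.ListAction using (sum)
open import Data.Nat.ListAction.Properties using (sum-++)
open import Data.Fin using (Fin; zero; suc; _≟_; inject₁; fromℕ; fromℕ<; toℕ; join; splitAt; _↑ˡ_; _↑ʳ_)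
open import Data.Fin.Properties using (suc-injective; any?; all?; ¬∀⟶∃¬; +↔⊎; *↔×; toℕ-injective; toℕ-inject₁; toℕ-fromℕ; toℕ-fromℕ<; toℕ≤pred[n]; splitAt-↑ˡ; splitAt-↑ʳ; join-splitAt)
open import Data.Fin.Patterns
open import Data.Fin.Induction using (<-weakInduction; >-weakInduction)
open import Data.Fin.Relation.Unary.Top using (View; view; ‵fromℕ; ‵inject₁; view-fromℕ; view-inject₁)
open import Data.Bool as Bool using (Bool; true; false; if_then_else_; not; _∧_; _∨_; _xor_; T)
open import Data.Bool.ListAction using (all)
open import Data.Bool.Properties using (∨-zeroʳ; not-involutive; ¬-not; xor-comm; xor-assoc; xor-identityʳ; xor-annihilates-not)
open import Data.Bool.Solver using (module xor-∧-Solver)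
open import Data.List using (List; []; _∷_; _++_; _ʳ++_; map; length; lookup; allFin; tabulate)
open import Data.List.Properties using (map-++; map-tabulate)
open import Data.List.Membership.Propositional using (_∈_)
open import Data.List.Membership.Propositional.Properties using (∈-lookup; ∈-tabulate⁺)
open import Data.List.Relation.Unary.Any using (here; there)
open import Data.List.Relation.Unary.All as All using (All; []; _∷_)
open import Data.List.Relation.Unary.AllPairs using (allPairs?; []; _∷_)
open import Data.List.Relation.Unary.Unique.Propositional using (Unique)
import Data.List.Relation.Unary.Unique.Propositional.Properties as Unique
open import Data.List.Relation.Binary.Pointwise using (Pointwise; []; _∷_; Pointwise-≡⇒≡)
open import Data.Maybe using (Maybe; just; nothing)
open import Data.Maybe.Properties using (just-injective)
open import Data.Product using (Σ; _×_; _,_; proj₁; proj₂; ∃-syntax)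
open import Data.Product.Properties using (≡-dec)
open import Data.Product.Function.NonDependent.Propositional using (_×-↔_)
open import Data.Sum using (_⊎_; inj₁; inj₂; swap)
open import Data.Sum.Function.Propositional using (_⊎-↔_)
open import Data.Empty using (⊥; ⊥-elim)
open import Data.Unit using (tt)
open import Function using (_∘_; id; _↔_; Inverse; mk↔ₛ′)
open import Function.Properties.Inverse using (↔-refl; ↔-sym; ↔-trans)
open import Relation.Nullary using (¬_; does; yes; no; Dec; ¬?; _×-dec_; _⊎-dec_)
open import Relation.Nullary.Decidable using (dec-true; dec-false; from-yes; decidable-stable)
open import Relation.Binary.PropositionalEquality
open import Algebra.Properties.Semiring.Sum +-*-semiring using (sum-syntax; sum-cong-≗; ∑-comm; ∑-distrib-+; *-distribˡ-sum; *-distribʳ-sum)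

-- Finite sums and counting

-- The edges outside the strips need not be covered, so the colouring of the outer Petersen graph is
-- forced by counting. If every strip has exactly one odd parity, the parities on the two sides of a
-- ring node show that its spoke lies in an odd number of the matchings. At a leaf the three
-- matchings supply three incidences in all, so both spokes and the arm lie in exactly one matching
-- each.
--
-- Each piece is joined to its mirror image. The resulting unit has a Hamiltonian path from vertex 0
-- to vertex 15, which can be continued through an outer edge at both ends or closed to a
-- 16-circuit; both the 2-factor and the cut argument rest on this.
--
-- The other properties are reduced to finite checks that do not depend on the length of the strips.
-- All connectivity statements rest on one fact: a vertex 2-colouring with at most three bichromatic
-- edges is constant except possibly at one vertex. For the girth, the position of a unit in its
-- strip is kept only modulo 3. Non-colourability follows from the defect, since the classes of a
-- 3-edge-colouring would be perfect matchings covering everything.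

false≢true : false ≢ true
false≢true ()

inject₁≢suc : ∀ {n} (i : Fin n) → inject₁ i ≢ suc i
inject₁≢suc (suc i) p = inject₁≢suc i (suc-injective p)

0≢1 : ∀ {n} → _≢_ {A = Fin (2 + n)} 0F 1F
0≢1 ()

1≢2 : ∀ {n} → _≢_ {A = Fin (3 + n)} 1F 2F
1≢2 ()

2≢3 : ∀ {n} → _≢_ {A = Fin (4 + n)} 2F 3F
2≢3 ()

b2n : Bool → ℕ
b2n b = if b then 1 else 0

listSum≡∑ : ∀ n (f : Fin n → ℕ) → sum (map f (allFin n)) ≡ ∑[ i < n ] f i
listSum≡∑ n f = trans (cong sum (map-tabulate id f)) (go n f)
  where
  go : ∀ n (f : Fin n → ℕ) → sum (tabulate f) ≡ ∑[ i < n ] f i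
  go zero    f = refl
  go (suc n) f = cong (f zero +_) (go n (f ∘ suc))

countF≡∑ : ∀ n (P : Fin n → Bool) → countF n P ≡ ∑[ i < n ] b2n (P i)
countF≡∑ n P = listSum≡∑ n (b2n ∘ P)

∑-zero : ∀ n (f : Fin n → ℕ) → (∀ i → f i ≡ 0) → ∑[ i < n ] f i ≡ 0
∑-zero zero    f h = refl
∑-zero (suc n) f h = cong₂ _+_ (h zero) (∑-zero n (f ∘ suc) (h ∘ suc))

∑-const : ∀ n c → ∑[ i < n ] c ≡ n * c
∑-const zero    c = refl
∑-const (suc n) c = cong (c +_) (∑-const n c)

∑-mono : ∀ n (f g : Fin n → ℕ) → (∀ i → f i ≤ g i) → ∑[ i < n ] f i ≤ ∑[ i < n ] g i
∑-mono zero    f g h = z≤n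
∑-mono (suc n) f g h = +-mono-≤ (h zero) (∑-mono n (f ∘ suc) (g ∘ suc) (h ∘ suc))

∑-indicator : ∀ {n} (i : Fin n) (g : Fin n → ℕ) → ∑[ j < n ] (b2n (does (i ≟ j)) * g j) ≡ g i
∑-indicator {suc n} zero g =
  trans (cong₂ _+_ (+-identityʳ (g zero)) (∑-zero n _ (λ _ → refl))) (+-identityʳ (g zero))
∑-indicator {suc n} (suc i) g = ∑-indicator i (g ∘ suc)

∑-unique : ∀ n (Q : Fin n → Bool) → (∀ i j → Q i ≡ true → Q j ≡ true → i ≡ j) →
           ∑[ i < n ] b2n (Q i) ≤ 1
∑-unique zero    Q u = z≤n
∑-unique (suc n) Q u with Q zero in q
... | false = ∑-unique n (Q ∘ suc) (λ i j a b → suc-injective (u (suc i) (suc j) a b))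
... | true  = ≤-reflexive (cong suc (∑-zero n _ λ i → cong b2n (rest i)))
  where
  rest : ∀ i → Q (suc i) ≡ false
  rest i with Q (suc i) in q'
  ... | false = refl
  ... | true with u zero (suc i) q q'
  ...   | ()

does-true : ∀ {n} (i j : Fin n) → does (i ≟ j) ≡ true → i ≡ j
does-true i j h with i ≟ j
... | yes p = p
does-true i j () | no _

-- Double counting of the pairs `(i , e)` with `g i ≡ e`: injectivity bounds every fibre by one.
countF-injection : ∀ {k m} (g : Fin k → Fin m) → (∀ {i j} → g i ≡ g j → i ≡ j) →
                   (P : Fin m → Bool) → countF k (P ∘ g) ≤ countF m P
countF-injection {k} {m} g inj P = begin
  countF k (P ∘ g)                                           ≡⟨ countF≡∑ k (P ∘ g) ⟩
  ∑[ i < k ] p (g i)                                         ≡⟨ sum-cong-≗ (λ i → sym (∑-indicator (g i) p)) ⟩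
  ∑[ i < k ] ∑[ e < m ] (b2n (does (g i ≟ e)) * p e)         ≡⟨ ∑-comm {k} {m} _ ⟩
  ∑[ e < m ] ∑[ i < k ] (b2n (does (g i ≟ e)) * p e)         ≡⟨ sum-cong-≗ (λ e → sym (*-distribʳ-sum (p e) (λ i → b2n (does (g i ≟ e))))) ⟩
  ∑[ e < m ] ((∑[ i < k ] b2n (does (g i ≟ e))) * p e)       ≤⟨ ∑-mono m _ _ (λ e → *-monoˡ-≤ (p e) (fibre e)) ⟩
  ∑[ e < m ] (1 * p e)                                       ≡⟨ sum-cong-≗ (λ e → *-identityˡ (p e)) ⟩
  ∑[ e < m ] p e                                             ≡⟨ sym (countF≡∑ m P) ⟩
  countF m P                                                 ∎
  where
  open ≤-Reasoning
  p : Fin m → ℕ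
  p e = b2n (P e)
  fibre : ∀ e → ∑[ i < k ] b2n (does (g i ≟ e)) ≤ 1
  fibre e = ∑-unique k _ (λ i j a b → inj (trans (does-true _ e a) (sym (does-true _ e b))))

countF-all : ∀ k (P : Fin k → Bool) → (∀ i → P i ≡ true) → countF k P ≡ k
countF-all k P h = trans (countF≡∑ k P)
  (trans (sum-cong-≗ (λ i → cong b2n (h i))) (trans (∑-const k 1) (*-identityʳ k)))

countF-none : ∀ k (P : Fin k → Bool) → (∀ i → P i ≡ false) → countF k P ≡ 0
countF-none k P h = trans (countF≡∑ k P) (∑-zero k _ (λ i → cong b2n (h i)))

countF-mono : ∀ k (P Q : Fin k → Bool) → (∀ i → P i ≡ true → Q i ≡ true) → countF k P ≤ countF k Q
countF-mono k P Q h = subst₂ _≤_ (sym (countF≡∑ k P)) (sym (countF≡∑ k Q)) (∑-mono k _ _ le)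
  where
  le : ∀ i → b2n (P i) ≤ b2n (Q i)
  le i with P i in eq
  ... | false = z≤n
  ... | true rewrite h i eq = ≤-refl

degIn≡∑ : ∀ G D v → degIn G D v ≡ ∑[ e < m G ] (b2n (D e) * endsAt G e v)
degIn≡∑ G D v = trans (listSum≡∑ (m G) _) (sum-cong-≗ λ e → pt (D e) (endsAt G e v))
  where
  pt : ∀ b k → (if b then k else 0) ≡ b2n b * k
  pt true  k = sym (+-identityʳ k)
  pt false k = refl

handshake : ∀ G D → ∑[ v < n G ] degIn G D v ≡ 2 * countF (m G) D
handshake G D = begin
  ∑[ v < n G ] degIn G D v                                    ≡⟨ sum-cong-≗ (degIn≡∑ G D) ⟩
  ∑[ v < n G ] ∑[ e < m G ] (b2n (D e) * endsAt G e v)        ≡⟨ ∑-comm {n G} {m G} _ ⟩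
  ∑[ e < m G ] ∑[ v < n G ] (b2n (D e) * endsAt G e v)        ≡⟨ sum-cong-≗ (λ e → sym (*-distribˡ-sum (b2n (D e)) (endsAt G e))) ⟩
  ∑[ e < m G ] (b2n (D e) * (∑[ v < n G ] endsAt G e v))      ≡⟨ sum-cong-≗ (λ e → trans (cong (b2n (D e) *_) (two e)) (*-comm (b2n (D e)) 2)) ⟩
  ∑[ e < m G ] (2 * b2n (D e))                                ≡⟨ sym (*-distribˡ-sum 2 (b2n ∘ D)) ⟩
  2 * (∑[ e < m G ] b2n (D e))                                ≡⟨ cong (2 *_) (sym (countF≡∑ (m G) D)) ⟩
  2 * countF (m G) D                                          ∎
  where
  open ≡-Reasoning
  one : ∀ (u : Fin (n G)) → ∑[ v < n G ] b2n (does (u ≟ v)) ≡ 1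
  one u = trans (sum-cong-≗ {n G} (λ v → sym (*-identityʳ (b2n (does (u ≟ v)))))) (∑-indicator u (λ _ → 1))
  two : ∀ e → ∑[ v < n G ] endsAt G e v ≡ 2
  two e = trans (∑-distrib-+ {n G} (λ v → b2n (does (proj₁ (ends G e) ≟ v))) (λ v → b2n (does (proj₂ (ends G e) ≟ v)))) (cong₂ _+_ (one (proj₁ (ends G e))) (one (proj₂ (ends G e))))

-- Cubic graphs presented by darts

-- A dart is an edge with one of its two sides. Each vertex has three slots, and `dart` and `back`
-- are inverse bijections between slots and darts. Degree three is thus built in, and local
-- arguments become case splits over slots.
record CubicGraph : Set₁ where
  field
    V E       : Set
    nV nE     : ℕ
    V↔        : V ↔ Fin nV
    E↔        : E ↔ Fin nE
    dart      : V → Fin 3 → E × Bool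
    back      : E → Bool → V × Fin 3
    dart-back : ∀ e b → dart (proj₁ (back e b)) (proj₂ (back e b)) ≡ (e , b)
    back-dart : ∀ v j → back (proj₁ (dart v j)) (proj₂ (dart v j)) ≡ (v , j)

  end : E → Bool → V
  end e b = proj₁ (back e b)

  inc : V → Fin 3 → E
  inc v j = proj₁ (dart v j)

  field
    no-loop   : ∀ e → end e true ≢ end e false

  toV : V → Fin nV
  toV = Inverse.to V↔
  fromV : Fin nV → V
  fromV = Inverse.from V↔
  toE : E → Fin nE
  toE = Inverse.to E↔
  fromE : Fin nE → E
  fromE = Inverse.from E↔

  toV-fromV : ∀ x → toV (fromV x) ≡ x
  toV-fromV x = Inverse.inverseˡ V↔ refl
  fromV-toV : ∀ x → fromV (toV x) ≡ x
  fromV-toV x = Inverse.inverseʳ V↔ refl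
  toE-fromE : ∀ x → toE (fromE x) ≡ x
  toE-fromE x = Inverse.inverseˡ E↔ refl
  fromE-toE : ∀ x → fromE (toE x) ≡ x
  fromE-toE x = Inverse.inverseʳ E↔ refl

  toV-injective : ∀ {x y} → toV x ≡ toV y → x ≡ y
  toV-injective {x} {y} p = trans (sym (fromV-toV x)) (trans (cong fromV p) (fromV-toV y))
  toE-injective : ∀ {x y} → toE x ≡ toE y → x ≡ y
  toE-injective {x} {y} p = trans (sym (fromE-toE x)) (trans (cong fromE p) (fromE-toE y))
  fromE-injective : ∀ {x y} → fromE x ≡ fromE y → x ≡ y
  fromE-injective {x} {y} p = trans (sym (toE-fromE x)) (trans (cong toE p) (toE-fromE y))

  graph : Graph
  graph = record
    { n = nV ; m = nE
    ; ends = λ e → toV (end (fromE e) false) , toV (end (fromE e) true) }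

  end-inc : ∀ v j → end (inc v j) (proj₂ (dart v j)) ≡ v
  end-inc v j = cong proj₁ (back-dart v j)

  inc-end : ∀ e b → inc (end e b) (proj₂ (back e b)) ≡ e
  inc-end e b = cong proj₁ (dart-back e b)

  inc-injective : ∀ v {j k} → inc v j ≡ inc v k → j ≡ k
  inc-injective v {j} {k} p with dart v j | dart v k | back-dart v j | back-dart v k
  inc-injective v refl | e , false | .e , false | q | r = cong proj₂ (trans (sym q) r)
  inc-injective v refl | e , true  | .e , true  | q | r = cong proj₂ (trans (sym q) r)
  inc-injective v refl | e , false | .e , true  | q | r =
    ⊥-elim (no-loop e (trans (cong proj₁ r) (sym (cong proj₁ q))))
  inc-injective v refl | e , true  | .e , false | q | r =
    ⊥-elim (no-loop e (trans (cong proj₁ q) (sym (cong proj₁ r))))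

  slot : ∀ v e → (∃[ b ] end e b ≡ v) → ∃[ j ] inc v j ≡ e
  slot v e (b , refl) = proj₂ (back e b) , inc-end e b

  slot-unique : ∀ e v → (∃[ b ] end (fromE e) b ≡ fromV v) → ∑[ j < 3 ] b2n (does (toE (inc (fromV v) j) ≟ e)) ≡ 1
  slot-unique e v h with slot (fromV v) (fromE e) h
  ... | j₀ , r = trans (sum-cong-≗ {3} pt) (∑-indicator j₀ (λ _ → 1))
    where
    pt : ∀ j → b2n (does (toE (inc (fromV v) j) ≟ e)) ≡ b2n (does (j₀ ≟ j)) * 1
    pt j with toE (inc (fromV v) j) ≟ e | j₀ ≟ j
    ... | yes _ | yes _ = refl
    ... | no _  | no _  = refl
    ... | yes a | no b  = ⊥-elim (b (inc-injective (fromV v) (trans r (trans (cong fromE (sym a)) (fromE-toE _)))))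
    ... | no a  | yes refl = ⊥-elim (a (trans (cong toE r) (toE-fromE e)))

  -- Since there are no loops, an edge has at most one end at `v`, and it then occupies exactly one
  -- slot by `slot-unique`. This turns degrees, defined as sums over all edges, into sums over three
  -- slots.
  endsAt-inc : ∀ e v → endsAt graph e v ≡ ∑[ j < 3 ] b2n (does (toE (inc (fromV v) j) ≟ e))
  endsAt-inc e v with toV (end (fromE e) false) ≟ v | toV (end (fromE e) true) ≟ v
  ... | no ¬p | no ¬q = sym (∑-zero 3 _ none)
    where
    incident : ∀ j → toE (inc (fromV v) j) ≡ e → ∃[ b ] toV (end (fromE e) b) ≡ v
    incident j p = proj₂ (dart (fromV v) j)
      , trans (cong (λ x → toV (end x (proj₂ (dart (fromV v) j)))) (trans (cong fromE (sym p)) (fromE-toE _)))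
              (trans (cong toV (end-inc (fromV v) j)) (toV-fromV v))
    none : ∀ j → b2n (does (toE (inc (fromV v) j) ≟ e)) ≡ 0
    none j with toE (inc (fromV v) j) ≟ e
    ... | no _ = refl
    ... | yes p with incident j p
    ...   | false , q = ⊥-elim (¬p q)
    ...   | true  , q = ⊥-elim (¬q q)
  ... | yes p | yes q = ⊥-elim (no-loop (fromE e) (toV-injective (trans q (sym p))))
  ... | yes p | no  _ = sym (slot-unique e v (false , trans (sym (fromV-toV _)) (cong fromV p)))
  ... | no _  | yes p = sym (slot-unique e v (true , trans (sym (fromV-toV _)) (cong fromV p)))

  degV : (E → Bool) → V → ℕ
  degV D v = b2n (D (inc v 0F)) + (b2n (D (inc v 1F)) + b2n (D (inc v 2F)))

  degIn≡degV : ∀ D v → degIn graph D v ≡ degV (D ∘ toE) (fromV v)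
  degIn≡degV D v = begin
    degIn graph D v                                                                    ≡⟨ degIn≡∑ graph D v ⟩
    ∑[ e < nE ] (b2n (D e) * endsAt graph e v)                                          ≡⟨ sum-cong-≗ {nE} (λ e → cong (b2n (D e) *_) (endsAt-inc e v)) ⟩
    ∑[ e < nE ] (b2n (D e) * (∑[ j < 3 ] b2n (does (toE (inc (fromV v) j) ≟ e))))       ≡⟨ sum-cong-≗ {nE} (λ e → *-distribˡ-sum {3} (b2n (D e)) (λ j → b2n (does (toE (inc (fromV v) j) ≟ e)))) ⟩
    ∑[ e < nE ] ∑[ j < 3 ] (b2n (D e) * b2n (does (toE (inc (fromV v) j) ≟ e)))         ≡⟨ ∑-comm {nE} {3} (λ e j → b2n (D e) * b2n (does (toE (inc (fromV v) j) ≟ e))) ⟩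
    ∑[ j < 3 ] ∑[ e < nE ] (b2n (D e) * b2n (does (toE (inc (fromV v) j) ≟ e)))         ≡⟨ sum-cong-≗ {3} (λ j → trans (sum-cong-≗ {nE} (λ e → *-comm (b2n (D e)) (b2n (does (toE (inc (fromV v) j) ≟ e))))) (∑-indicator (toE (inc (fromV v) j)) (b2n ∘ D))) ⟩
    ∑[ j < 3 ] b2n (D (toE (inc (fromV v) j)))                                          ≡⟨ cong (λ z → b2n (D (toE (inc (fromV v) 0F))) + (b2n (D (toE (inc (fromV v) 1F))) + z)) (+-identityʳ _) ⟩
    degV (D ∘ toE) (fromV v)                                                            ∎
    where open ≡-Reasoning

  cubic : Cubic graph
  cubic v = degIn≡degV (allEdges graph) v

  perfectMatching⇒ : ∀ {M} → PerfectMatching graph M → ∀ v → degV (M ∘ toE) v ≡ 1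
  perfectMatching⇒ {M} pm v =
    trans (cong (degV (M ∘ toE)) (sym (fromV-toV v))) (trans (sym (degIn≡degV M (toV v))) (pm (toV v)))

  degV-cong : ∀ {D D' : E → Bool} → (∀ e → D e ≡ D' e) → ∀ v → degV D v ≡ degV D' v
  degV-cong h v = cong₂ _+_ (cong b2n (h _)) (cong₂ _+_ (cong b2n (h _)) (cong b2n (h _)))

  degV⇒degIn : ∀ D k → (∀ v → degV D v ≡ k) → ∀ v → degIn graph (D ∘ fromE) v ≡ k
  degV⇒degIn D k h v =
    trans (degIn≡degV (D ∘ fromE) v) (trans (degV-cong (λ e → cong D (fromE-toE e)) (fromV v)) (h (fromV v)))

  countE : (E → Bool) → ℕ
  countE D = countF nE (D ∘ fromE)

-- Exhaustive search, and the Petersen graph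

countL : List Bool → ℕ
countL bs = sum (map b2n bs)

countL-++ : ∀ xs ys → countL (xs ++ ys) ≡ countL xs + countL ys
countL-++ xs ys = trans (cong sum (map-++ b2n xs ys)) (sum-++ (map b2n xs) (map b2n ys))

all-∈ : ∀ {A : Set} (p : A → Bool) {as a} → all p as ≡ true → a ∈ as → p a ≡ true
all-∈ p {x ∷ as} h i with p x in eq
all-∈ p {x ∷ as} h (here refl) | true = eq
all-∈ p {x ∷ as} h (there i)   | true = all-∈ p h i

-- Assignments of values to a sequence of variables, built one variable at a time and pruned as soon
-- as the number of violated binary constraints exceeds a budget. The entry of `pss` belonging to a
-- variable lists the earlier variables constrained together with it, as distances back.
module Search {A : Set} (vals : List A) (complete : ∀ a → a ∈ vals)
              (violates : A → A → Bool) (good : List A → Bool) where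

  against : A → List A → ℕ → Bool
  against a []       _       = false
  against a (x ∷ xs) zero    = violates a x
  against a (x ∷ xs) (suc o) = against a xs o

  conflicts : A → List A → List ℕ → List Bool
  conflicts a xs ps = map (against a xs) ps

  search : List (List ℕ) → ℕ → List A → Bool
  search []         b xs = good xs
  search (ps ∷ pss) b xs = all branch vals
    where
    branch : A → Bool
    branch a with countL (conflicts a xs ps)
    -- A pruned branch counts as success, because soundness speaks only of assignments within the
    -- budget.
    ... | c = if c ≤ᵇ b then search pss (b ∸ c) (a ∷ xs) else true

  violations : List (List ℕ) → List A → List A → List Bool
  violations (ps ∷ pss) (y ∷ ys) xs = conflicts y xs ps ++ violations pss ys (y ∷ xs)
  violations _          _        xs = []

  split : ∀ ps pss y ys xs → countL (violations (ps ∷ pss) (y ∷ ys) xs) ≡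
          countL (violations pss ys (y ∷ xs)) + countL (conflicts y xs ps)
  split ps pss y ys xs = trans (countL-++ (conflicts y xs ps) _) (+-comm (countL (conflicts y xs ps)) _)

  -- Every assignment follows its own branch of the search: the budget pays for the conflicts of
  -- each variable in turn, so the branch is never pruned. Values are accumulated in reverse, hence
  -- `ʳ++`.
  search-sound : ∀ pss ys b xs → length ys ≡ length pss → search pss b xs ≡ true →
                 countL (violations pss ys xs) ≤ b → good (ys ʳ++ xs) ≡ true
  search-sound []         []       b xs _ s _ = s
  search-sound (ps ∷ pss) (y ∷ ys) b xs l s v
    with countL (conflicts y xs ps) | all-∈ _ s (complete y) | subst (_≤ b) (split ps pss y ys xs) v
  ... | c | s′ | v′ with c ≤ᵇ b in le
  ...   | true  = search-sound pss ys (b ∸ c) (y ∷ xs) (ℕ-suc-injective l) s′ (m+n≤o⇒m≤o∸n _ v′)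
  ...   | false = ⊥-elim (subst T le (≤⇒≤ᵇ (≤-trans (m≤n+m c _) v′)))

record Rainbow (a b c : Fin 3) : Set where
  constructor distinct
  field
    a≢b : a ≢ b
    a≢c : a ≢ c
    b≢c : b ≢ c

countL-none : ∀ {bs} → All (_≡ false) bs → countL bs ≡ 0
countL-none []         = refl
countL-none (refl ∷ h) = countL-none h

fin3-complete : (a : Fin 3) → a ∈ (0F ∷ 1F ∷ 2F ∷ [])
fin3-complete 0F = here refl
fin3-complete 1F = there (here refl)
fin3-complete 2F = there (there (here refl))

-- As `good` is always false, a successful search with budget 0 says that every assignment violates
-- some constraint.
module PetersenSearch =
  Search {A = Fin 3} (0F ∷ 1F ∷ 2F ∷ []) fin3-complete
         (λ a b → does (a ≟ b)) (λ _ → false)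

module Petersen where
  open PetersenSearch public

  -- The line graph of the Petersen graph: its 30 pairs of adjacent edges, each recorded at the
  -- later edge.
  earlier : List (List ℕ)
  earlier = [] ∷ (0 ∷ []) ∷ (0 ∷ []) ∷ (0 ∷ []) ∷ (0 ∷ []) ∷ (0 ∷ []) ∷ (0 ∷ [])
          ∷ (0 ∷ 4 ∷ 5 ∷ []) ∷ (2 ∷ 3 ∷ 6 ∷ 7 ∷ []) ∷ (2 ∷ 3 ∷ []) ∷ (0 ∷ 6 ∷ 7 ∷ [])
          ∷ (0 ∷ 1 ∷ 10 ∷ []) ∷ (7 ∷ 8 ∷ []) ∷ (0 ∷ 5 ∷ 6 ∷ []) ∷ (0 ∷ 1 ∷ 2 ∷ 13 ∷ []) ∷ []

  exhausted : search earlier 0 [] ≡ true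
  exhausted = refl

-- The vertices are 0, …, 7, u, v, and the edges in order are
-- 01, 12, 23, 34, 45, 56, 67, 27, 15, 6u, 3u, 0u, 4v, 7v, 0v.
petersen-uncolourable :
  ∀ c₀ c₁ c₂ c₃ c₄ c₅ c₆ c₇ c₈ c₉ c₁₀ c₁₁ c₁₂ c₁₃ c₁₄ →
  Rainbow c₀ c₁₄ c₁₁ → Rainbow c₁ c₀ c₈ → Rainbow c₂ c₁ c₇ → Rainbow c₃ c₂ c₁₀ →
  Rainbow c₄ c₃ c₁₂ → Rainbow c₅ c₄ c₈ → Rainbow c₆ c₅ c₉ → Rainbow c₁₃ c₆ c₇ →
  Rainbow c₉ c₁₀ c₁₁ → Rainbow c₁₂ c₁₃ c₁₄ → ⊥
petersen-uncolourable c₀ c₁ c₂ c₃ c₄ c₅ c₆ c₇ c₈ c₉ c₁₀ c₁₁ c₁₂ c₁₃ c₁₄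
  (distinct 0≢14 0≢11 14≢11) (distinct 1≢0 1≢8 0≢8) (distinct 2≢1 2≢7 1≢7) (distinct 3≢2 3≢10 2≢10)
  (distinct 4≢3 4≢12 3≢12) (distinct 5≢4 5≢8 4≢8) (distinct 6≢5 6≢9 5≢9) (distinct 13≢6 13≢7 6≢7)
  (distinct 9≢10 9≢11 10≢11) (distinct 12≢13 12≢14 13≢14)
  = false≢true (search-sound earlier colours 0 [] refl exhausted (≤-reflexive (countL-none proper)))
  where
  open Petersen
  colours : List (Fin 3)
  colours = c₀ ∷ c₁ ∷ c₂ ∷ c₃ ∷ c₄ ∷ c₅ ∷ c₆ ∷ c₇ ∷ c₈ ∷ c₉ ∷ c₁₀ ∷ c₁₁ ∷ c₁₂ ∷ c₁₃ ∷ c₁₄ ∷ []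
  ≢₁ : ∀ {a b : Fin 3} → a ≢ b → does (a ≟ b) ≡ false
  ≢₁ p = dec-false (_ ≟ _) p
  ≢₂ : ∀ {a b : Fin 3} → a ≢ b → does (b ≟ a) ≡ false
  ≢₂ p = dec-false (_ ≟ _) (λ q → p (sym q))
  proper : All (_≡ false) (violations earlier colours [])
  proper = ≢₁ 1≢0 ∷ ≢₁ 2≢1 ∷ ≢₁ 3≢2 ∷ ≢₁ 4≢3 ∷ ≢₁ 5≢4 ∷ ≢₁ 6≢5
         ∷ ≢₂ 6≢7 ∷ ≢₂ 2≢7 ∷ ≢₂ 1≢7
         ∷ ≢₂ 5≢8 ∷ ≢₂ 4≢8 ∷ ≢₂ 1≢8 ∷ ≢₂ 0≢8
         ∷ ≢₂ 6≢9 ∷ ≢₂ 5≢9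
         ∷ ≢₂ 9≢10 ∷ ≢₂ 3≢10 ∷ ≢₂ 2≢10
         ∷ ≢₂ 10≢11 ∷ ≢₂ 9≢11 ∷ ≢₂ 0≢11
         ∷ ≢₂ 4≢12 ∷ ≢₂ 3≢12
         ∷ ≢₂ 12≢13 ∷ ≢₁ 13≢7 ∷ ≢₁ 13≢6
         ∷ ≢₂ 13≢14 ∷ ≢₂ 12≢14 ∷ ≢₁ 14≢11 ∷ ≢₂ 0≢14 ∷ []

-- Connectivity from small edge cuts

countF-strict : ∀ k (P Q : Fin k → Bool) → (∀ i → P i ≡ true → Q i ≡ true) →
                ∀ j → P j ≡ false → Q j ≡ true → countF k P < countF k Q
countF-strict k P Q h j pj qj = subst₂ _<_ (sym (countF≡∑ k P)) (sym (countF≡∑ k Q)) (go k P Q h j pj qj)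
  where
  le : ∀ p q → (p ≡ true → q ≡ true) → b2n p ≤ b2n q
  le false q     h = z≤n
  le true  true  h = ≤-refl
  le true  false h with h refl
  ... | ()
  go : ∀ k (P Q : Fin k → Bool) → (∀ i → P i ≡ true → Q i ≡ true) →
       ∀ j → P j ≡ false → Q j ≡ true → ∑[ i < k ] b2n (P i) < ∑[ i < k ] b2n (Q i)
  go (suc k) P Q h zero pj qj rewrite pj | qj = s≤s (∑-mono k _ _ (λ i → le (P (suc i)) (Q (suc i)) (h (suc i))))
  go (suc k) P Q h (suc j) pj qj = +-mono-≤-< (le (P zero) (Q zero) (h zero)) (go k (P ∘ suc) (Q ∘ suc) (h ∘ suc) j pj qj)

module Reachability (G : Graph) (W : Fin (n G) → Bool) (F : EdgeSet G) where

  reach-snoc : ∀ {u a b} e → Reach G W F u a → F e ≡ true → Joins G e a b → W b ≡ true → Reach G W F u b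
  reach-snoc e (here w)          f j wb = step e w f j (here wb)
  reach-snoc e (step e' w f' j' r) f j wb = step e' w f' j' (reach-snoc e r f j wb)

  reach-target : ∀ {u v} → Reach G W F u v → W v ≡ true
  reach-target (here w)         = w
  reach-target (step _ _ _ _ r) = reach-target r

  record Component (u : Fin (n G)) : Set where
    field
      S      : Fin (n G) → Bool
      start  : S u ≡ true
      sound  : ∀ v → S v ≡ true → Reach G W F u v
      closed : ∀ {a b} e → F e ≡ true → Joins G e a b → W b ≡ true → S a ≡ true → S b ≡ true

  Leaves : (Fin (n G) → Bool) → Fin (n G) × Fin (n G) → Set
  Leaves S (a , b) = S a ≡ true × S b ≡ false × W b ≡ true

  -- The set `S` grows from the start vertex by one vertex for each edge that leaves it. The fuel of
  -- `grow` bounds the number of vertices outside `S`, which strictly decreases.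
  component : ∀ u → W u ≡ true → Component u
  component u wu = grow _ (λ v → does (v ≟ u)) (dec-true (u ≟ u) refl) atStart ≤-refl
    where
    atStart : ∀ v → does (v ≟ u) ≡ true → Reach G W F u v
    atStart v p with does-true v u p
    ... | refl = here wu

    Crossing : (Fin (n G) → Bool) → Fin (m G) → Set
    Crossing S e = F e ≡ true × (Leaves S (ends G e) ⊎ Leaves S (proj₂ (ends G e) , proj₁ (ends G e)))

    leaves? : ∀ S ab → Dec (Leaves S ab)
    leaves? S (a , b) = (S a Bool.≟ true) ×-dec (S b Bool.≟ false) ×-dec (W b Bool.≟ true)

    crossing? : ∀ S e → Dec (Crossing S e)
    crossing? S e = (F e Bool.≟ true) ×-dec (leaves? S (ends G e) ⊎-dec leaves? S (proj₂ (ends G e) , proj₁ (ends G e)))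

    crossing-ends : ∀ S e → Crossing S e → ∃[ a ] ∃[ b ] F e ≡ true × Joins G e a b × Leaves S (a , b)
    crossing-ends S e (f , inj₁ l) = _ , _ , f , inj₁ refl , l
    crossing-ends S e (f , inj₂ l) = _ , _ , f , inj₂ refl , l

    grow : ∀ k S → S u ≡ true → (∀ v → S v ≡ true → Reach G W F u v) → countF (n G) (not ∘ S) ≤ k → Component u
    grow k S s r c with any? (crossing? S)
    ... | no ¬x = record { S = S ; start = s ; sound = r ; closed = cl }
      where
      cl : ∀ {a b} e → F e ≡ true → Joins G e a b → W b ≡ true → S a ≡ true → S b ≡ true
      cl {a} {b} e f j wb sa with S b in sb
      ... | true = refl
      ... | false with j
      ...   | inj₁ p = ⊥-elim (¬x (e , f , inj₁ (subst (Leaves S) (sym p) (sa , sb , wb))))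
      ...   | inj₂ p = ⊥-elim (¬x (e , f , inj₂ (subst (Leaves S) (cong (λ z → proj₂ z , proj₁ z) (sym p)) (sa , sb , wb))))
    grow k S s r c | yes (e , x) with crossing-ends S e x
    ... | a , b , f , j , sa , sb , wb = next k c
      where
      S' : Fin (n G) → Bool
      S' v = S v ∨ does (v ≟ b)
      r' : ∀ v → S' v ≡ true → Reach G W F u v
      r' v p with S v in sv
      ... | true = r v sv
      ... | false with does-true v b p
      ...   | refl = reach-snoc e (r a sa) f j wb
      shrink : countF (n G) (not ∘ S') < countF (n G) (not ∘ S)
      shrink = countF-strict (n G) (not ∘ S') (not ∘ S) mono b
        (cong not (trans (cong (S b ∨_) (dec-true (b ≟ b) refl)) (∨-zeroʳ (S b)))) (cong not sb)
        where
        mono : ∀ i → not (S' i) ≡ true → not (S i) ≡ true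
        mono i p with S i
        ... | false = refl
        mono i () | true
      next : ∀ k → countF (n G) (not ∘ S) ≤ k → Component u
      next zero    c = ⊥-elim (n≮0 (<-≤-trans shrink c))
      next (suc k) c = grow k S' (cong (_∨ does (u ≟ b)) s) r' (s≤s⁻¹ (<-≤-trans shrink c))

module Cuts (Γ : CubicGraph) where
  open CubicGraph Γ

  bichromatic : (V → Bool) → E → Bool
  bichromatic f e = f (end e false) xor f (end e true)

  -- The three edges at a single vertex always form a cut, so this is the most that a bound of three
  -- on the bichromatic edges can give.
  AlmostConstant : (V → Bool) → Set
  AlmostConstant f = ∃[ x ] ∃[ b ] (∀ v → v ≢ x → f v ≡ b)

  nbr : V → Fin 3 → V
  nbr v j = end (inc v j) (not (proj₂ (dart v j)))

  joins-inc : ∀ v j → Joins graph (toE (inc v j)) (toV v) (toV (nbr v j))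
  joins-inc v j with dart v j | end-inc v j
  ... | e , false | refl = inj₁ (cong (λ z → toV (end z false) , toV (end z true)) (fromE-toE e))
  ... | e , true  | refl = inj₂ (cong (λ z → toV (end z false) , toV (end z true)) (fromE-toE e))

  joins-nbr : ∀ u j → Joins graph (toE (inc (fromV u) j)) u (toV (nbr (fromV u) j))
  joins-nbr u j = subst (λ z → Joins graph (toE (inc (fromV u) j)) z (toV (nbr (fromV u) j))) (toV-fromV u) (joins-inc (fromV u) j)

  nbr≢ : ∀ v j → nbr v j ≢ v
  nbr≢ v j p with dart v j | end-inc v j
  ... | e , false | q = no-loop e (trans p (sym q))
  ... | e , true  | q = no-loop e (trans q (sym p))

  module _ (cut : ∀ f → countE (bichromatic f) ≤ 3 → AlmostConstant f) where

    cut-set : ∀ (R : EdgeSet graph) (S : Fin nV → Bool) → countF nE R ≤ 3 →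
      (∀ {a b} e → R e ≡ false → Joins graph e a b → S a ≡ true → S b ≡ true) → AlmostConstant (S ∘ toV)
    cut-set R S r cl = cut (S ∘ toV) (≤-trans (countF-mono nE _ R inR) r)
      where
      inR : ∀ e → bichromatic (S ∘ toV) (fromE e) ≡ true → R e ≡ true
      inR e p with R e in re
      ... | true = refl
      ... | false with S (toV (end (fromE e) false)) in a | S (toV (end (fromE e) true)) in b
      ...   | true  | false = ⊥-elim (false≢true (trans (sym b) (cl e re (inj₁ refl) a)))
      ...   | false | true  = ⊥-elim (false≢true (trans (sym a) (cl e re (inj₂ refl) b)))
      inR e () | false | true  | true
      inR e () | false | false | false

    -- The exceptional vertex lies on one of the two sides, and that side then contains nothing
    -- else.
    isolated : ∀ {S : Fin nV → Bool} {a c} → AlmostConstant (S ∘ toV) → S a ≡ true → S c ≡ false →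
      (∀ v → S v ≡ true → v ≡ a) ⊎ (∀ v → S v ≡ false → v ≡ c)
    isolated {S} {a} {c} (x , b , h) sa sc = by b exceptional
      where
      exceptional : ∀ v → S v ≢ b → v ≡ toV x
      exceptional v ne with v ≟ toV x
      ... | yes p = p
      ... | no ¬p = ⊥-elim (ne (trans (cong S (sym (toV-fromV v)))
                      (h (fromV v) (λ q → ¬p (trans (sym (toV-fromV v)) (cong toV q))))))
      by : ∀ b → (∀ v → S v ≢ b → v ≡ toV x) → (∀ v → S v ≡ true → v ≡ a) ⊎ (∀ v → S v ≡ false → v ≡ c)
      by true  exc = inj₂ λ v sv → trans (exc v (λ p → false≢true (trans (sym sv) p)))
                                         (sym (exc c (λ p → false≢true (trans (sym sc) p))))
      by false exc = inj₁ λ v sv → trans (exc v (λ p → false≢true (trans (sym p) sv)))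
                                         (sym (exc a (λ p → false≢true (trans (sym p) sa))))

    -- Keeps a circuit from lying in a side of a cut that has only one vertex. Length one would be a
    -- loop.
    circuit-edge : ∀ {F} (C : Circuit graph F) →
      ∃[ e ] ∃[ w ] w ≢ vs C zero × F e ≡ true × Joins graph e (vs C zero) w
    circuit-edge record { k = zero ; vs = vs ; es = es ; es-in = es-in ; close = close } =
      ⊥-elim (no-loop (fromE (es zero)) (toV-injective (loop close)))
      where
      loop : Joins graph (es zero) (vs zero) (vs zero) → toV (end (fromE (es zero)) true) ≡ toV (end (fromE (es zero)) false)
      loop (inj₁ p) = trans (cong proj₂ p) (sym (cong proj₁ p))
      loop (inj₂ p) = trans (cong proj₂ p) (sym (cong proj₁ p))
    circuit-edge record { k = suc k ; vs = vs ; es = es ; vs-inj = vs-inj ; es-in = es-in ; links = links } =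
      es zero , vs 1F , (λ p → 0≢1 (vs-inj (sym p))) , es-in zero , links zero

    -- If the component of the first circuit misses the second one, one side of the cut is a single
    -- vertex; but each side contains both ends of an edge of its circuit.
    cyclicallyConnected : CyclicallyEdgeConnected graph 4
    cyclicallyConnected R r C₁ C₂ = decide (S (vs C₂ zero)) refl
      where
      open Reachability graph (allV graph) (λ e → not (R e))
      open Component (component (vs C₁ zero) refl)
      almost : AlmostConstant (S ∘ toV)
      almost = cut-set R S (s≤s⁻¹ r) (λ e re j sa → closed e (cong not re) j refl sa)
      decide : ∀ b → S (vs C₂ zero) ≡ b → Reach graph (allV graph) (λ e → not (R e)) (vs C₁ zero) (vs C₂ zero)
      decide true  p = sound _ p
      decide false p with isolated {S} almost start p | circuit-edge C₁ | circuit-edge C₂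
      ... | inj₁ only | e , w , w≢ , f , j | _ = ⊥-elim (w≢ (only w (closed e f j refl start)))
      ... | inj₂ only | _ | e , w , w≢ , f , j with S w in sw
      ...   | false = ⊥-elim (w≢ (only w sw))
      ...   | true  = ⊥-elim (false≢true (trans (sym p) (closed e f (swap j) refl sw)))

    connected : Connected graph
    connected u v = decide (S v) refl
      where
      open Reachability graph (allV graph) (allEdges graph)
      open Component (component u refl)
      almost : AlmostConstant (S ∘ toV)
      almost = cut-set (λ _ → false) S (≤-trans (≤-reflexive (countF-none nE _ (λ _ → refl))) z≤n)
                 (λ e _ j sa → closed e refl j refl sa)
      decide : ∀ b → S v ≡ b → Reach graph (allV graph) (allEdges graph) u v
      decide true  p = sound _ p
      decide false p with isolated {S} almost start p
      ... | inj₁ only = ⊥-elim (nbr≢ (fromV u) 0F (toV-injective (trans (only _ (closed _ refl (joins-nbr u 0F) refl start)) (sym (toV-fromV u)))))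
      ... | inj₂ only with S (toV (nbr (fromV v) 0F)) in sw
      ...   | false = ⊥-elim (nbr≢ (fromV v) 0F (toV-injective (trans (only _ sw) (sym (toV-fromV v)))))
      ...   | true  = ⊥-elim (false≢true (trans (sym p) (closed _ refl (swap (joins-nbr v 0F)) refl sw)))

    module _ (simple : ∀ v {j k} → nbr v j ≡ nbr v k → j ≡ k) where

      -- Here the cut consists of the three edges at `x`. The side without `u` contains both `x` and
      -- `v`; if the other side were `u` alone, all neighbours of `u` would be `x`, against
      -- `simple`.
      connectedWithout : ∀ (x u v : Fin nV) → u ≢ x → v ≢ x →
        Reach graph (λ w → not (does (w ≟ x))) (allEdges graph) u v
      connectedWithout x u v u≢x v≢x = decide (S v) refl
        where
        W : Fin nV → Bool
        W w = not (does (w ≟ x))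
        open Reachability graph W (allEdges graph)
        off : ∀ {w} → w ≢ x → W w ≡ true
        off ne = cong not (dec-false (_ ≟ x) ne)
        open Component (component u (off u≢x))
        Sx : S x ≡ false
        Sx with S x in sx
        ... | false = refl
        ... | true with reach-target (sound x sx)
        ...   | p rewrite dec-true (x ≟ x) refl = ⊥-elim (false≢true p)
        R : EdgeSet graph
        R e = does (toE (inc (fromV x) 0F) ≟ e) ∨ does (toE (inc (fromV x) 1F) ≟ e) ∨ does (toE (inc (fromV x) 2F) ≟ e)
        R≤3 : countF nE R ≤ 3
        R≤3 = ≤-trans (≤-reflexive (countF≡∑ nE R)) (≤-trans (∑-mono nE _ _ below) (≤-reflexive total))
          where
          below : ∀ e → b2n (R e) ≤ b2n (allEdges graph e) * endsAt graph e x
          below e rewrite endsAt-inc e x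
            with does (toE (inc (fromV x) 0F) ≟ e) | does (toE (inc (fromV x) 1F) ≟ e) | does (toE (inc (fromV x) 2F) ≟ e)
          ... | true  | _     | _     = s≤s z≤n
          ... | false | true  | _     = s≤s z≤n
          ... | false | false | true  = s≤s z≤n
          ... | false | false | false = z≤n
          total : ∑[ e < nE ] (b2n (allEdges graph e) * endsAt graph e x) ≡ 3
          total = trans (sym (degIn≡∑ graph (allEdges graph) x)) (cubic x)
        inR : ∀ e b → toV (end (fromE e) b) ≡ x → R e ≡ true
        inR e b p with slot (fromV x) (fromE e) (b , trans (sym (fromV-toV _)) (cong fromV p))
        ... | 0F , q rewrite dec-true (toE (inc (fromV x) 0F) ≟ e) (trans (cong toE q) (toE-fromE e)) = refl
        ... | 1F , q rewrite dec-true (toE (inc (fromV x) 1F) ≟ e) (trans (cong toE q) (toE-fromE e)) = ∨-zeroʳ _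
        ... | 2F , q rewrite dec-true (toE (inc (fromV x) 2F) ≟ e) (trans (cong toE q) (toE-fromE e)) =
          trans (cong (does (toE (inc (fromV x) 0F) ≟ e) ∨_) (∨-zeroʳ _)) (∨-zeroʳ _)
        avoid : ∀ {a b} e → R e ≡ false → Joins graph e a b → b ≢ x
        avoid e re (inj₁ p) q = false≢true (trans (sym re) (inR e true (trans (cong proj₂ p) q)))
        avoid e re (inj₂ p) q = false≢true (trans (sym re) (inR e false (trans (cong proj₁ p) q)))
        almost : AlmostConstant (S ∘ toV)
        almost = cut-set R S R≤3 (λ e re j sa → closed e refl j (off (avoid e re j)) sa)
        toX : (∀ w → S w ≡ true → w ≡ u) → ∀ j → toV (nbr (fromV u) j) ≡ x
        toX only j with toV (nbr (fromV u) j) ≟ x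
        ... | yes p = p
        ... | no ¬p = ⊥-elim (nbr≢ (fromV u) j (toV-injective (trans (only _ (closed _ refl (joins-nbr u j) (off ¬p) start)) (sym (toV-fromV u)))))
        decide : ∀ b → S v ≡ b → Reach graph W (allEdges graph) u v
        decide true  p = sound _ p
        decide false p with isolated {S} almost start p
        ... | inj₂ only = ⊥-elim (v≢x (sym (only x Sx)))
        ... | inj₁ only with simple (fromV u) {0F} {1F} (toV-injective (trans (toX only 0F) (sym (toX only 1F))))
        ...   | ()

      twoConnected : 2 < nV → TwoConnected graph
      twoConnected big = big , connected , connectedWithout

-- Girth

∧-left : ∀ {a b} → a ∧ b ≡ true → a ≡ true
∧-left {true} _ = refl

∧-right : ∀ {a b} → a ∧ b ≡ true → b ≡ true
∧-right {true} h = h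

module Trails (Γ : CubicGraph) where
  open CubicGraph Γ
  open Cuts Γ using (nbr; nbr≢)

  arrive : V → Fin 3 → Fin 3
  arrive v j = proj₂ (back (inc v j) (not (proj₂ (dart v j))))

  inc-arrive : ∀ v j → inc (nbr v j) (arrive v j) ≡ inc v j
  inc-arrive v j = inc-end (inc v j) (not (proj₂ (dart v j)))

  -- Walks that never go straight back along the edge just used. The number counts the turns, so a
  -- trail has one edge more.
  data Trail (w : V) : V → Fin 3 → ℕ → Set where
    done : ∀ {v j} → nbr v j ≡ w → Trail w v j 0
    more : ∀ {v j j' k} → j' ≢ arrive v j → Trail w (nbr v j) j' k → Trail w v j (suc k)

  joins-slot : ∀ {e a b} → Joins graph e a b → ∃[ j ] inc (fromV a) j ≡ fromE e × nbr (fromV a) j ≡ fromV b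
  joins-slot {e} {a} {b} = λ { (inj₁ p) → at false (trans (sym (fromV-toV _)) (cong (fromV ∘ proj₁) p)) (trans (sym (fromV-toV _)) (cong (fromV ∘ proj₂) p))
                             ; (inj₂ p) → at true (trans (sym (fromV-toV _)) (cong (fromV ∘ proj₂) p)) (trans (sym (fromV-toV _)) (cong (fromV ∘ proj₁) p)) }
    where
    at : ∀ s → end (fromE e) s ≡ fromV a → end (fromE e) (not s) ≡ fromV b →
         ∃[ j ] inc (fromV a) j ≡ fromE e × nbr (fromV a) j ≡ fromV b
    at s p q = proj₂ (back (fromE e) s) , cong proj₁ d , trans (cong (λ z → end (proj₁ z) (not (proj₂ z))) d) q
      where
      d : dart (fromV a) (proj₂ (back (fromE e) s)) ≡ (fromE e , s)
      d = trans (cong (λ z → dart z (proj₂ (back (fromE e) s))) (sym p)) (dart-back (fromE e) s)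

  turn : ∀ {v j w j' e e'} → inc v j ≡ e → nbr v j ≡ w → inc w j' ≡ e' → e ≢ e' → j' ≢ arrive v j
  turn {v} {j} refl refl refl ne p = ne (trans (sym (inc-arrive v j)) (cong (inc (nbr v j)) (sym p)))

  -- Consecutive edges of a circuit are distinct, so going round it is a trail. Only lengths 1 to 4
  -- have to be excluded, and length 1 is a loop.
  no-short-trail⇒girth : (∀ v j k → k ≤ 3 → ¬ Trail v v j k) → GirthAtLeast graph 5
  no-short-trail⇒girth h C with k C in kC
  ... | suc (suc (suc (suc _))) = s≤s (s≤s (s≤s (s≤s (s≤s z≤n))))
  no-short-trail⇒girth h record { k = 0 ; close = c } | 0 with joins-slot c
  ... | j , _ , p = ⊥-elim (nbr≢ _ j p)
  no-short-trail⇒girth h record { k = 1 ; es = es ; es-inj = inj ; links = l ; close = c } | 1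
    with joins-slot (l 0F) | joins-slot c
  ... | j₀ , i₀ , n₀ | j₁ , i₁ , n₁ = ⊥-elim (h _ j₀ 1 (s≤s z≤n)
    (more {j' = j₁} (turn i₀ n₀ i₁ (λ p → 0≢1 (inj (fromE-injective p))))
      (done (trans (cong (λ z → nbr z j₁) n₀) n₁))))
  no-short-trail⇒girth h record { k = 2 ; es = es ; es-inj = inj ; links = l ; close = c } | 2
    with joins-slot (l 0F) | joins-slot (l 1F) | joins-slot c
  ... | j₀ , i₀ , n₀ | j₁ , i₁ , n₁ | j₂ , i₂ , n₂ = ⊥-elim (h _ j₀ 2 (s≤s (s≤s z≤n))
    (more {j' = j₁} (turn i₀ n₀ i₁ (λ p → 0≢1 (inj (fromE-injective p))))
      (subst (λ z → Trail _ z j₁ 1) (sym n₀)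
        (more {j' = j₂} (turn i₁ n₁ i₂ (λ p → 1≢2 (inj (fromE-injective p))))
          (done (trans (cong (λ z → nbr z j₂) n₁) n₂))))))
  no-short-trail⇒girth h record { k = 3 ; es = es ; es-inj = inj ; links = l ; close = c } | 3
    with joins-slot (l 0F) | joins-slot (l 1F) | joins-slot (l 2F) | joins-slot c
  ... | j₀ , i₀ , n₀ | j₁ , i₁ , n₁ | j₂ , i₂ , n₂ | j₃ , i₃ , n₃ = ⊥-elim (h _ j₀ 3 (s≤s (s≤s (s≤s z≤n)))
    (more {j' = j₁} (turn i₀ n₀ i₁ (λ p → 0≢1 (inj (fromE-injective p))))
      (subst (λ z → Trail _ z j₁ 2) (sym n₀)
        (more {j' = j₂} (turn i₁ n₁ i₂ (λ p → 1≢2 (inj (fromE-injective p))))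
          (subst (λ z → Trail _ z j₂ 1) (sym n₁)
            (more {j' = j₃} (turn i₂ n₂ i₃ (λ p → 2≢3 (inj (fromE-injective p))))
              (done (trans (cong (λ z → nbr z j₃) n₂) n₃))))))))

  -- Two slots leading to the same neighbour give a closed trail with one turn: out through one slot
  -- and back through the other.
  no-short-trail⇒simple : (∀ v j k → k ≤ 3 → ¬ Trail v v j k) → ∀ v {j k} → nbr v j ≡ nbr v k → j ≡ k
  no-short-trail⇒simple h v {j} {k} p with j ≟ k
  ... | yes q = q
  ... | no ¬q = ⊥-elim (h v j 1 (s≤s z≤n) (more {j' = arrive v k} ne (done (trans (cong (λ z → nbr z (arrive v k)) p) return))))
    where
    ne : arrive v k ≢ arrive v j
    ne q = ¬q (inc-injective v (trans (sym (inc-arrive v j)) (trans (cong₂ inc p (sym q)) (inc-arrive v k))))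
    return : nbr (nbr v k) (arrive v k) ≡ v
    return = trans (cong (λ z → end (proj₁ z) (not (proj₂ z))) (dart-back (inc v k) (not (proj₂ (dart v k)))))
      (trans (cong (end (inc v k)) (not-involutive (proj₂ (dart v k)))) (end-inc v k))

  -- Walks of Γ are followed on the codes φ v of their vertices; `moves` lists all codes a step can lead to.
  module Coded {Code : Set} (index : Code → ℕ) (moves : Code → Fin 3 → List (Code × Fin 3)) (φ : V → Code)
               (moves-complete : ∀ v j → (φ (nbr v j) , arrive v j) ∈ moves (φ v) j) where

    noReturn : ℕ → ℕ → Code → Fin 3 → Bool
    after : ℕ → ℕ → Code × Fin 3 → Bool
    continue : ℕ → ℕ → Code → Fin 3 → Fin 3 → Bool
    noReturn k i c j = all (after k i) (moves c j)
    after zero    i (c , r) = not (index c ≡ᵇ i)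
    after (suc k) i (c , r) = not (index c ≡ᵇ i) ∧ all (continue k i c r) (0F ∷ 1F ∷ 2F ∷ [])

    continue k i c r j = does (j ≟ r) ∨ noReturn k i c j

    continue-sound : ∀ k i c r j → continue k i c r j ≡ true → j ≢ r → noReturn k i c j ≡ true
    continue-sound k i c r j h ne with j ≟ r
    ... | yes p = ⊥-elim (ne p)
    ... | no _  = h

    -- A closed trail maps to a closed walk of codes through the same slots. The check compares
    -- every intermediate code with the initial one, which treats all lengths up to the bound at
    -- once.
    noReturn-sound : ∀ K {w v j k} → noReturn K (index (φ w)) (φ v) j ≡ true → k ≤ K → ¬ Trail w v j k
    noReturn-sound K {w} {v} {j} r k≤K t = avoids K (all-∈ (after K (index (φ w))) r (moves-complete v j)) k≤K t
      where
      hit : not (index (φ w) ≡ᵇ index (φ w)) ≢ true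
      hit p with index (φ w) ≡ᵇ index (φ w) | ≡⇒≡ᵇ (index (φ w)) (index (φ w)) refl
      hit () | true | _
      avoids : ∀ K {k} → after K (index (φ w)) (φ (nbr v j) , arrive v j) ≡ true → k ≤ K → ¬ Trail w v j k
      avoids zero    a z≤n (done refl) = hit a
      avoids (suc K) a _   (done refl) = hit (∧-left a)
      avoids (suc K) a k≤K (more {j' = j'} ne t) = noReturn-sound K
        (continue-sound K (index (φ w)) (φ (nbr v j)) (arrive v j) j'
          (all-∈ (continue K (index (φ w)) (φ (nbr v j)) (arrive v j)) (∧-right {not (index (φ (nbr v j)) ≡ᵇ index (φ w))} a) (fin3-complete j')) ne)
        (s≤s⁻¹ k≤K) t

-- Circuits as orbits

module Orbits (Γ : CubicGraph) where
  open CubicGraph Γ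

  -- A 2-factor given by a successor map and coordinates: `orbit v` names the circuit through `v`,
  -- and `rank v` is the position on it. All conditions are local and can be checked by cases.
  -- `size j` is the largest rank, one less than the length.
  record Rotation (D : E → Bool) (r : ℕ) : Set where
    field
      succ       : V → V
      out        : V → E
      joins      : ∀ v → Σ Bool λ s → end (out v) s ≡ v × end (out v) (not s) ≡ succ v
      out-inj    : ∀ {v w} → out v ≡ out w → v ≡ w
      out-in     : ∀ v → D (out v) ≡ true
      orbit      : V → Fin r
      rank       : V → ℕ
      size       : Fin r → ℕ
      origin     : Fin r → V
      orbit-origin : ∀ j → orbit (origin j) ≡ j
      rank-origin  : ∀ j → rank (origin j) ≡ 0
      rank-zero    : ∀ v → rank v ≡ 0 → v ≡ origin (orbit v)
      rank≤size    : ∀ v → rank v ≤ size (orbit v)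
      orbit-succ   : ∀ v → orbit (succ v) ≡ orbit v
      rank-succ    : ∀ v → rank (succ v) ≡ suc (rank v) ⊎ (rank v ≡ size (orbit v) × succ v ≡ origin (orbit v))
      pred         : ∀ v → rank v ≢ 0 → ∃[ u ] succ u ≡ v

    iter : ℕ → V → V
    iter zero    v = v
    iter (suc k) v = succ (iter k v)

    orbit-iter : ∀ k j → orbit (iter k (origin j)) ≡ j
    orbit-iter zero    j = orbit-origin j
    orbit-iter (suc k) j = trans (orbit-succ _) (orbit-iter k j)

    rank-iter : ∀ k j → k ≤ size j → rank (iter k (origin j)) ≡ k
    rank-iter zero    j _ = rank-origin j
    rank-iter (suc k) j h with rank-succ (iter k (origin j)) | rank-iter k j (≤-trans (n≤1+n k) h)
    ... | inj₁ p       | q = trans p (cong suc q)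
    ... | inj₂ (p , _) | q = ⊥-elim (<-irrefl (trans (sym q) (trans p (cong size (orbit-iter k j)))) h)

    succ-last : ∀ j → succ (iter (size j) (origin j)) ≡ origin j
    succ-last j with rank-succ (iter (size j) (origin j))
    ... | inj₂ (_ , p) = trans p (cong origin (orbit-iter (size j) j))
    ... | inj₁ p = ⊥-elim (<-irrefl refl (≤-trans
            (≤-reflexive (sym (trans p (cong suc (rank-iter (size j) j ≤-refl)))))
            (≤-trans (rank≤size (succ (iter (size j) (origin j))))
              (≤-reflexive (cong size (trans (orbit-succ _) (orbit-iter (size j) j)))))))

    -- Descending through `pred` ends at rank zero, which only the origin has; hence the iterates of
    -- the origin exhaust its orbit class.
    iter-rank : ∀ k v → rank v ≡ k → iter k (origin (orbit v)) ≡ v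
    iter-rank zero    v p = sym (rank-zero v p)
    iter-rank (suc k) v p with pred v (λ q → 0≢1+n (trans (sym q) p))
    ... | u , refl with rank-succ u
    ...   | inj₁ q = cong succ (trans (cong (iter k ∘ origin) (orbit-succ u))
                       (iter-rank k u (ℕ-suc-injective (trans (sym q) p))))
    ...   | inj₂ (_ , q) = ⊥-elim (0≢1+n (trans (sym (rank-origin (orbit u))) (trans (cong rank (sym q)) p)))

    vertexAt : ∀ j → Fin (suc (size j)) → V
    vertexAt j i = iter (toℕ i) (origin j)

    joins-out : ∀ v → Joins graph (toE (out v)) (toV v) (toV (succ v))
    joins-out v with joins v
    ... | false , p , q = inj₁ (cong₂ _,_ (cong toV (trans (cong (λ e → end e false) (fromE-toE _)) p)) (cong toV (trans (cong (λ e → end e true) (fromE-toE _)) q)))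
    ... | true  , p , q = inj₂ (cong₂ _,_ (cong toV (trans (cong (λ e → end e false) (fromE-toE _)) q)) (cong toV (trans (cong (λ e → end e true) (fromE-toE _)) p)))

    vertexAt-injective : ∀ j {i i′} → vertexAt j i ≡ vertexAt j i′ → i ≡ i′
    vertexAt-injective j {i} {i′} p = toℕ-injective
      (trans (sym (rank-iter (toℕ i) j (toℕ≤pred[n] i))) (trans (cong rank p) (rank-iter (toℕ i′) j (toℕ≤pred[n] i′))))

    circuit : Fin r → Circuit graph (D ∘ fromE)
    circuit j = record
      { k      = size j
      ; vs     = toV ∘ vertexAt j
      ; es     = toE ∘ out ∘ vertexAt j
      ; vs-inj = λ p → vertexAt-injective j (toV-injective p)
      ; es-inj = λ p → vertexAt-injective j (out-inj (toE-injective p))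
      ; es-in  = λ i → trans (cong D (fromE-toE _)) (out-in _)
      ; links  = λ i → subst (λ k → Joins graph (toE (out (iter k (origin j)))) (toV (iter k (origin j))) (toV (succ (iter (toℕ i) (origin j)))))
                         (sym (toℕ-inject₁ i)) (joins-out (iter (toℕ i) (origin j)))
      ; close  = subst (λ k → Joins graph (toE (out (iter k (origin j)))) (toV (iter k (origin j))) (toV (origin j)))
                         (sym (toℕ-fromℕ (size j)))
                         (subst (λ w → Joins graph (toE (out (iter (size j) (origin j)))) (toV (iter (size j) (origin j))) (toV w))
                            (succ-last j) (joins-out (iter (size j) (origin j)))) }

    hasOddCircuits : ∀ {o} → countF r (λ j → oddᵇ (suc (size j))) ≡ o → HasOddCircuits graph (D ∘ fromE) o
    hasOddCircuits c = r , circuit , covers , apart , c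
      where
      covers : ∀ (v : Fin nV) → ∃[ j ] ∃[ i ] vs (circuit j) i ≡ v
      covers v = orbit u , i , trans (cong toV (trans (cong (λ k → iter k (origin (orbit u))) (toℕ-fromℕ< (s≤s (rank≤size u)))) (iter-rank (rank u) u refl))) (toV-fromV v)
        where
        u = fromV v
        i : Fin (suc (size (orbit u)))
        i = fromℕ< (s≤s (rank≤size u))
      apart : ∀ (j j′ : Fin r) i i′ → vs (circuit j) i ≡ vs (circuit j′) i′ → j ≡ j′
      apart j j′ i i′ p = trans (sym (orbit-iter (toℕ i) j)) (trans (cong orbit (toV-injective p)) (orbit-iter (toℕ i′) j′))

-- Oddness at least two

two-of-three : ∀ (d m : Fin 3 → Bool) a b → a ≢ b → d a ≡ true → d b ≡ true →
  b2n (d 0F) + (b2n (d 1F) + b2n (d 2F)) ≡ 2 → (∀ j → m j ≡ true → d j ≡ true) →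
  b2n (m 0F) + (b2n (m 1F) + b2n (m 2F)) ≡ b2n (m a) + b2n (m b)
two-of-three d m a b a≢b da db sum2 m⊆d = go a b a≢b da db
  where
  absent : ∀ j → d j ≡ false → m j ≡ false
  absent j dj with m j in eq
  ... | false = refl
  ... | true  = trans (sym (m⊆d j eq)) dj
  third₂ : d 0F ≡ true → d 1F ≡ true → m 2F ≡ false
  third₂ p p′ = absent 2F (rest₂ (d 0F) (d 1F) (d 2F) p p′ sum2)
    where
    rest₂ : ∀ a b c → a ≡ true → b ≡ true → b2n a + (b2n b + b2n c) ≡ 2 → c ≡ false
    rest₂ true true false _ _ _ = refl
  third₁ : d 0F ≡ true → d 2F ≡ true → m 1F ≡ false
  third₁ p p′ = absent 1F (rest₁ (d 0F) (d 1F) (d 2F) p p′ sum2)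
    where
    rest₁ : ∀ a b c → a ≡ true → c ≡ true → b2n a + (b2n b + b2n c) ≡ 2 → b ≡ false
    rest₁ true false true _ _ _ = refl
  third₀ : d 1F ≡ true → d 2F ≡ true → m 0F ≡ false
  third₀ p p′ = absent 0F (rest₀ (d 0F) (d 1F) (d 2F) p p′ sum2)
    where
    rest₀ : ∀ a b c → b ≡ true → c ≡ true → b2n a + (b2n b + b2n c) ≡ 2 → a ≡ false
    rest₀ false true true _ _ _ = refl
  go : ∀ a b → a ≢ b → d a ≡ true → d b ≡ true →
       b2n (m 0F) + (b2n (m 1F) + b2n (m 2F)) ≡ b2n (m a) + b2n (m b)
  go 0F 0F ne _ _ = ⊥-elim (ne refl)
  go 1F 1F ne _ _ = ⊥-elim (ne refl)
  go 2F 2F ne _ _ = ⊥-elim (ne refl)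
  go 0F 1F _ p p′ rewrite third₂ p p′ = cong (b2n (m 0F) +_) (+-identityʳ _)
  go 1F 0F _ p p′ rewrite third₂ p′ p = trans (cong (b2n (m 0F) +_) (+-identityʳ _)) (+-comm (b2n (m 0F)) _)
  go 0F 2F _ p p′ rewrite third₁ p p′ = refl
  go 2F 0F _ p p′ rewrite third₁ p′ p = +-comm (b2n (m 0F)) _
  go 1F 2F _ p p′ rewrite third₀ p p′ = refl
  go 2F 1F _ p p′ rewrite third₀ p′ p = +-comm (b2n (m 1F)) _

oddᵇ-suc : ∀ n → oddᵇ (suc n) ≡ not (oddᵇ n)
oddᵇ-suc zero    = refl
oddᵇ-suc (suc n) = trans (sym (not-involutive (oddᵇ n))) (cong not (sym (oddᵇ-suc n)))

oddᵇ-2*+ : ∀ n m → oddᵇ (2 * n + m) ≡ oddᵇ m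
oddᵇ-2*+ zero    m = refl
oddᵇ-2*+ (suc n) m = trans (cong oddᵇ (cong suc (cong (_+ m) (+-suc n (n + 0))))) (oddᵇ-2*+ n m)

module Oddness (Γ : CubicGraph) where
  open CubicGraph Γ
  open Trails Γ using (joins-slot)

  -- The edges `e` and `e′` are all that `D` has at `v`, so a subset of `D` can be counted on them.
  degree-subset : ∀ (D M : EdgeSet graph) v {e e′ w w′} → degIn graph D v ≡ 2 → (∀ e → M e ≡ true → D e ≡ true) →
    Joins graph e v w → Joins graph e′ v w′ → e ≢ e′ → D e ≡ true → D e′ ≡ true →
    degIn graph M v ≡ b2n (M e) + b2n (M e′)
  degree-subset D M v {e} {e′} deg M⊆D j j′ ne de de′ =
    let a , p , _ = joins-slot j
        b , p′ , _ = joins-slot j′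
        at : ∀ {x k} → inc (fromV v) k ≡ fromE x → toE (inc (fromV v) k) ≡ x
        at q = trans (cong toE q) (toE-fromE _)
    in trans (degIn≡degV M v)
         (trans (two-of-three (D ∘ toE ∘ inc (fromV v)) (M ∘ toE ∘ inc (fromV v)) a b
             (λ q → ne (trans (sym (at p)) (trans (cong (toE ∘ inc (fromV v)) q) (at p′))))
             (trans (cong D (at p)) de) (trans (cong D (at p′)) de′)
             (trans (sym (degIn≡degV D v)) deg) (λ k → M⊆D (toE (inc (fromV v) k))))
           (cong₂ (λ x y → b2n (M x) + b2n (M y)) (at p) (at p′)))

  sum-degrees : ∀ (A B C : EdgeSet graph) → (∀ e → b2n (A e) ≡ b2n (B e) + b2n (C e)) →
    ∀ v → degIn graph A v ≡ degIn graph B v + degIn graph C v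
  sum-degrees A B C h v = trans (degIn≡∑ graph A v)
    (trans (sum-cong-≗ {nE} (λ e → trans (cong (_* endsAt graph e v) (h e)) (*-distribʳ-+ (endsAt graph e v) (b2n (B e)) (b2n (C e)))))
      (trans (∑-distrib-+ {nE} (λ e → b2n (B e) * endsAt graph e v) (λ e → b2n (C e) * endsAt graph e v))
        (sym (cong₂ _+_ (degIn≡∑ graph B v) (degIn≡∑ graph C v)))))

  module _ {D : EdgeSet graph} where

    follow : (C : Circuit graph D) → ∀ {i : Fin (suc (k C))} → View i → Fin nV
    follow C ‵fromℕ       = vs C zero
    follow C (‵inject₁ i) = vs C (suc i)

    joins-follow : (C : Circuit graph D) → ∀ {i : Fin (suc (k C))} (w : View i) → Joins graph (es C i) (vs C i) (follow C w)
    joins-follow C ‵fromℕ       = close C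
    joins-follow C (‵inject₁ i) = links C i

    follow-on : (C : Circuit graph D) → ∀ {i : Fin (suc (k C))} (w : View i) → ∃[ i′ ] vs C i′ ≡ follow C w
    follow-on C ‵fromℕ       = zero , refl
    follow-on C (‵inject₁ i) = suc i , refl

    before : (C : Circuit graph D) → Fin (suc (k C)) → Fin (suc (k C))
    before C zero    = fromℕ (k C)
    before C (suc i) = inject₁ i

    joins-before : (C : Circuit graph D) → ∀ i → Joins graph (es C (before C i)) (vs C i) (vs C (before C i))
    joins-before C zero    = swap (close C)
    joins-before C (suc i) = swap (links C i)

    -- Equality would mean a circuit of length one, that is, a loop.
    before≢ : (C : Circuit graph D) → ∀ i → before C i ≢ i
    before≢ C zero p = loop (k C) (es C) (vs C) p (close C)
      where
      loop : ∀ k (es : Fin (suc k) → Fin nE) (vs : Fin (suc k) → Fin nV) → fromℕ k ≡ zero →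
             ¬ Joins graph (es (fromℕ k)) (vs (fromℕ k)) (vs zero)
      loop zero es vs _ (inj₁ p) = no-loop (fromE (es zero)) (toV-injective (trans (cong proj₂ p) (sym (cong proj₁ p))))
      loop zero es vs _ (inj₂ p) = no-loop (fromE (es zero)) (toV-injective (trans (cong proj₂ p) (sym (cong proj₁ p))))
    before≢ C (suc i) p = inject₁≢suc i p

  -- The edges at even positions of the circuits form a matching, except at the origins of the odd circuits.
  module Alternating (D : EdgeSet graph) (tf : TwoFactor graph D) {r : ℕ} (cs : Fin r → Circuit graph D)
    (covers : ∀ v → ∃[ j ] ∃[ i ] vs (cs j) i ≡ v)
    (apart : ∀ j j′ i i′ → vs (cs j) i ≡ vs (cs j′) i′ → j ≡ j′) where

    Chosen : Fin nE → Set
    Chosen e = ∃[ j ] ∃[ i ] es (cs j) i ≡ e × oddᵇ (toℕ i) ≡ false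

    chosen? : ∀ e → Dec (Chosen e)
    chosen? e = any? (λ j → any? (λ i → (es (cs j) i ≟ e) ×-dec (oddᵇ (toℕ i) Bool.≟ false)))

    N : EdgeSet graph
    N e = does (chosen? e)

    N⇒chosen : ∀ e → N e ≡ true → Chosen e
    N⇒chosen e p with chosen? e
    ... | yes c = c
    N⇒chosen e () | no _

    N⊆D : ∀ e → N e ≡ true → D e ≡ true
    N⊆D e p with N⇒chosen e p
    ... | j , i , refl , _ = es-in (cs j) i

    -- A common edge has the same ends in both circuits, and disjoint circuits share no vertex.
    same-circuit : ∀ j i j′ i′ → es (cs j′) i′ ≡ es (cs j) i → j′ ≡ j
    same-circuit j i j′ i′ p = go (joins-follow (cs j′) (view i′)) (subst (λ e → Joins graph e (vs (cs j) i) (follow (cs j) (view i))) (sym p) (joins-follow (cs j) (view i)))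
      where
      x : ∃[ i″ ] vs (cs j) i″ ≡ follow (cs j) (view i)
      x = follow-on (cs j) (view i)
      go : Joins graph (es (cs j′) i′) (vs (cs j′) i′) (follow (cs j′) (view i′)) →
           Joins graph (es (cs j′) i′) (vs (cs j) i) (follow (cs j) (view i)) → j′ ≡ j
      go (inj₁ a) (inj₁ b) = apart j′ j i′ i (cong proj₁ (trans (sym a) b))
      go (inj₂ a) (inj₂ b) = apart j′ j i′ i (cong proj₂ (trans (sym a) b))
      go (inj₁ a) (inj₂ b) = apart j′ j i′ (proj₁ x) (trans (cong proj₁ (trans (sym a) b)) (sym (proj₂ x)))
      go (inj₂ a) (inj₁ b) = apart j′ j i′ (proj₁ x) (trans (cong proj₂ (trans (sym a) b)) (sym (proj₂ x)))

    N-es : ∀ j i → N (es (cs j) i) ≡ not (oddᵇ (toℕ i))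
    N-es j i with oddᵇ (toℕ i) in eq
    ... | false = dec-true (chosen? (es (cs j) i)) (j , i , refl , eq)
    ... | true  = dec-false (chosen? (es (cs j) i)) no′
      where
      no′ : ¬ Chosen (es (cs j) i)
      no′ (j′ , i′ , p , q) with same-circuit j i j′ i′ p
      ... | refl with es-inj (cs j) p
      ...   | refl = false≢true (trans (sym q) eq)

    degree-at : ∀ j i → degIn graph N (vs (cs j) i) ≡ b2n (N (es (cs j) i)) + b2n (N (es (cs j) (before (cs j) i)))
    degree-at j i = degree-subset D N (vs (cs j) i) (tf (vs (cs j) i)) N⊆D
      (joins-follow (cs j) (view i)) (joins-before (cs j) i) (λ p → before≢ (cs j) i (sym (es-inj (cs j) p)))
      (es-in (cs j) i) (es-in (cs j) (before (cs j) i))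

    -- The indicator of the origins of the odd circuits. As a sum over circuits, its total over the
    -- vertices is found by exchanging sums.
    excess : Fin nV → ℕ
    excess v = ∑[ j < r ] (b2n (oddᵇ (len (cs j))) * b2n (does (vs (cs j) zero ≟ v)))

    excess-at : ∀ j i → excess (vs (cs j) i) ≡ b2n (oddᵇ (len (cs j))) * b2n (does (zero ≟ i))
    excess-at j i = trans (sum-cong-≗ {r} pt) (∑-indicator j (λ _ → b2n (oddᵇ (len (cs j))) * b2n (does (zero ≟ i))))
      where
      pt : ∀ j′ → b2n (oddᵇ (len (cs j′))) * b2n (does (vs (cs j′) zero ≟ vs (cs j) i)) ≡
                  b2n (does (j ≟ j′)) * (b2n (oddᵇ (len (cs j))) * b2n (does (zero ≟ i)))
      pt j′ with j ≟ j′
      ... | no ne = trans (cong (λ d → b2n (oddᵇ (len (cs j′))) * b2n d) (dec-false (_ ≟ _) (λ p → ne (sym (apart j′ j zero i p))))) (*-zeroʳ (b2n (oddᵇ (len (cs j′)))))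
      ... | yes refl = trans (cong (λ d → b2n (oddᵇ (len (cs j))) * b2n d) same-index) (sym (+-identityʳ _))
        where
        same-index : does (vs (cs j) zero ≟ vs (cs j) i) ≡ does (zero ≟ i)
        same-index with zero ≟ i
        ... | yes refl = dec-true (vs (cs j) zero ≟ vs (cs j) zero) refl
        ... | no ne    = dec-false (vs (cs j) zero ≟ vs (cs j) i) (λ p → ne (vs-inj (cs j) p))

    -- At position `suc i` the two edges have consecutive positions, one of them even. At the origin
    -- they have the first and the last position, which are both even exactly when the length is
    -- odd.
    degree-N : ∀ v → degIn graph N v ≡ 1 + excess v
    degree-N v with covers v
    ... | j , i , refl = trans (degree-at j i) (trans (local i) (cong suc (sym (excess-at j i))))
      where
      local : ∀ i → b2n (N (es (cs j) i)) + b2n (N (es (cs j) (before (cs j) i))) ≡ 1 + b2n (oddᵇ (len (cs j))) * b2n (does (zero ≟ i))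
      local zero = trans (cong₂ (λ a b → b2n a + b2n b) (N-es j zero)
          (trans (N-es j (fromℕ (k (cs j)))) (trans (cong (not ∘ oddᵇ) (toℕ-fromℕ (k (cs j)))) (sym (oddᵇ-suc (k (cs j)))))))
        (cong suc (sym (*-identityʳ _)))
      local (suc i) = trans (cong₂ (λ a b → b2n a + b2n b) (trans (N-es j (suc i)) (trans (cong not (oddᵇ-suc (toℕ i))) (not-involutive _)))
          (trans (N-es j (inject₁ i)) (cong (not ∘ oddᵇ) (toℕ-inject₁ i))))
        (trans (complementary (oddᵇ (toℕ i))) (cong suc (sym (*-zeroʳ (b2n (oddᵇ (len (cs j))))))))
        where
        complementary : ∀ b → b2n b + b2n (not b) ≡ 1
        complementary true  = refl
        complementary false = refl

    total-excess : ∑[ v < nV ] excess v ≡ countF r (λ j → oddᵇ (len (cs j)))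
    total-excess = begin
      ∑[ v < nV ] ∑[ j < r ] (b2n (oddᵇ (len (cs j))) * b2n (does (vs (cs j) zero ≟ v)))     ≡⟨ ∑-comm {nV} {r} (λ v j → b2n (oddᵇ (len (cs j))) * b2n (does (vs (cs j) zero ≟ v))) ⟩
      ∑[ j < r ] ∑[ v < nV ] (b2n (oddᵇ (len (cs j))) * b2n (does (vs (cs j) zero ≟ v)))     ≡⟨ sum-cong-≗ {r} (λ j → trans (sum-cong-≗ {nV} (λ v → *-comm (b2n (oddᵇ (len (cs j)))) (b2n (does (vs (cs j) zero ≟ v))))) (∑-indicator (vs (cs j) zero) (λ _ → b2n (oddᵇ (len (cs j)))))) ⟩
      ∑[ j < r ] b2n (oddᵇ (len (cs j)))                                                     ≡⟨ sym (countF≡∑ r _) ⟩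
      countF r (λ j → oddᵇ (len (cs j)))                                                     ∎
      where open ≡-Reasoning

    -- Handshaking for `N`, whose degrees are `1 + excess`. If `nV` is even, so is the number of odd
    -- circuits.
    odd-count-parity : nV + countF r (λ j → oddᵇ (len (cs j))) ≡ 2 * countF nE N
    odd-count-parity = trans (cong₂ _+_ (sym (trans (∑-const nV 1) (*-identityʳ nV))) (sym total-excess))
      (trans (sym (∑-distrib-+ {nV} (λ _ → 1) excess)) (trans (sum-cong-≗ {nV} (λ v → sym (degree-N v))) (handshake graph N)))

    module _ (allEven : countF r (λ j → oddᵇ (len (cs j))) ≡ 0) where

      no-excess : ∀ v → excess v ≡ 0
      no-excess = summands nV excess (trans total-excess allEven)
        where
        summands : ∀ n (f : Fin n → ℕ) → ∑[ i < n ] f i ≡ 0 → ∀ i → f i ≡ 0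
        summands (suc n) f p zero    = m+n≡0⇒m≡0 (f zero) p
        summands (suc n) f p (suc i) = summands n (f ∘ suc) (m+n≡0⇒n≡0 (f zero) p) i

      M₁ M₃ : EdgeSet graph
      M₁ e = not (D e)
      M₃ e = D e ∧ not (N e)

      split : ∀ e → b2n (D e) ≡ b2n (N e) + b2n (M₃ e)
      split e with D e | N e | N⊆D e
      ... | true  | true  | _ = refl
      ... | true  | false | _ = refl
      ... | false | false | _ = refl
      ... | false | true  | h = ⊥-elim (false≢true (h refl))

      pm₁ : PerfectMatching graph M₁
      pm₁ v = +-cancelˡ-≡ 2 _ _ (trans (cong (_+ degIn graph M₁ v) (sym (tf v)))
                (trans (sym (sum-degrees (allEdges graph) D M₁ (λ e → whole (D e)) v)) (cubic v)))
        where
        whole : ∀ b → 1 ≡ b2n b + b2n (not b)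
        whole true  = refl
        whole false = refl

      pm₂ : PerfectMatching graph N
      pm₂ v = trans (degree-N v) (cong suc (no-excess v))

      pm₃ : PerfectMatching graph M₃
      pm₃ v = +-cancelˡ-≡ 1 _ _ (trans (cong (_+ degIn graph M₃ v) (sym (pm₂ v)))
                (trans (sym (sum-degrees D N M₃ split v)) (tf v)))

      all-covered : uncovered graph M₁ N M₃ ≡ 0
      all-covered = countF-none nE _ pt
        where
        pt : ∀ e → not (not (D e) ∨ N e ∨ (D e ∧ not (N e))) ≡ false
        pt e with D e | N e
        ... | false | _     = refl
        ... | true  | true  = refl
        ... | true  | false = refl

  oddness≥2 : ∀ h → nV ≡ 2 * h →
    (∀ M₁ M₂ M₃ → PerfectMatching graph M₁ → PerfectMatching graph M₂ → PerfectMatching graph M₃ → 1 ≤ uncovered graph M₁ M₂ M₃) →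
    ∀ D o → TwoFactor graph D → HasOddCircuits graph D o → 2 ≤ o
  oddness≥2 h even unc D o tf (r , cs , covers , apart , refl) = decide _ refl
    where
    open Alternating D tf cs covers apart
    decide : ∀ o → countF r (λ j → oddᵇ (len (cs j))) ≡ o → 2 ≤ countF r (λ j → oddᵇ (len (cs j)))
    decide zero p = ⊥-elim (n≮0 (≤-trans (unc _ _ _ (pm₁ p) (pm₂ p) (pm₃ p)) (≤-reflexive (all-covered p))))
    decide (suc zero) p = ⊥-elim (false≢true (trans (trans (sym (oddᵇ-2*+ (countF nE N) 0)) (cong oddᵇ (+-identityʳ (2 * countF nE N))))
      (trans (cong oddᵇ (sym odd-count-parity)) (trans (cong₂ (λ a b → oddᵇ (a + b)) even p) (oddᵇ-2*+ h 1)))))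
    decide (suc (suc o)) p = ≤-trans (s≤s (s≤s z≤n)) (≤-reflexive (sym p))

  -- At a vertex the degrees of the three colours are at most one and add up to three, so every
  -- colour class is a perfect matching; together the classes cover all edges.
  uncolourable :
    (∀ M₁ M₂ M₃ → PerfectMatching graph M₁ → PerfectMatching graph M₂ → PerfectMatching graph M₃ → 1 ≤ uncovered graph M₁ M₂ M₃) →
    ¬ ThreeEdgeColourable graph
  uncolourable unc (c , proper) = n≮0 (≤-trans
      (unc (hue 0F) (hue 1F) (hue 2F) (λ v → proj₁ (saturated v)) (λ v → proj₁ (proj₂ (saturated v))) (λ v → proj₂ (proj₂ (saturated v))))
      (≤-reflexive (countF-none nE _ covered)))
    where
    hue : Fin 3 → EdgeSet graph
    hue i e = does (c e ≟ i)
    covered : ∀ e → not (hue 0F e ∨ hue 1F e ∨ hue 2F e) ≡ false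
    covered e with c e
    ... | 0F = refl
    ... | 1F = refl
    ... | 2F = refl
    one-hue : ∀ e → 1 ≡ b2n (hue 0F e) + b2n (hue 1F e ∨ hue 2F e)
    one-hue e with c e
    ... | 0F = refl
    ... | 1F = refl
    ... | 2F = refl
    two-hues : ∀ e → b2n (hue 1F e ∨ hue 2F e) ≡ b2n (hue 1F e) + b2n (hue 2F e)
    two-hues e with c e
    ... | 0F = refl
    ... | 1F = refl
    ... | 2F = refl
    all-ones : ∀ {a b c} → a ≤ 1 → b ≤ 1 → c ≤ 1 → a + (b + c) ≡ 3 → a ≡ 1 × b ≡ 1 × c ≡ 1
    all-ones (s≤s z≤n) (s≤s z≤n) (s≤s z≤n) _ = refl , refl , refl
    all-ones z≤n z≤n z≤n ()
    all-ones z≤n z≤n (s≤s z≤n) ()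
    all-ones z≤n (s≤s z≤n) z≤n ()
    all-ones z≤n (s≤s z≤n) (s≤s z≤n) ()
    all-ones (s≤s z≤n) z≤n z≤n ()
    all-ones (s≤s z≤n) z≤n (s≤s z≤n) ()
    all-ones (s≤s z≤n) (s≤s z≤n) z≤n ()
    saturated : ∀ v → degIn graph (hue 0F) v ≡ 1 × degIn graph (hue 1F) v ≡ 1 × degIn graph (hue 2F) v ≡ 1
    saturated v = all-ones (proper v 0F) (proper v 1F) (proper v 2F)
      (trans (cong (degIn graph (hue 0F) v +_) (sym (sum-degrees (λ e → hue 1F e ∨ hue 2F e) (hue 1F) (hue 2F) two-hues v)))
        (trans (sym (sum-degrees (allEdges graph) (hue 0F) (λ e → hue 1F e ∨ hue 2F e) one-hue v)) (cubic v)))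

-- The family of graphs

pattern 10F = suc 9F
pattern 11F = suc 10F
pattern 12F = suc 11F
pattern 13F = suc 12F
pattern 14F = suc 13F
pattern 15F = suc 14F

next6 prev6 : Fin 6 → Fin 6
next6 0F = 1F
next6 1F = 2F
next6 2F = 3F
next6 3F = 4F
next6 4F = 5F
next6 5F = 0F
prev6 0F = 5F
prev6 (suc i) = inject₁ i

next6-prev6 : ∀ i → next6 (prev6 i) ≡ i
next6-prev6 = from-yes (all? λ i → next6 (prev6 i) ≟ i)

prev6-next6 : ∀ i → prev6 (next6 i) ≡ i
prev6-next6 = from-yes (all? λ i → prev6 (next6 i) ≟ i)

mod3 : Fin 6 → Fin 3
mod3 0F = 0F
mod3 1F = 1F
mod3 2F = 2F
mod3 3F = 0F
mod3 4F = 1F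
mod3 5F = 2F

low high : Fin 3 → Fin 6
low 0F = 0F
low 1F = 1F
low 2F = 2F
high i = suc (suc (suc i))

module Family (q : ℕ) where

  -- A strip has `3 + q * 3` units: a multiple of three, so that the last unit has level 2 in the
  -- girth check for every `q`, and more than one, so that no unit is both first and last.
  last : ℕ
  last = 2 + q * 3

  Unit : Set
  Unit = Fin 6 × Fin (suc last)

  -- Vertices 0, …, 7 of a unit form a Petersen graph without two vertices u, v, whose neighbours were
  -- 6, 3, 0 and 4, 7, 0; vertices 8, …, 15 are its image under l ↦ 15 − l. The three edges leg t join
  -- 9, 12, 15 of the previous unit to 6, 3, 0 of unit t. Between strips e − 1 and e the last of these
  -- edges is subdivided by node e (entry e, leg (e , 0) 2), which is joined to leaf (e mod 3).
  data Vertex : Set where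
    unit : Unit → Fin 16 → Vertex
    node : Fin 6 → Vertex
    leaf : Fin 3 → Vertex
    hub  : Vertex

  -- `path t k` joins the vertices `k` and `k + 1` of a unit; the chords join 1-5, 2-7, 4-11, 8-13,
  -- 10-14 and 0-15. The edges 4-11, 7-8 and 0-15 connect the two halves. All paths of a unit and
  -- its chord 5 form a Hamiltonian circuit of the unit.
  data Edge : Set where
    path  : Unit → Fin 15 → Edge
    chord : Unit → Fin 6 → Edge
    leg   : Unit → Fin 3 → Edge
    entry : Fin 6 → Edge
    spoke : Fin 6 → Edge
    arm   : Fin 3 → Edge

  prev : Unit → Unit
  prev (e , zero)  = prev6 e , fromℕ last
  prev (e , suc i) = e , inject₁ i

  nextAt : Fin 6 → {i : Fin (suc last)} → View i → Unit
  nextAt e ‵fromℕ       = next6 e , zero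
  nextAt e (‵inject₁ i) = e , suc i

  next : Unit → Unit
  next (e , i) = nextAt e (view i)

  next-prev : ∀ t → next (prev t) ≡ t
  next-prev (e , zero) rewrite view-fromℕ last = cong (_, zero) (next6-prev6 e)
  next-prev (e , suc i) rewrite view-inject₁ i = refl

  prev-next : ∀ t → prev (next t) ≡ t
  prev-next (e , i) with view i
  ... | ‵fromℕ     = cong (_, fromℕ last) (prev6-next6 e)
  ... | ‵inject₁ j = refl

  exitZ : Fin 6 → {i : Fin (suc last)} → View i → Edge × Bool
  exitZ e ‵fromℕ       = entry (next6 e) , false
  exitZ e (‵inject₁ i) = leg (e , suc i) 2F , false

  forward : Unit → {l : Fin 16} → View l → Edge × Bool
  forward t ‵fromℕ       = chord t 5F , true
  forward t (‵inject₁ k) = path t k , false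

  third : Unit → Fin 16 → Edge × Bool
  third t 0F  = leg t 2F , true
  third t 1F  = chord t 0F , false
  third t 2F  = chord t 1F , false
  third t 3F  = leg t 1F , true
  third t 4F  = chord t 2F , false
  third t 5F  = chord t 0F , true
  third t 6F  = leg t 0F , true
  third t 7F  = chord t 1F , true
  third t 8F  = chord t 3F , false
  third t 9F  = leg (next t) 0F , false
  third t 10F = chord t 4F , false
  third t 11F = chord t 2F , true
  third t 12F = leg (next t) 1F , false
  third t 13F = chord t 3F , true
  third t 14F = chord t 4F , true
  third (e , i) 15F = exitZ e (view i)

  dart : Vertex → Fin 3 → Edge × Bool
  dart (unit t l)       0F = forward t (view l)
  dart (unit t zero)    1F = chord t 5F , false
  dart (unit t (suc k)) 1F = path t k , true
  dart (unit t l)       2F = third t l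
  dart (node e) 0F = entry e , true
  dart (node e) 1F = leg (e , zero) 2F , false
  dart (node e) 2F = spoke e , false
  dart (leaf i) 0F = spoke (low i) , true
  dart (leaf i) 1F = spoke (high i) , true
  dart (leaf i) 2F = arm i , false
  dart hub j = arm j , true

  enterZ : Unit → Vertex × Fin 3
  enterZ (e , zero)  = node e , 1F
  enterZ (e , suc i) = unit (e , inject₁ i) 15F , 2F

  back : Edge → Bool → Vertex × Fin 3
  back (path t k) false = unit t (inject₁ k) , 0F
  back (path t k) true  = unit t (suc k) , 1F
  back (chord t 0F) false = unit t 1F , 2F
  back (chord t 0F) true  = unit t 5F , 2F
  back (chord t 1F) false = unit t 2F , 2F
  back (chord t 1F) true  = unit t 7F , 2F
  back (chord t 2F) false = unit t 4F , 2F
  back (chord t 2F) true  = unit t 11F , 2F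
  back (chord t 3F) false = unit t 8F , 2F
  back (chord t 3F) true  = unit t 13F , 2F
  back (chord t 4F) false = unit t 10F , 2F
  back (chord t 4F) true  = unit t 14F , 2F
  back (chord t 5F) false = unit t 0F , 1F
  back (chord t 5F) true  = unit t 15F , 0F
  back (leg t 0F) false = unit (prev t) 9F , 2F
  back (leg t 0F) true  = unit t 6F , 2F
  back (leg t 1F) false = unit (prev t) 12F , 2F
  back (leg t 1F) true  = unit t 3F , 2F
  back (leg t 2F) false = enterZ t
  back (leg t 2F) true  = unit t 0F , 2F
  back (entry e) false = unit (prev6 e , fromℕ last) 15F , 2F
  back (entry e) true  = node e , 0F
  back (spoke e) false = node e , 2F
  back (spoke 0F) true = leaf 0F , 0F
  back (spoke 1F) true = leaf 1F , 0F
  back (spoke 2F) true = leaf 2F , 0F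
  back (spoke (suc (suc (suc i)))) true = leaf i , 1F
  back (arm i) false = leaf i , 2F
  back (arm i) true  = hub , i

  dart-back : ∀ e b → dart (proj₁ (back e b)) (proj₂ (back e b)) ≡ (e , b)
  dart-back (path t k) false rewrite view-inject₁ k = refl
  dart-back (path t k) true  = refl
  dart-back (chord t 0F) false = refl
  dart-back (chord t 0F) true  = refl
  dart-back (chord t 1F) false = refl
  dart-back (chord t 1F) true  = refl
  dart-back (chord t 2F) false = refl
  dart-back (chord t 2F) true  = refl
  dart-back (chord t 3F) false = refl
  dart-back (chord t 3F) true  = refl
  dart-back (chord t 4F) false = refl
  dart-back (chord t 4F) true  = refl
  dart-back (chord t 5F) false = refl
  dart-back (chord t 5F) true  = refl
  dart-back (leg t 0F) false = cong (λ u → leg u 0F , false) (next-prev t)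
  dart-back (leg t 0F) true  = refl
  dart-back (leg t 1F) false = cong (λ u → leg u 1F , false) (next-prev t)
  dart-back (leg t 1F) true  = refl
  dart-back (leg (e , zero) 2F)  false = refl
  dart-back (leg (e , suc i) 2F) false rewrite view-inject₁ i = refl
  dart-back (leg t 2F) true  = refl
  dart-back (entry e) false rewrite view-fromℕ last = cong (λ x → entry x , false) (next6-prev6 e)
  dart-back (entry e) true  = refl
  dart-back (spoke e) false = refl
  dart-back (spoke 0F) true = refl
  dart-back (spoke 1F) true = refl
  dart-back (spoke 2F) true = refl
  dart-back (spoke (suc (suc (suc i)))) true = refl
  dart-back (arm i) false = refl
  dart-back (arm i) true  = refl

  back-dart : ∀ v j → back (proj₁ (dart v j)) (proj₂ (dart v j)) ≡ (v , j)
  back-dart (unit t l) 0F with view l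
  ... | ‵fromℕ     = refl
  ... | ‵inject₁ k = refl
  back-dart (unit t zero)    1F = refl
  back-dart (unit t (suc k)) 1F = refl
  back-dart (unit t 0F)  2F = refl
  back-dart (unit t 1F)  2F = refl
  back-dart (unit t 2F)  2F = refl
  back-dart (unit t 3F)  2F = refl
  back-dart (unit t 4F)  2F = refl
  back-dart (unit t 5F)  2F = refl
  back-dart (unit t 6F)  2F = refl
  back-dart (unit t 7F)  2F = refl
  back-dart (unit t 8F)  2F = refl
  back-dart (unit t 9F)  2F = cong (λ u → unit u 9F , 2F) (prev-next t)
  back-dart (unit t 10F) 2F = refl
  back-dart (unit t 11F) 2F = refl
  back-dart (unit t 12F) 2F = cong (λ u → unit u 12F , 2F) (prev-next t)
  back-dart (unit t 13F) 2F = refl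
  back-dart (unit t 14F) 2F = refl
  back-dart (unit (e , i) 15F) 2F with view i
  ... | ‵fromℕ     = cong (λ x → unit (x , fromℕ last) 15F , 2F) (prev6-next6 e)
  ... | ‵inject₁ j = refl
  back-dart (node e) 0F = refl
  back-dart (node e) 1F = refl
  back-dart (node e) 2F = refl
  back-dart (leaf 0F) 0F = refl
  back-dart (leaf 1F) 0F = refl
  back-dart (leaf 2F) 0F = refl
  back-dart (leaf i) 1F = refl
  back-dart (leaf i) 2F = refl
  back-dart hub j = refl

  no-loop : ∀ e → proj₁ (back e true) ≢ proj₁ (back e false)
  no-loop (path t k) p = inject₁≢suc k (sym (label-injective p))
    where
    label-injective : ∀ {t l l′} → unit t l ≡ unit t l′ → l ≡ l′
    label-injective refl = refl
  no-loop (chord t 0F) ()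
  no-loop (chord t 1F) ()
  no-loop (chord t 2F) ()
  no-loop (chord t 3F) ()
  no-loop (chord t 4F) ()
  no-loop (chord t 5F) ()
  no-loop (leg t 0F) ()
  no-loop (leg t 1F) ()
  no-loop (leg (e , zero) 2F) ()
  no-loop (leg (e , suc i) 2F) ()
  no-loop (entry e) ()
  no-loop (spoke 0F) ()
  no-loop (spoke 1F) ()
  no-loop (spoke 2F) ()
  no-loop (spoke (suc (suc (suc i)))) ()
  no-loop (arm i) ()

  units : ℕ
  units = 6 * suc last

  V↔Sum : Vertex ↔ ((Unit × Fin 16) ⊎ (Fin 6 ⊎ (Fin 3 ⊎ Fin 1)))
  V↔Sum = mk↔ₛ′
    (λ { (unit t l) → inj₁ (t , l) ; (node e) → inj₂ (inj₁ e) ; (leaf i) → inj₂ (inj₂ (inj₁ i)) ; hub → inj₂ (inj₂ (inj₂ 0F)) })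
    (λ { (inj₁ (t , l)) → unit t l ; (inj₂ (inj₁ e)) → node e ; (inj₂ (inj₂ (inj₁ i))) → leaf i ; (inj₂ (inj₂ (inj₂ 0F))) → hub })
    (λ { (inj₁ (t , l)) → refl ; (inj₂ (inj₁ e)) → refl ; (inj₂ (inj₂ (inj₁ i))) → refl ; (inj₂ (inj₂ (inj₂ 0F))) → refl })
    (λ { (unit t l) → refl ; (node e) → refl ; (leaf i) → refl ; hub → refl })

  E↔Sum : Edge ↔ ((Unit × Fin 15) ⊎ ((Unit × Fin 6) ⊎ ((Unit × Fin 3) ⊎ (Fin 6 ⊎ (Fin 6 ⊎ Fin 3)))))
  E↔Sum = mk↔ₛ′
    (λ { (path t k) → inj₁ (t , k) ; (chord t c) → inj₂ (inj₁ (t , c)) ; (leg t r) → inj₂ (inj₂ (inj₁ (t , r)))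
       ; (entry e) → inj₂ (inj₂ (inj₂ (inj₁ e))) ; (spoke e) → inj₂ (inj₂ (inj₂ (inj₂ (inj₁ e)))) ; (arm i) → inj₂ (inj₂ (inj₂ (inj₂ (inj₂ i)))) })
    (λ { (inj₁ (t , k)) → path t k ; (inj₂ (inj₁ (t , c))) → chord t c ; (inj₂ (inj₂ (inj₁ (t , r)))) → leg t r
       ; (inj₂ (inj₂ (inj₂ (inj₁ e)))) → entry e ; (inj₂ (inj₂ (inj₂ (inj₂ (inj₁ e))))) → spoke e ; (inj₂ (inj₂ (inj₂ (inj₂ (inj₂ i))))) → arm i })
    (λ { (inj₁ (t , k)) → refl ; (inj₂ (inj₁ (t , c))) → refl ; (inj₂ (inj₂ (inj₁ (t , r)))) → refl
       ; (inj₂ (inj₂ (inj₂ (inj₁ e)))) → refl ; (inj₂ (inj₂ (inj₂ (inj₂ (inj₁ e))))) → refl ; (inj₂ (inj₂ (inj₂ (inj₂ (inj₂ i))))) → refl })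
    (λ { (path t k) → refl ; (chord t c) → refl ; (leg t r) → refl ; (entry e) → refl ; (spoke e) → refl ; (arm i) → refl })

  cells : ∀ k → (Unit × Fin k) ↔ Fin (units * k)
  cells k = ↔-trans (↔-sym *↔× ×-↔ ↔-refl) (↔-sym *↔×)

  -- Only bijectivity matters from here on; the numbering itself is kept opaque.
  abstract
    V↔Fin : Vertex ↔ Fin (units * 16 + (6 + (3 + 1)))
    V↔Fin = ↔-trans V↔Sum (↔-trans (cells 16 ⊎-↔ ↔-trans (↔-refl ⊎-↔ ↔-sym +↔⊎) (↔-sym +↔⊎)) (↔-sym +↔⊎))

    E↔Fin : Edge ↔ Fin (units * 15 + (units * 6 + (units * 3 + (6 + (6 + 3)))))
    E↔Fin = ↔-trans E↔Sum
      (↔-trans (cells 15 ⊎-↔ ↔-trans (cells 6 ⊎-↔ ↔-trans (cells 3 ⊎-↔ ↔-trans (↔-refl ⊎-↔ ↔-sym +↔⊎) (↔-sym +↔⊎)) (↔-sym +↔⊎)) (↔-sym +↔⊎)) (↔-sym +↔⊎))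

  Γ : CubicGraph
  Γ = record
    { V = Vertex ; E = Edge ; V↔ = V↔Fin ; E↔ = E↔Fin
    ; dart = dart ; back = back ; dart-back = dart-back ; back-dart = back-dart ; no-loop = no-loop }

-- Parities of perfect matchings

data ExactlyOne : Bool → Bool → Bool → Set where
  1st  : ExactlyOne true false false
  2nd : ExactlyOne false true false
  3rd  : ExactlyOne false false true

exactlyOne : ∀ a b c → b2n a + (b2n b + b2n c) ≡ 1 → ExactlyOne a b c
exactlyOne true  false false refl = 1st
exactlyOne false true  false refl = 2nd
exactlyOne false false true  refl = 3rd

exactlyOne? : ∀ a b c → Dec (ExactlyOne a b c)
exactlyOne? true  false false = yes 1st
exactlyOne? false true  false = yes 2nd
exactlyOne? false false true  = yes 3rd
exactlyOne? false false false = no λ ()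
exactlyOne? true  true  _     = no λ ()
exactlyOne? true  false true  = no λ ()
exactlyOne? false true  true  = no λ ()

xor₃ : Bool → Bool → Bool → Bool
xor₃ a b c = a xor (b xor c)

exactlyOne⇒odd : ∀ {a b c} → ExactlyOne a b c → xor₃ a b c ≡ true
exactlyOne⇒odd 1st  = refl
exactlyOne⇒odd 2nd = refl
exactlyOne⇒odd 3rd  = refl

colour : Bool → Bool → Bool → Fin 3
colour a b c = if a then 0F else if b then 1F else 2F

-- Three matchings choose one edge each at a vertex. If all three edges are covered, the choice is a
-- bijection.
rainbow-at : ∀ {a₁ a₂ a₃ b₁ b₂ b₃ c₁ c₂ c₃} →
  ExactlyOne a₁ b₁ c₁ → ExactlyOne a₂ b₂ c₂ → ExactlyOne a₃ b₃ c₃ →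
  a₁ ∨ a₂ ∨ a₃ ≡ true → b₁ ∨ b₂ ∨ b₃ ≡ true → c₁ ∨ c₂ ∨ c₃ ≡ true →
  Rainbow (colour a₁ a₂ a₃) (colour b₁ b₂ b₃) (colour c₁ c₂ c₃)
    × ExactlyOne a₁ a₂ a₃ × ExactlyOne b₁ b₂ b₃ × ExactlyOne c₁ c₂ c₃
rainbow-at 1st  2nd 3rd  refl refl refl = distinct (λ ()) (λ ()) (λ ()) , 1st , 2nd , 3rd
rainbow-at 1st  3rd  2nd refl refl refl = distinct (λ ()) (λ ()) (λ ()) , 1st , 3rd , 2nd
rainbow-at 2nd 1st  3rd  refl refl refl = distinct (λ ()) (λ ()) (λ ()) , 2nd , 1st , 3rd
rainbow-at 2nd 3rd  1st  refl refl refl = distinct (λ ()) (λ ()) (λ ()) , 3rd , 1st , 2nd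
rainbow-at 3rd  1st  2nd refl refl refl = distinct (λ ()) (λ ()) (λ ()) , 2nd , 3rd , 1st
rainbow-at 3rd  2nd 1st  refl refl refl = distinct (λ ()) (λ ()) (λ ()) , 3rd , 2nd , 1st
rainbow-at 1st  1st  1st  _ () _
rainbow-at 1st  1st  2nd _ _ ()
rainbow-at 1st  1st  3rd  _ () _
rainbow-at 2nd 2nd 1st  _ _ ()
rainbow-at 2nd 2nd 2nd () _ _
rainbow-at 2nd 2nd 3rd  () _ _
rainbow-at 3rd  3rd  1st  _ () _
rainbow-at 3rd  3rd  2nd () _ _
rainbow-at 3rd  3rd  3rd  () _ _

-- The numbers of edges of each colour add up to three, so one or three of them are odd; all are odd
-- only if each is one.
parity-rainbow : ∀ {a₁ a₂ a₃ b₁ b₂ b₃ c₁ c₂ c₃} →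
  ExactlyOne a₁ a₂ a₃ → ExactlyOne b₁ b₂ b₃ → ExactlyOne c₁ c₂ c₃ →
  ExactlyOne (xor₃ a₁ b₁ c₁) (xor₃ a₂ b₂ c₂) (xor₃ a₃ b₃ c₃)
    ⊎ (xor₃ a₁ b₁ c₁ ≡ true × xor₃ a₂ b₂ c₂ ≡ true × xor₃ a₃ b₃ c₃ ≡ true)
      × Rainbow (colour a₁ a₂ a₃) (colour b₁ b₂ b₃) (colour c₁ c₂ c₃)
parity-rainbow 1st  1st  1st  = inj₁ 1st
parity-rainbow 1st  1st  2nd = inj₁ 2nd
parity-rainbow 1st  1st  3rd  = inj₁ 3rd
parity-rainbow 1st  2nd 1st  = inj₁ 2nd
parity-rainbow 1st  2nd 2nd = inj₁ 1st
parity-rainbow 1st  2nd 3rd  = inj₂ ((refl , refl , refl) , distinct (λ ()) (λ ()) (λ ()))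
parity-rainbow 1st  3rd  1st  = inj₁ 3rd
parity-rainbow 1st  3rd  2nd = inj₂ ((refl , refl , refl) , distinct (λ ()) (λ ()) (λ ()))
parity-rainbow 1st  3rd  3rd  = inj₁ 1st
parity-rainbow 2nd 1st  1st  = inj₁ 2nd
parity-rainbow 2nd 1st  2nd = inj₁ 1st
parity-rainbow 2nd 1st  3rd  = inj₂ ((refl , refl , refl) , distinct (λ ()) (λ ()) (λ ()))
parity-rainbow 2nd 2nd 1st  = inj₁ 1st
parity-rainbow 2nd 2nd 2nd = inj₁ 2nd
parity-rainbow 2nd 2nd 3rd  = inj₁ 3rd
parity-rainbow 2nd 3rd  1st  = inj₂ ((refl , refl , refl) , distinct (λ ()) (λ ()) (λ ()))
parity-rainbow 2nd 3rd  2nd = inj₁ 3rd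
parity-rainbow 2nd 3rd  3rd  = inj₁ 2nd
parity-rainbow 3rd  1st  1st  = inj₁ 3rd
parity-rainbow 3rd  1st  2nd = inj₂ ((refl , refl , refl) , distinct (λ ()) (λ ()) (λ ()))
parity-rainbow 3rd  1st  3rd  = inj₁ 1st
parity-rainbow 3rd  2nd 1st  = inj₂ ((refl , refl , refl) , distinct (λ ()) (λ ()) (λ ()))
parity-rainbow 3rd  2nd 2nd = inj₁ 3rd
parity-rainbow 3rd  2nd 3rd  = inj₁ 2nd
parity-rainbow 3rd  3rd  1st  = inj₁ 1st
parity-rainbow 3rd  3rd  2nd = inj₁ 2nd
parity-rainbow 3rd  3rd  3rd  = inj₁ 3rd

-- Summing the equations of the eight vertices cancels the nine inner edges modulo 2.
abstract
  half-parity : ∀ x₀ x₁ x₂ x₃ x₄ x₅ x₆ x₇ x₈ x₉ x₁₀ x₁₁ x₁₂ x₁₃ x₁₄ →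
    xor₃ x₀ x₁₄ x₁₁ ≡ true → xor₃ x₁ x₀ x₈ ≡ true → xor₃ x₂ x₁ x₇ ≡ true → xor₃ x₃ x₂ x₁₀ ≡ true →
    xor₃ x₄ x₃ x₁₂ ≡ true → xor₃ x₅ x₄ x₈ ≡ true → xor₃ x₆ x₅ x₉ ≡ true → xor₃ x₁₃ x₆ x₇ ≡ true →
    xor₃ x₉ x₁₀ x₁₁ ≡ xor₃ x₁₂ x₁₃ x₁₄
  half-parity x₀ x₁ x₂ x₃ x₄ x₅ x₆ x₇ x₈ x₉ x₁₀ x₁₁ x₁₂ x₁₃ x₁₄ h₀ h₁ h₂ h₃ h₄ h₅ h₆ h₇ =
    trans (solve 15
      (λ x₀ x₁ x₂ x₃ x₄ x₅ x₆ x₇ x₈ x₉ x₁₀ x₁₁ x₁₂ x₁₃ x₁₄ →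
        x₉ :+ (x₁₀ :+ x₁₁) :=
        (((x₀ :+ (x₁₄ :+ x₁₁)) :+ (x₁ :+ (x₀ :+ x₈))) :+ ((x₂ :+ (x₁ :+ x₇)) :+ (x₃ :+ (x₂ :+ x₁₀)))
         :+ (((x₄ :+ (x₃ :+ x₁₂)) :+ (x₅ :+ (x₄ :+ x₈))) :+ ((x₆ :+ (x₅ :+ x₉)) :+ (x₁₃ :+ (x₆ :+ x₇)))))
        :+ (x₁₂ :+ (x₁₃ :+ x₁₄)))
      refl x₀ x₁ x₂ x₃ x₄ x₅ x₆ x₇ x₈ x₉ x₁₀ x₁₁ x₁₂ x₁₃ x₁₄)
    (cong (_xor xor₃ x₁₂ x₁₃ x₁₄)
      (cong₂ _xor_ (cong₂ _xor_ (cong₂ _xor_ h₀ h₁) (cong₂ _xor_ h₂ h₃))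
                   (cong₂ _xor_ (cong₂ _xor_ h₄ h₅) (cong₂ _xor_ h₆ h₇))))
    where open xor-∧-Solver

resp₃ : ∀ (P : Bool → Bool → Bool → Set) {a a′ b b′ c c′} → a ≡ a′ → b ≡ b′ → c ≡ c′ → P a b c → P a′ b′ c′
resp₃ P refl refl refl p = p

xor₃-swap : ∀ a b c → xor₃ a b c ≡ xor₃ b a c
xor₃-swap a b c = trans (sym (xor-assoc a b c)) (trans (cong (_xor c) (xor-comm a b)) (xor-assoc b a c))

-- The triples before and after a node share their first two edges, so their parities differ by
-- `in′ xor out`, which is true unless the matching uses the spoke `s`.
node-parity : ∀ {a b in′ out s} → ExactlyOne in′ out s → s ≡ not (xor₃ a b in′ xor xor₃ a b out)
node-parity {false} {false} 1st = refl
node-parity {false} {false} 2nd = refl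
node-parity {false} {false} 3rd = refl
node-parity {false} {true}  1st = refl
node-parity {false} {true}  2nd = refl
node-parity {false} {true}  3rd = refl
node-parity {true}  {false} 1st = refl
node-parity {true}  {false} 2nd = refl
node-parity {true}  {false} 3rd = refl
node-parity {true}  {true}  1st = refl
node-parity {true}  {true}  2nd = refl
node-parity {true}  {true}  3rd = refl

data Odd : Bool → Bool → Bool → Set where
  one   : ∀ {a b c} → ExactlyOne a b c → Odd a b c
  three : Odd true true true

-- Modulo 2 the three values add up to 3 + 1 + 1.
not-xor-odd : ∀ {a₁ a₂ a₃ b₁ b₂ b₃} → ExactlyOne a₁ a₂ a₃ → ExactlyOne b₁ b₂ b₃ →
  Odd (not (a₁ xor b₁)) (not (a₂ xor b₂)) (not (a₃ xor b₃))
not-xor-odd 1st 1st = three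
not-xor-odd 1st 2nd = one 3rd
not-xor-odd 1st 3rd = one 2nd
not-xor-odd 2nd 1st = one 3rd
not-xor-odd 2nd 2nd = three
not-xor-odd 2nd 3rd = one 1st
not-xor-odd 3rd 1st = one 2nd
not-xor-odd 3rd 2nd = one 1st
not-xor-odd 3rd 3rd = three

-- Equal colours on both sides would make all three values true, against the last hypothesis; for
-- different colours the true value marks the remaining colour.
not-xor-rainbow : ∀ {a₁ a₂ a₃ b₁ b₂ b₃} → ExactlyOne a₁ a₂ a₃ → ExactlyOne b₁ b₂ b₃ →
  ExactlyOne (not (a₁ xor b₁)) (not (a₂ xor b₂)) (not (a₃ xor b₃)) →
  Rainbow (colour b₁ b₂ b₃) (colour (not (a₁ xor b₁)) (not (a₂ xor b₂)) (not (a₃ xor b₃))) (colour a₁ a₂ a₃)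
not-xor-rainbow 1st 2nd _ = distinct (λ ()) (λ ()) (λ ())
not-xor-rainbow 1st 3rd _ = distinct (λ ()) (λ ()) (λ ())
not-xor-rainbow 2nd 1st _ = distinct (λ ()) (λ ()) (λ ())
not-xor-rainbow 2nd 3rd _ = distinct (λ ()) (λ ()) (λ ())
not-xor-rainbow 3rd 1st _ = distinct (λ ()) (λ ()) (λ ())
not-xor-rainbow 3rd 2nd _ = distinct (λ ()) (λ ()) (λ ())

-- Each matching uses one of the three edges at the leaf, three uses in all. Two odd numbers of uses
-- can only be 1 and 1, which leaves 1 for the arm.
leaf-covers : ∀ {a₁ a₂ a₃ b₁ b₂ b₃ c₁ c₂ c₃} → Odd a₁ a₂ a₃ → Odd b₁ b₂ b₃ →
  ExactlyOne a₁ b₁ c₁ → ExactlyOne a₂ b₂ c₂ → ExactlyOne a₃ b₃ c₃ →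
  (a₁ ∨ a₂ ∨ a₃ ≡ true) × (b₁ ∨ b₂ ∨ b₃ ≡ true) × (c₁ ∨ c₂ ∨ c₃ ≡ true)
leaf-covers three (one ()) 1st 1st 1st
leaf-covers (one 1st) (one 1st) () _ _
leaf-covers (one 1st) (one 2nd) 1st 2nd 3rd = refl , refl , refl
leaf-covers (one 1st) (one 3rd) 1st 3rd 2nd = refl , refl , refl
leaf-covers (one 2nd) (one 1st) 2nd 1st 3rd = refl , refl , refl
leaf-covers (one 2nd) (one 2nd) _ () _
leaf-covers (one 2nd) (one 3rd) 3rd 1st 2nd = refl , refl , refl
leaf-covers (one 3rd) (one 1st) 2nd 3rd 1st = refl , refl , refl
leaf-covers (one 3rd) (one 2nd) 3rd 2nd 1st = refl , refl , refl
leaf-covers (one 3rd) (one 3rd) _ _ ()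

-- Uncovered edges in an unbalanced strip

module Defect (q : ℕ) where
  open Family q
  open CubicGraph Γ using (degV; inc; toE; fromE; toE-fromE; fromE-toE; toE-injective; graph; perfectMatching⇒)

  -- The first half of a unit in the edge order of `petersen-uncolourable`. The legs stand for the
  -- edges at u, and the three edges to the mirror half for those at v.
  petersenEdge : Unit → Fin 15 → Edge
  petersenEdge t 0F  = path t 0F
  petersenEdge t 1F  = path t 1F
  petersenEdge t 2F  = path t 2F
  petersenEdge t 3F  = path t 3F
  petersenEdge t 4F  = path t 4F
  petersenEdge t 5F  = path t 5F
  petersenEdge t 6F  = path t 6F
  petersenEdge t 7F  = chord t 1F
  petersenEdge t 8F  = chord t 0F
  petersenEdge t 9F  = leg t 0F
  petersenEdge t 10F = leg t 1F
  petersenEdge t 11F = leg t 2F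
  petersenEdge t 12F = chord t 2F
  petersenEdge t 13F = path t 7F
  petersenEdge t 14F = chord t 5F

  owner : Edge → Maybe Unit
  owner (path t _)  = just t
  owner (chord t _) = just t
  owner (leg t _)   = just t
  owner (entry _)   = nothing
  owner (spoke _)   = nothing
  owner (arm _)     = nothing

  owner-petersenEdge : ∀ t k → owner (petersenEdge t k) ≡ just t
  owner-petersenEdge t 0F  = refl
  owner-petersenEdge t 1F  = refl
  owner-petersenEdge t 2F  = refl
  owner-petersenEdge t 3F  = refl
  owner-petersenEdge t 4F  = refl
  owner-petersenEdge t 5F  = refl
  owner-petersenEdge t 6F  = refl
  owner-petersenEdge t 7F  = refl
  owner-petersenEdge t 8F  = refl
  owner-petersenEdge t 9F  = refl
  owner-petersenEdge t 10F = refl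
  owner-petersenEdge t 11F = refl
  owner-petersenEdge t 12F = refl
  owner-petersenEdge t 13F = refl
  owner-petersenEdge t 14F = refl

  module Matching (M : Edge → Bool) (pm : ∀ v → degV M v ≡ 1) where

    at : ∀ v → ExactlyOne (M (inc v 0F)) (M (inc v 1F)) (M (inc v 2F))
    at v = exactlyOne _ _ _ (pm v)

    odd : ∀ v → xor₃ (M (inc v 0F)) (M (inc v 1F)) (M (inc v 2F)) ≡ true
    odd v = exactlyOne⇒odd (at v)

    -- The mirror image reverses the path, so slots 0 and 1 trade places in the equations of the
    -- second half.
    odd′ : ∀ v → xor₃ (M (inc v 1F)) (M (inc v 0F)) (M (inc v 2F)) ≡ true
    odd′ v = trans (xor₃-swap (M (inc v 1F)) (M (inc v 0F)) (M (inc v 2F))) (odd v)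

    inParity midParity outParity : Unit → Bool
    inParity  t = xor₃ (M (leg t 0F)) (M (leg t 1F)) (M (leg t 2F))
    midParity t = xor₃ (M (chord t 2F)) (M (path t 7F)) (M (chord t 5F))
    outParity t = xor₃ (M (leg (next t) 0F)) (M (leg (next t) 1F)) (M (proj₁ (third t 15F)))

    in≡mid : ∀ t → inParity t ≡ midParity t
    in≡mid t = half-parity (x 0F) (x 1F) (x 2F) (x 3F) (x 4F) (x 5F) (x 6F) (x 7F) (x 8F) (x 9F) (x 10F) (x 11F) (x 12F) (x 13F) (x 14F)
      (odd (unit t 0F)) (odd (unit t 1F)) (odd (unit t 2F)) (odd (unit t 3F))
      (odd (unit t 4F)) (odd (unit t 5F)) (odd (unit t 6F)) (odd (unit t 7F))
      where x = λ k → M (petersenEdge t k)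

    out≡mid : ∀ t → outParity t ≡ midParity t
    out≡mid t = half-parity
      (M (path t 14F)) (M (path t 13F)) (M (path t 12F)) (M (path t 11F)) (M (path t 10F)) (M (path t 9F)) (M (path t 8F))
      (M (chord t 3F)) (M (chord t 4F)) (M (leg (next t) 0F)) (M (leg (next t) 1F)) (M (proj₁ (third t 15F)))
      (M (chord t 2F)) (M (path t 7F)) (M (chord t 5F))
      (odd′ (unit t 15F)) (odd′ (unit t 14F)) (odd′ (unit t 13F)) (odd′ (unit t 12F))
      (odd′ (unit t 11F)) (odd′ (unit t 10F)) (odd′ (unit t 9F)) (odd′ (unit t 8F))

    out≡in : ∀ t → outParity t ≡ inParity t
    out≡in t = trans (out≡mid t) (sym (in≡mid t))

    inParity-step : ∀ e i → inParity (e , suc i) ≡ inParity (e , inject₁ i)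
    inParity-step e i = trans (sym eq) (out≡in (e , inject₁ i))
      where
      eq : outParity (e , inject₁ i) ≡ inParity (e , suc i)
      eq rewrite view-inject₁ i = refl

    stripParity : Fin 6 → Bool
    stripParity e = inParity (e , zero)

    inParity-strip : ∀ e i → inParity (e , i) ≡ stripParity e
    inParity-strip e = <-weakInduction (λ i → inParity (e , i) ≡ stripParity e) refl
      (λ i ih → trans (inParity-step e i) ih)

    spoke-parity : ∀ e → M (spoke e) ≡ not (stripParity (prev6 e) xor stripParity e)
    spoke-parity e = trans (node-parity {M (leg (e , zero) 0F)} {M (leg (e , zero) 1F)} (at (node e)))
      (cong (λ z → not (z xor stripParity e)) (trans (sym eq) (trans (out≡in (prev6 e , fromℕ last)) (inParity-strip (prev6 e) (fromℕ last)))))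
      where
      eq : outParity (prev6 e , fromℕ last) ≡ xor₃ (M (leg (e , zero) 0F)) (M (leg (e , zero) 1F)) (M (entry e))
      eq rewrite view-fromℕ last | next6-prev6 e = refl

  module Triple (M₁ M₂ M₃ : Edge → Bool)
    (pm₁ : ∀ v → degV M₁ v ≡ 1) (pm₂ : ∀ v → degV M₂ v ≡ 1) (pm₃ : ∀ v → degV M₃ v ≡ 1) where

    module 𝟙 = Matching M₁ pm₁
    module 𝟚 = Matching M₂ pm₂
    module 𝟛 = Matching M₃ pm₃

    covered : Edge → Bool
    covered e = M₁ e ∨ M₂ e ∨ M₃ e

    hue : Edge → Fin 3
    hue e = colour (M₁ e) (M₂ e) (M₃ e)

    Simple : Edge → Set
    Simple e = ExactlyOne (M₁ e) (M₂ e) (M₃ e)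

    rainbow : ∀ v → covered (inc v 0F) ≡ true → covered (inc v 1F) ≡ true → covered (inc v 2F) ≡ true →
      Rainbow (hue (inc v 0F)) (hue (inc v 1F)) (hue (inc v 2F)) × Simple (inc v 0F) × Simple (inc v 1F) × Simple (inc v 2F)
    rainbow v = rainbow-at (𝟙.at v) (𝟚.at v) (𝟛.at v)

    Balanced : Unit → Set
    Balanced t = ExactlyOne (𝟙.inParity t) (𝟚.inParity t) (𝟛.inParity t)

    covered⇒balanced : ∀ t → (∀ k → covered (petersenEdge t k) ≡ true) → Balanced t
    covered⇒balanced t h
      with rainbow (unit t 0F) (h 0F) (h 14F) (h 11F) | rainbow (unit t 3F) (h 3F) (h 2F) (h 10F)
         | rainbow (unit t 6F) (h 6F) (h 5F) (h 9F) | rainbow (unit t 4F) (h 4F) (h 3F) (h 12F)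
         | rainbow (unit t 7F) (h 13F) (h 6F) (h 7F)
    ... | r₀ , _ , s₁₄ , s₁₁ | r₃ , _ , _ , s₁₀ | r₆ , _ , _ , s₉ | r₄ , _ , _ , s₁₂ | r₇ , s₁₃ , _
      with parity-rainbow s₉ s₁₀ s₁₁ | parity-rainbow s₁₂ s₁₃ s₁₄
    ... | inj₁ bal | _ = bal
    ... | inj₂ _ | inj₁ bal = resp₃ ExactlyOne (sym (𝟙.in≡mid t)) (sym (𝟚.in≡mid t)) (sym (𝟛.in≡mid t)) bal
    -- All parities are odd, so both triples are rainbow and serve as the edges at the missing
    -- vertices u and v.
    ... | inj₂ (_ , ru) | inj₂ (_ , rv) = ⊥-elim (petersen-uncolourable
            (c 0F) (c 1F) (c 2F) (c 3F) (c 4F) (c 5F) (c 6F) (c 7F) (c 8F) (c 9F) (c 10F) (c 11F) (c 12F) (c 13F) (c 14F)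
            r₀ (proj₁ (rainbow (unit t 1F) (h 1F) (h 0F) (h 8F))) (proj₁ (rainbow (unit t 2F) (h 2F) (h 1F) (h 7F)))
            r₃ r₄ (proj₁ (rainbow (unit t 5F) (h 5F) (h 4F) (h 8F))) r₆ r₇ ru rv)
      where c = λ k → hue (petersenEdge t k)

    BalancedStrip : Fin 6 → Set
    BalancedStrip e = ExactlyOne (𝟙.stripParity e) (𝟚.stripParity e) (𝟛.stripParity e)

    not-all-balanced : ¬ (∀ e → BalancedStrip e)
    -- The vertices 0, ..., 7, u, v are here leaf 2, hub, leaf 0, node 0, node 1, leaf 1, node 4,
    -- node 3, node 5, node 2; an edge of the hexagon has the colour of its strip.
    not-all-balanced bal = petersen-uncolourable
      (hue (arm 2F)) (hue (arm 0F)) (hue (spoke 0F)) (s 0F) (hue (spoke 1F)) (hue (spoke 4F)) (s 3F) (hue (spoke 3F))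
      (hue (arm 1F)) (s 4F) (s 5F) (hue (spoke 5F)) (s 1F) (s 2F) (hue (spoke 2F))
      (zxy (leafRainbow 2F)) (xzy hubRainbow) (xzy (leafRainbow 0F)) (nodeRainbow 0F)
      (yzx (nodeRainbow 1F)) (yxz (leafRainbow 1F)) (zyx (nodeRainbow 4F)) (zxy (nodeRainbow 3F))
      (zxy (nodeRainbow 5F)) (zxy (nodeRainbow 2F))
      where
      s : Fin 6 → Fin 3
      s e = colour (𝟙.stripParity e) (𝟚.stripParity e) (𝟛.stripParity e)
      spoke-odd : ∀ e → Odd (M₁ (spoke e)) (M₂ (spoke e)) (M₃ (spoke e))
      spoke-odd e = resp₃ Odd (sym (𝟙.spoke-parity e)) (sym (𝟚.spoke-parity e)) (sym (𝟛.spoke-parity e))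
        (not-xor-odd (bal (prev6 e)) (bal e))
      leafAll : ∀ i → Rainbow (hue (spoke (low i))) (hue (spoke (high i))) (hue (arm i))
                      × Simple (spoke (low i)) × Simple (spoke (high i)) × Simple (arm i)
      leafAll i = let a , b , c = leaf-covers (spoke-odd (low i)) (spoke-odd (high i)) (𝟙.at (leaf i)) (𝟚.at (leaf i)) (𝟛.at (leaf i))
                  in rainbow (leaf i) a b c
      leafRainbow : ∀ i → Rainbow (hue (spoke (low i))) (hue (spoke (high i))) (hue (arm i))
      leafRainbow i = proj₁ (leafAll i)
      covers : ∀ {a b c} → ExactlyOne a b c → a ∨ b ∨ c ≡ true
      covers 1st = refl
      covers 2nd = refl
      covers 3rd = refl
      arm-covered : ∀ i → covered (arm i) ≡ true
      arm-covered i = covers (proj₂ (proj₂ (proj₂ (leafAll i))))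
      hubRainbow : Rainbow (hue (arm 0F)) (hue (arm 1F)) (hue (arm 2F))
      hubRainbow = proj₁ (rainbow hub (arm-covered 0F) (arm-covered 1F) (arm-covered 2F))
      spoke-simple : ∀ e → Simple (spoke e)
      spoke-simple 0F = proj₁ (proj₂ (leafAll 0F))
      spoke-simple 1F = proj₁ (proj₂ (leafAll 1F))
      spoke-simple 2F = proj₁ (proj₂ (leafAll 2F))
      spoke-simple (suc (suc (suc i))) = proj₁ (proj₂ (proj₂ (leafAll i)))
      nodeRainbow : ∀ e → Rainbow (s e) (hue (spoke e)) (s (prev6 e))
      nodeRainbow e = resp₃ (λ a b c → Rainbow (s e) (colour a b c) (s (prev6 e)))
        (sym (𝟙.spoke-parity e)) (sym (𝟚.spoke-parity e)) (sym (𝟛.spoke-parity e))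
        (not-xor-rainbow (bal (prev6 e)) (bal e)
          (resp₃ ExactlyOne (𝟙.spoke-parity e) (𝟚.spoke-parity e) (𝟛.spoke-parity e) (spoke-simple e)))
      ne : ∀ {a b : Fin 3} → a ≢ b → b ≢ a
      ne p q = p (sym q)
      zxy : ∀ {x y z} → Rainbow x y z → Rainbow z x y
      zxy (distinct p q r) = distinct (ne q) (ne r) p
      xzy : ∀ {x y z} → Rainbow x y z → Rainbow x z y
      xzy (distinct p q r) = distinct q p (ne r)
      yzx : ∀ {x y z} → Rainbow x y z → Rainbow y z x
      yzx (distinct p q r) = distinct r (ne p) (ne q)
      yxz : ∀ {x y z} → Rainbow x y z → Rainbow y x z
      yxz (distinct p q r) = distinct (ne p) r q
      zyx : ∀ {x y z} → Rainbow x y z → Rainbow z y x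
      zyx (distinct p q r) = distinct (ne r) (ne q) (ne p)

    unbalanced-strip : ∃[ e ] ¬ BalancedStrip e
    unbalanced-strip = ¬∀⟶∃¬ 6 _ (λ e → exactlyOne? _ _ _) not-all-balanced

    uncovered-in : ∀ t → ¬ Balanced t → ∃[ k ] covered (petersenEdge t k) ≡ false
    uncovered-in t ¬bal =
      let k , p = ¬∀⟶∃¬ 15 _ (λ k → covered (petersenEdge t k) Bool.≟ true) (λ h → ¬bal (covered⇒balanced t h))
      in k , ¬-not p

    -- Parities are constant along a strip, so no unit of an unbalanced strip is balanced, and each
    -- provides an uncovered edge. These edges differ because `owner` recovers the unit.
    length≤uncovered : suc last ≤ countF (CubicGraph.nE Γ) (λ e → not (covered (fromE e)))
    length≤uncovered = ≤-trans (≤-reflexive (sym (countF-all (suc last) _ (λ i → bare (witness i)))))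
                       (countF-injection place place-injective (λ e → not (covered (fromE e))))
      where
      e = proj₁ unbalanced-strip
      witness : ∀ i → ∃[ k ] covered (petersenEdge (e , i) k) ≡ false
      witness i = uncovered-in (e , i) (λ bal → proj₂ unbalanced-strip (strip bal))
        where
        strip : Balanced (e , i) → BalancedStrip e
        strip = resp₃ ExactlyOne (𝟙.inParity-strip e i) (𝟚.inParity-strip e i) (𝟛.inParity-strip e i)
      place : Fin (suc last) → Fin (CubicGraph.nE Γ)
      place i = toE (petersenEdge (e , i) (proj₁ (witness i)))
      bare : ∀ {i} (w : ∃[ k ] covered (petersenEdge (e , i) k) ≡ false) →
             not (covered (fromE (toE (petersenEdge (e , i) (proj₁ w))))) ≡ true
      bare {i} (k , p) = cong not (trans (cong covered (fromE-toE (petersenEdge (e , i) k))) p)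
      place-injective : ∀ {i j} → place i ≡ place j → i ≡ j
      place-injective {i} {j} p = cong proj₂ (just-injective (trans (sym (owner-petersenEdge (e , i) (proj₁ (witness i))))
        (trans (cong owner (toE-injective {petersenEdge (e , i) (proj₁ (witness i))} {petersenEdge (e , j) (proj₁ (witness j))} p))
          (owner-petersenEdge (e , j) (proj₁ (witness j))))))

  length≤defect : ∀ M₁ M₂ M₃ → PerfectMatching graph M₁ → PerfectMatching graph M₂ → PerfectMatching graph M₃ →
    suc last ≤ uncovered graph M₁ M₂ M₃
  length≤defect M₁ M₂ M₃ p₁ p₂ p₃ = ≤-trans
    (Triple.length≤uncovered (M₁ ∘ toE) (M₂ ∘ toE) (M₃ ∘ toE)
      (perfectMatching⇒ {M₁} p₁) (perfectMatching⇒ {M₂} p₂) (perfectMatching⇒ {M₃} p₃))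
    (countF-mono _ _ _ (λ e h → trans (sym (same e)) h))
    where
    same : ∀ e → not (M₁ (toE (fromE e)) ∨ M₂ (toE (fromE e)) ∨ M₃ (toE (fromE e))) ≡ not (M₁ e ∨ M₂ e ∨ M₃ e)
    same e = cong (λ x → not (M₁ x ∨ M₂ x ∨ M₃ x)) (toE-fromE e)

-- Girth of the family

rot rot⁻¹ : Fin 3 → Fin 3
rot 0F = 1F
rot 1F = 2F
rot 2F = 0F
rot⁻¹ 0F = 2F
rot⁻¹ 1F = 0F
rot⁻¹ 2F = 1F

-- A finite quotient common to all graphs of the family: the position in a strip is kept modulo 3,
-- which still separates a unit from its two neighbours.
data Code : Set where
  unitᶜ : Fin 6 → Fin 3 → Fin 16 → Code
  nodeᶜ : Fin 6 → Code
  leafᶜ : Fin 3 → Code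
  hubᶜ  : Code

index : Code → ℕ
index (unitᶜ e κ l) = 10 + (toℕ l + 16 * (toℕ κ + 3 * toℕ e))
index (nodeᶜ e)     = 4 + toℕ e
index (leafᶜ i)     = 1 + toℕ i
index hubᶜ          = 0

sideZ : Fin 6 → Fin 3 → List (Code × Fin 3)
sideZ e 0F = (nodeᶜ e , 1F) ∷ []
sideZ e _  = []

exitᶜ : Fin 6 → Fin 3 → List (Code × Fin 3)
exitᶜ e 2F = (nodeᶜ (next6 e) , 0F) ∷ []
exitᶜ e _  = []

forwardᶜ : Fin 6 → Fin 3 → {l : Fin 16} → View l → List (Code × Fin 3)
forwardᶜ e κ ‵fromℕ       = (unitᶜ e κ 0F , 1F) ∷ []
forwardᶜ e κ (‵inject₁ k) = (unitᶜ e κ (suc k) , 1F) ∷ []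

-- A code does not tell whether its unit ends a strip, so every possible target is listed. Moves
-- that never occur only make the check stricter.
moves : Code → Fin 3 → List (Code × Fin 3)
moves (unitᶜ e κ l)       0F = forwardᶜ e κ (view l)
moves (unitᶜ e κ zero)    1F = (unitᶜ e κ 15F , 0F) ∷ []
moves (unitᶜ e κ (suc k)) 1F = (unitᶜ e κ (inject₁ k) , 0F) ∷ []
moves (unitᶜ e κ 0F)  2F = (unitᶜ e (rot⁻¹ κ) 15F , 2F) ∷ sideZ e κ
moves (unitᶜ e κ 1F)  2F = (unitᶜ e κ 5F , 2F) ∷ []
moves (unitᶜ e κ 2F)  2F = (unitᶜ e κ 7F , 2F) ∷ []
moves (unitᶜ e κ 3F)  2F = (unitᶜ e (rot⁻¹ κ) 12F , 2F) ∷ (unitᶜ (prev6 e) 2F 12F , 2F) ∷ []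
moves (unitᶜ e κ 4F)  2F = (unitᶜ e κ 11F , 2F) ∷ []
moves (unitᶜ e κ 5F)  2F = (unitᶜ e κ 1F , 2F) ∷ []
moves (unitᶜ e κ 6F)  2F = (unitᶜ e (rot⁻¹ κ) 9F , 2F) ∷ (unitᶜ (prev6 e) 2F 9F , 2F) ∷ []
moves (unitᶜ e κ 7F)  2F = (unitᶜ e κ 2F , 2F) ∷ []
moves (unitᶜ e κ 8F)  2F = (unitᶜ e κ 13F , 2F) ∷ []
moves (unitᶜ e κ 9F)  2F = (unitᶜ e (rot κ) 6F , 2F) ∷ (unitᶜ (next6 e) 0F 6F , 2F) ∷ []
moves (unitᶜ e κ 10F) 2F = (unitᶜ e κ 14F , 2F) ∷ []
moves (unitᶜ e κ 11F) 2F = (unitᶜ e κ 4F , 2F) ∷ []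
moves (unitᶜ e κ 12F) 2F = (unitᶜ e (rot κ) 3F , 2F) ∷ (unitᶜ (next6 e) 0F 3F , 2F) ∷ []
moves (unitᶜ e κ 13F) 2F = (unitᶜ e κ 8F , 2F) ∷ []
moves (unitᶜ e κ 14F) 2F = (unitᶜ e κ 10F , 2F) ∷ []
moves (unitᶜ e κ 15F) 2F = (unitᶜ e (rot κ) 0F , 2F) ∷ exitᶜ e κ
moves (nodeᶜ e) 0F = (unitᶜ (prev6 e) 2F 15F , 2F) ∷ []
moves (nodeᶜ e) 1F = (unitᶜ e 0F 0F , 2F) ∷ []
moves (nodeᶜ 0F) 2F = (leafᶜ 0F , 0F) ∷ []
moves (nodeᶜ 1F) 2F = (leafᶜ 1F , 0F) ∷ []
moves (nodeᶜ 2F) 2F = (leafᶜ 2F , 0F) ∷ []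
moves (nodeᶜ (suc (suc (suc i)))) 2F = (leafᶜ i , 1F) ∷ []
moves (leafᶜ i) 0F = (nodeᶜ (low i) , 2F) ∷ []
moves (leafᶜ i) 1F = (nodeᶜ (high i) , 2F) ∷ []
moves (leafᶜ i) 2F = (hubᶜ , i) ∷ []
moves hubᶜ j = (leafᶜ j , 2F) ∷ []

module Girth (q : ℕ) where
  open Family q
  open CubicGraph Γ using (graph)
  open Cuts Γ using (nbr)
  open Trails Γ

  level : ∀ {n} → Fin n → Fin 3
  level zero    = 0F
  level (suc i) = rot (level i)

  level-inject₁ : ∀ {n} (i : Fin n) → level (inject₁ i) ≡ level i
  level-inject₁ zero    = refl
  level-inject₁ (suc i) = cong rot (level-inject₁ i)

  level-last : level (fromℕ last) ≡ 2F
  level-last = go q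
    where
    rot³ : ∀ κ → rot (rot (rot κ)) ≡ κ
    rot³ 0F = refl
    rot³ 1F = refl
    rot³ 2F = refl
    go : ∀ q → level (fromℕ (2 + q * 3)) ≡ 2F
    go zero    = refl
    go (suc q) = trans (rot³ _) (go q)

  rot⁻¹-rot : ∀ κ → rot⁻¹ (rot κ) ≡ κ
  rot⁻¹-rot 0F = refl
  rot⁻¹-rot 1F = refl
  rot⁻¹-rot 2F = refl

  code : Vertex → Code
  code (unit (e , i) l) = unitᶜ e (level i) l
  code (node e)         = nodeᶜ e
  code (leaf i)         = leafᶜ i
  code hub              = hubᶜ

  moves-complete : ∀ v j → (code (nbr v j) , arrive v j) ∈ moves (code v) j
  moves-complete (unit (e , i) l) 0F with view l
  ... | ‵fromℕ     = here refl
  ... | ‵inject₁ k = here refl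
  moves-complete (unit (e , i) zero)    1F = here refl
  moves-complete (unit (e , i) (suc k)) 1F = here refl
  moves-complete (unit (e , zero)  0F) 2F = there (here refl)
  moves-complete (unit (e , suc i) 0F) 2F =
    here (cong (λ κ → unitᶜ e κ 15F , 2F) (trans (level-inject₁ i) (sym (rot⁻¹-rot (level i)))))
  moves-complete (unit (e , i) 1F)  2F = here refl
  moves-complete (unit (e , i) 2F)  2F = here refl
  moves-complete (unit (e , zero)  3F) 2F = there (here (cong (λ κ → unitᶜ (prev6 e) κ 12F , 2F) level-last))
  moves-complete (unit (e , suc i) 3F) 2F =
    here (cong (λ κ → unitᶜ e κ 12F , 2F) (trans (level-inject₁ i) (sym (rot⁻¹-rot (level i)))))
  moves-complete (unit (e , i) 4F)  2F = here refl
  moves-complete (unit (e , i) 5F)  2F = here refl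
  moves-complete (unit (e , zero)  6F) 2F = there (here (cong (λ κ → unitᶜ (prev6 e) κ 9F , 2F) level-last))
  moves-complete (unit (e , suc i) 6F) 2F =
    here (cong (λ κ → unitᶜ e κ 9F , 2F) (trans (level-inject₁ i) (sym (rot⁻¹-rot (level i)))))
  moves-complete (unit (e , i) 7F)  2F = here refl
  moves-complete (unit (e , i) 8F)  2F = here refl
  moves-complete (unit (e , i) 9F)  2F with view i
  ... | ‵fromℕ     = there (here refl)
  ... | ‵inject₁ j = here (cong (λ κ → unitᶜ e (rot κ) 6F , 2F) (sym (level-inject₁ j)))
  moves-complete (unit (e , i) 10F) 2F = here refl
  moves-complete (unit (e , i) 11F) 2F = here refl
  moves-complete (unit (e , i) 12F) 2F with view i
  ... | ‵fromℕ     = there (here refl)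
  ... | ‵inject₁ j = here (cong (λ κ → unitᶜ e (rot κ) 3F , 2F) (sym (level-inject₁ j)))
  moves-complete (unit (e , i) 13F) 2F = here refl
  moves-complete (unit (e , i) 14F) 2F = here refl
  moves-complete (unit (e , i) 15F) 2F with view i
  ... | ‵fromℕ     = there (subst (λ κ → (nodeᶜ (next6 e) , 0F) ∈ exitᶜ e κ) (sym level-last) (here refl))
  ... | ‵inject₁ j = here (cong (λ κ → unitᶜ e (rot κ) 0F , 2F) (sym (level-inject₁ j)))
  moves-complete (node e) 0F = here (cong (λ κ → unitᶜ (prev6 e) κ 15F , 2F) level-last)
  moves-complete (node e) 1F = here refl
  moves-complete (node 0F) 2F = here refl
  moves-complete (node 1F) 2F = here refl
  moves-complete (node 2F) 2F = here refl
  moves-complete (node (suc (suc (suc i)))) 2F = here refl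
  moves-complete (leaf i) 0F = here refl
  moves-complete (leaf i) 1F = here refl
  moves-complete (leaf i) 2F = here refl
  moves-complete hub j = here refl

  open Coded index moves code moves-complete

  units-ok : ∀ e κ l j → noReturn 3 (index (unitᶜ e κ l)) (unitᶜ e κ l) j ≡ true
  units-ok = from-yes (all? λ e → all? λ κ → all? λ l → all? λ j → noReturn 3 (index (unitᶜ e κ l)) (unitᶜ e κ l) j Bool.≟ true)

  nodes-ok : ∀ e j → noReturn 3 (index (nodeᶜ e)) (nodeᶜ e) j ≡ true
  nodes-ok = from-yes (all? λ e → all? λ j → noReturn 3 (index (nodeᶜ e)) (nodeᶜ e) j Bool.≟ true)

  leaves-ok : ∀ i j → noReturn 3 (index (leafᶜ i)) (leafᶜ i) j ≡ true
  leaves-ok = from-yes (all? λ i → all? λ j → noReturn 3 (index (leafᶜ i)) (leafᶜ i) j Bool.≟ true)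

  hub-ok : ∀ j → noReturn 3 (index hubᶜ) hubᶜ j ≡ true
  hub-ok = from-yes (all? λ j → noReturn 3 (index hubᶜ) hubᶜ j Bool.≟ true)

  codes-ok : ∀ c j → noReturn 3 (index c) c j ≡ true
  codes-ok (unitᶜ e κ l) = units-ok e κ l
  codes-ok (nodeᶜ e)     = nodes-ok e
  codes-ok (leafᶜ i)     = leaves-ok i
  codes-ok hubᶜ          = hub-ok

  no-short-trail : ∀ v j k → k ≤ 3 → ¬ Trail v v j k
  no-short-trail v j k = noReturn-sound 3 (codes-ok (code v) j)

  girth : GirthAtLeast graph 5
  girth = no-short-trail⇒girth no-short-trail

  simple : ∀ v {j k} → nbr v j ≡ nbr v k → j ≡ k
  simple = no-short-trail⇒simple no-short-trail

-- Small edge cuts of the family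

countL-lookup : ∀ {A : Set} (P : A → Bool) xs → countL (map P xs) ≡ countF (length xs) (P ∘ lookup xs)
countL-lookup P xs = trans (go xs) (sym (countF≡∑ (length xs) (P ∘ lookup xs)))
  where
  go : ∀ xs → countL (map P xs) ≡ ∑[ i < length xs ] b2n (P (lookup xs i))
  go []       = refl
  go (x ∷ xs) = cong (b2n (P x) +_) (go xs)

lookup-injective : ∀ {A : Set} {xs : List A} → Unique xs → ∀ {i j} → lookup xs i ≡ lookup xs j → i ≡ j
lookup-injective {xs = x ∷ xs} (h ∷ u) {zero}  {zero}  p = refl
lookup-injective {xs = x ∷ xs} (h ∷ u) {zero}  {suc j} p = ⊥-elim (All.lookup h (∈-lookup j) p)
lookup-injective {xs = x ∷ xs} (h ∷ u) {suc i} {zero}  p = ⊥-elim (All.lookup h (∈-lookup i) (sym p))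
lookup-injective {xs = x ∷ xs} (h ∷ u) {suc i} {suc j} p = cong suc (lookup-injective u p)

-- The edges in a list may depend on a variable unit, but their keys are numerals, for which
-- `unique?` decides.
unique-by : ∀ {A : Set} (key : A → ℕ) {ks} xs → map key xs ≡ ks → Unique ks → Unique xs
unique-by key xs refl u = Unique.map⁻ u

unique? : (ks : List ℕ) → Dec (Unique ks)
unique? = allPairs? (λ x y → ¬? (x ℕ.≟ y))

countF≤1 : ∀ k (P : Fin (suc k) → Bool) → countF (suc k) P ≤ 1 → ∃[ x ] (∀ i → i ≢ x → P i ≡ false)
countF≤1 k P c with any? (λ i → P i Bool.≟ true)
... | no ¬p = zero , λ i _ → ¬-not (λ q → ¬p (i , q))
... | yes (x , px) = x , λ i i≢x → ¬-not (λ pi → 2≰1 (≤-trans (two i pi i≢x) c))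
  where
  2≰1 : ¬ (2 ≤ 1)
  2≰1 (s≤s ())
  two : ∀ i → P i ≡ true → i ≢ x → 2 ≤ countF (suc k) P
  two i pi i≢x = subst (_≤ countF (suc k) P) (countF-all 2 (P ∘ g) (λ { 0F → pi ; 1F → px }))
                   (countF-injection g inj P)
    where
    g : Fin 2 → Fin (suc k)
    g 0F = i
    g 1F = x
    inj : ∀ {a b} → g a ≡ g b → a ≡ b
    inj {0F} {0F} _ = refl
    inj {0F} {1F} p = ⊥-elim (i≢x p)
    inj {1F} {0F} p = ⊥-elim (i≢x (sym p))
    inj {1F} {1F} _ = refl

xor-false⇒≡ : ∀ {a b} → a xor b ≡ false → b ≡ a
xor-false⇒≡ {false} {false} _ = refl
xor-false⇒≡ {true}  {true}  _ = refl

≢⇒xor : ∀ {a b} → a ≢ b → a xor b ≡ true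
≢⇒xor {false} {false} p = ⊥-elim (p refl)
≢⇒xor {false} {true}  p = refl
≢⇒xor {true}  {false} p = refl
≢⇒xor {true}  {true}  p = ⊥-elim (p refl)

xor-shift : ∀ b x y → (b xor x) xor (b xor y) ≡ x xor y
xor-shift false x y = refl
xor-shift true  x y = xor-annihilates-not x y

bools-complete : ∀ b → b ∈ (false ∷ true ∷ [])
bools-complete false = here refl
bools-complete true  = there (here refl)

same : List Bool → Bool
same []       = true
same (x ∷ xs) = all (λ y → not (x xor y)) xs

module CycleSearch = Search (false ∷ true ∷ []) bools-complete _xor_ same

module CutSearch = Search (false ∷ true ∷ []) bools-complete _xor_ (λ xs → countL xs ≤ᵇ 1)

-- The variables are the vertices 15, 14, …, 0 of a unit.
cyclePartners : List (List ℕ)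
cyclePartners = [] ∷ z ∷ z ∷ z ∷ z ∷ z ∷ z ∷ z ∷ z ∷ z ∷ z ∷ z ∷ z ∷ z ∷ z ∷ (0 ∷ 14 ∷ []) ∷ []
  where z = 0 ∷ []

-- As before, but with the six outer edges leading to a constant preceding all variables.
unitPartners : List (List ℕ)
unitPartners =
  (0 ∷ []) ∷ (0 ∷ []) ∷ (0 ∷ []) ∷ (0 ∷ 3 ∷ []) ∷ (0 ∷ []) ∷ (0 ∷ 3 ∷ []) ∷ (0 ∷ 6 ∷ []) ∷ (0 ∷ 4 ∷ []) ∷
  (0 ∷ []) ∷ (0 ∷ 9 ∷ []) ∷ (0 ∷ []) ∷ (0 ∷ 6 ∷ []) ∷ (0 ∷ 12 ∷ []) ∷ (0 ∷ 4 ∷ []) ∷ (0 ∷ 3 ∷ []) ∷ (0 ∷ 14 ∷ 15 ∷ []) ∷ []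

-- The variables are the hub, the leaves 2, 1, 0 and the nodes 5, …, 0; the two edges along the
-- ring at each node lead to the constant.
treePartners : List (List ℕ)
treePartners =
  [] ∷ (0 ∷ []) ∷ (1 ∷ []) ∷ (2 ∷ []) ∷
  (4 ∷ 4 ∷ 2 ∷ []) ∷ (5 ∷ 5 ∷ 2 ∷ []) ∷ (6 ∷ 6 ∷ 2 ∷ []) ∷ (7 ∷ 7 ∷ 5 ∷ []) ∷ (8 ∷ 8 ∷ 5 ∷ []) ∷ (9 ∷ 9 ∷ 5 ∷ []) ∷ []

-- Budget 1 forces constancy because the number of colour changes around a circuit is even.
cycle-ok : CycleSearch.search cyclePartners 1 [] ≡ true
cycle-ok = refl

-- The initial `false` is the common colour of everything outside. It adds nothing to the final
-- count, so success bounds by one the number of vertices that differ from the outside.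
unit-ok : CutSearch.search unitPartners 3 (false ∷ []) ≡ true
unit-ok = refl

tree-ok : CutSearch.search treePartners 3 (false ∷ []) ≡ true
tree-ok = refl

opposite : Fin 6 → Fin 6
opposite 0F = 3F
opposite 1F = 4F
opposite 2F = 5F
opposite 3F = 0F
opposite 4F = 1F
opposite 5F = 2F

≤ᵇ-true : ∀ m {k} → (m ≤ᵇ k) ≡ true → m ≤ k
≤ᵇ-true m p = ≤ᵇ⇒≤ m _ (subst T (sym p) tt)

module CutLemma (q : ℕ) where
  open Family q
  open CubicGraph Γ using (toE; fromE; fromE-toE; toE-injective; countE; inc)
  open Cuts Γ using (bichromatic; AlmostConstant; nbr)

  _≟ᵤ_ : (s t : Unit) → Dec (s ≡ t)
  _≟ᵤ_ = ≡-dec _≟_ _≟_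

  prev≢ : ∀ t → prev t ≢ t
  prev≢ (e , zero)  p with cong proj₂ p
  ... | ()
  prev≢ (e , suc i) p = inject₁≢suc i (cong proj₂ p)

  next≢ : ∀ t → next t ≢ t
  next≢ t p = prev≢ (next t) (trans (prev-next t) (sym p))

  -- Induction along the ring in the direction of `next`: it carries a value from `t` all the way
  -- round to `prev t`.
  data Around (t : Unit) : Unit → Set where
    start : Around t t
    after : ∀ {s} → Around t s → Around t (next s)

  around : ∀ t s → Around t s
  around (e , i) (e′ , i′) = along i′ (away e′ (home (next6 e) (nextStrip i start)))
    where
    next-inject₁ : ∀ e i → next (e , inject₁ i) ≡ (e , suc i)
    next-inject₁ e i rewrite view-inject₁ i = refl
    next-last : ∀ e → next (e , fromℕ last) ≡ (next6 e , zero)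
    next-last e rewrite view-fromℕ last = refl
    along : ∀ {t e} i → Around t (e , zero) → Around t (e , i)
    along {t} {e} i a = <-weakInduction (λ i → Around t (e , i)) a (λ i b → subst (Around t) (next-inject₁ e i) (after b)) i
    toLast : ∀ {t e} i → Around t (e , i) → Around t (e , fromℕ last)
    toLast {t} {e} i a = >-weakInduction (λ i → Around t (e , i) → Around t (e , fromℕ last)) (λ b → b)
                           (λ i rec b → rec (subst (Around t) (next-inject₁ e i) (after b))) i a
    nextStrip : ∀ {t e} i → Around t (e , i) → Around t (next6 e , zero)
    nextStrip {t} {e} i a = subst (Around t) (next-last e) (after (toLast i a))
    module _ {t : Unit} where
      s : ∀ {e} → Around t (e , zero) → Around t (next6 e , zero)
      s = nextStrip zero
      home : ∀ e → Around t (e , zero) → Around t (0F , zero)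
      home 0F a = a
      home 1F a = s (s (s (s (s a))))
      home 2F a = s (s (s (s a)))
      home 3F a = s (s (s a))
      home 4F a = s (s a)
      home 5F a = s a
      away : ∀ e → Around t (0F , zero) → Around t (e , zero)
      away 0F a = a
      away 1F a = s a
      away 2F a = s (s a)
      away 3F a = s (s (s a))
      away 4F a = s (s (s (s a)))
      away 5F a = s (s (s (s (s a))))

  -- A 2-colouring f that is not constant on a unit changes at least twice along its spanning circuit
  -- 0, 1, …, 15. With at most three bichromatic edges this happens in at most one unit, and two
  -- bichromatic edges of any other class are then excluded.
  data Class : Set where
    cyc  : Unit → Class
    legs : Unit → Class
    misc : Class

  class : Edge → Class
  class (path t k)   = cyc t
  class (chord t 5F) = cyc t
  class (chord t _)  = misc
  class (leg t 2F)   = misc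
  class (leg t _)    = legs t
  class (entry _)    = misc
  class (spoke _)    = misc
  class (arm _)      = misc

  key : Edge → ℕ
  key (path t k)  = toℕ k
  key (chord t c) = 15 + toℕ c
  key (leg t r)   = 21 + toℕ r
  key (entry e)   = 24 + toℕ e
  key (spoke e)   = 30 + toℕ e
  key (arm i)     = 36 + toℕ i

  cycleEdges : Unit → List Edge
  cycleEdges t = p 14F ∷ p 13F ∷ p 12F ∷ p 11F ∷ p 10F ∷ p 9F ∷ p 8F ∷ p 7F ∷ p 6F ∷ p 5F ∷ p 4F ∷ p 3F ∷ p 2F ∷ p 1F ∷ p 0F ∷ chord t 5F ∷ []
    where p = path t

  cycleEdges-unique : ∀ t → Unique (cycleEdges t)
  cycleEdges-unique t = unique-by key (cycleEdges t) refl (from-yes (unique? (map key (cycleEdges (0F , 0F)))))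

  cycleEdges-class : ∀ t → All (λ e → class e ≡ cyc t) (cycleEdges t)
  cycleEdges-class t = refl ∷ refl ∷ refl ∷ refl ∷ refl ∷ refl ∷ refl ∷ refl ∷ refl ∷ refl ∷ refl ∷ refl ∷ refl ∷ refl ∷ refl ∷ refl ∷ []

  labels : List (Fin 16)
  labels = 15F ∷ 14F ∷ 13F ∷ 12F ∷ 11F ∷ 10F ∷ 9F ∷ 8F ∷ 7F ∷ 6F ∷ 5F ∷ 4F ∷ 3F ∷ 2F ∷ 1F ∷ 0F ∷ []

  few⇒bound : ∀ f → countE (bichromatic f) ≤ 3 → ∀ es → Unique es → countL (map (bichromatic f) es) ≤ 3
  few⇒bound f few es u = ≤-trans (≤-reflexive (countL-lookup (bichromatic f) es))
    (≤-trans (countF-mono _ _ _ (λ i p → trans (cong (bichromatic f) (fromE-toE (lookup es i))) p))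
      (≤-trans (countF-injection (toE ∘ lookup es) (λ p → lookup-injective u (toE-injective p)) (bichromatic f ∘ fromE)) few))

  module FewBichromatic (f : Vertex → Bool) (bound : ∀ es → Unique es → countL (map (bichromatic f) es) ≤ 3) where

    β : Edge → Bool
    β = bichromatic f

    record Block (c : Class) : Set where
      constructor block
      field
        edges   : List Edge
        unique  : Unique edges
        inClass : All (λ e → class e ≡ c) edges
        heavy   : 2 ≤ countL (map β edges)

    -- Different classes share no edge, so the two lists together contain four bichromatic edges.
    clash : ∀ {c c′} → Block c → Block c′ → c ≢ c′ → ⊥
    clash (block es u k h) (block es′ u′ k′ h′) c≢c′ = 4≰3 (≤-trans (+-mono-≤ h h′)
      (≤-trans (≤-reflexive (sym (trans (cong countL (map-++ β es es′)) (countL-++ (map β es) (map β es′)))))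
        (bound (es ++ es′) (Unique.++⁺ u u′ (λ { (i , j) → c≢c′ (trans (sym (All.lookup k i)) (All.lookup k′ j)) })))))
      where
      4≰3 : ¬ (4 ≤ 3)
      4≰3 (s≤s (s≤s (s≤s ())))

    pair : ∀ {c} e e′ → e ≢ e′ → class e ≡ c → class e′ ≡ c → β e ≡ true → β e′ ≡ true → Block c
    pair e e′ ne k k′ b b′ = block (e ∷ e′ ∷ []) ((ne ∷ []) ∷ [] ∷ []) (k ∷ k′ ∷ []) (≤-reflexive (sym (cong₂ (λ x y → b2n x + (b2n y + 0)) b b′)))

    Constant : Unit → Set
    Constant t = ∀ l → f (unit t l) ≡ f (unit t 0F)

    constant? : ∀ t → Dec (Constant t)
    constant? t = all? (λ l → f (unit t l) Bool.≟ f (unit t 0F))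

    light⇒constant : ∀ t → countL (map β (cycleEdges t)) ≤ 1 → Constant t
    light⇒constant t c l = go l
      where
      go : ∀ l → f (unit t l) ≡ f (unit t 0F)
      go zero    = refl
      go (suc l) = xor-false⇒≡ (not-true (all-∈ (λ y → not (f (unit t 0F) xor y))
                     (CycleSearch.search-sound cyclePartners (map (f ∘ unit t) labels) 1 [] refl cycle-ok c)
                     (∈-tabulate⁺ {f = λ l → f (unit t (suc l))} l)))
        where
        not-true : ∀ {b} → not b ≡ true → b ≡ false
        not-true {false} _ = refl

    cycleBlock : ∀ t → ¬ Constant t → Block (cyc t)
    cycleBlock t ¬c = block (cycleEdges t) (cycleEdges-unique t) (cycleEdges-class t) (≰⇒> (λ c → ¬c (light⇒constant t c)))

    -- Even between two strips, where a node subdivides the third edge, two of the connecting edges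
    -- run directly from unit to unit.
    legBlock : ∀ t → Constant (prev t) → Constant t → f (unit (prev t) 0F) ≢ f (unit t 0F) → Block (legs t)
    legBlock t c c′ ne = pair (leg t 0F) (leg t 1F) (λ ()) refl refl
      (≢⇒xor (λ p → ne (trans (sym (c 9F)) (trans p (c′ 6F))))) (≢⇒xor (λ p → ne (trans (sym (c 12F)) (trans p (c′ 3F)))))

    special : Fin 10 → Vertex
    special 0F = node 0F
    special 1F = node 1F
    special 2F = node 2F
    special 3F = node 3F
    special 4F = node 4F
    special 5F = node 5F
    special 6F = leaf 0F
    special 7F = leaf 1F
    special 8F = leaf 2F
    special 9F = hub

    at-special : ∀ (P : Vertex → Set) → (∀ t l → P (unit t l)) → (∀ k → P (special k)) → ∀ v → P v
    at-special P u s (unit t l) = u t l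
    at-special P u s (node 0F) = s 0F
    at-special P u s (node 1F) = s 1F
    at-special P u s (node 2F) = s 2F
    at-special P u s (node 3F) = s 3F
    at-special P u s (node 4F) = s 4F
    at-special P u s (node 5F) = s 5F
    at-special P u s (leaf 0F) = s 6F
    at-special P u s (leaf 1F) = s 7F
    at-special P u s (leaf 2F) = s 8F
    at-special P u s hub = s 9F

    module AllConstant (constant : ∀ t → Constant t) where

      value : Unit → Bool
      value t = f (unit t 0F)

      -- A change of value at `x` uses up a block, so no other change is possible; following the
      -- ring from `x` to `prev x` then gives equal values after all.
      value-prev : ∀ x → value (prev x) ≡ value x
      value-prev x with value (prev x) Bool.≟ value x
      ... | yes p = p
      ... | no ne = ⊥-elim (ne (onRing (around x (prev x))))
        where
        otherwise : ∀ y → y ≢ x → value (prev y) ≡ value y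
        otherwise y y≢x with value (prev y) Bool.≟ value y
        ... | yes p = p
        ... | no ne′ = ⊥-elim (clash (legBlock x (constant _) (constant _) ne) (legBlock y (constant _) (constant _) ne′)
                         (λ { refl → y≢x refl }))
        onRing : ∀ {s} → Around x s → value s ≡ value x
        onRing start = refl
        onRing (after {s} a) with next s ≟ᵤ x
        ... | yes p = cong value p
        ... | no ne″ = trans (sym (otherwise (next s) ne″)) (trans (cong value (prev-next s)) (onRing a))

      b : Bool
      b = value (0F , zero)

      on-unit : ∀ t l → f (unit t l) ≡ b
      on-unit t l = trans (constant t l) (go (around (0F , zero) t))
        where
        go : ∀ {s} → Around (0F , zero) s → value s ≡ b
        go start = refl
        go (after {s} a) = trans (sym (value-prev (next s))) (trans (cong value (prev-next s)) (go a))

      treeEdges : List Edge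
      treeEdges = arm 2F ∷ arm 1F ∷ arm 0F
                ∷ entry 5F ∷ leg (5F , zero) 2F ∷ spoke 5F ∷ entry 4F ∷ leg (4F , zero) 2F ∷ spoke 4F
                ∷ entry 3F ∷ leg (3F , zero) 2F ∷ spoke 3F ∷ entry 2F ∷ leg (2F , zero) 2F ∷ spoke 2F
                ∷ entry 1F ∷ leg (1F , zero) 2F ∷ spoke 1F ∷ entry 0F ∷ leg (0F , zero) 2F ∷ spoke 0F ∷ []

      -- Unlike `key`, this separates the edges leg (e , 0) 2 of different strips.
      treeKey : Edge → ℕ
      treeKey (leg (e , _) _) = 40 + toℕ e
      treeKey e               = key e

      tree-unique : Unique treeEdges
      tree-unique = unique-by treeKey treeEdges refl (from-yes (unique?
        (38 ∷ 37 ∷ 36 ∷ 29 ∷ 45 ∷ 35 ∷ 28 ∷ 44 ∷ 34 ∷ 27 ∷ 43 ∷ 33 ∷ 26 ∷ 42 ∷ 32 ∷ 25 ∷ 41 ∷ 31 ∷ 24 ∷ 40 ∷ 30 ∷ [])))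

      -- Normalised so that the colour `b` of the units becomes `false`, the starting entry of the
      -- search; bichromatic edges stay the same.
      g : Vertex → Bool
      g v = b xor f v

      treeValues : List Bool
      treeValues = map g (hub ∷ leaf 2F ∷ leaf 1F ∷ leaf 0F ∷ node 5F ∷ node 4F ∷ node 3F ∷ node 2F ∷ node 1F ∷ node 0F ∷ [])

      same-tree : Pointwise _≡_ (CutSearch.violations treePartners treeValues (false ∷ [])) (map β treeEdges)
      same-tree = shift (leaf 2F) hub ∷ shift (leaf 1F) hub ∷ shift (leaf 0F) hub
        ∷ in′ 5F ∷ out 5F ∷ shift (node 5F) (leaf 2F) ∷ in′ 4F ∷ out 4F ∷ shift (node 4F) (leaf 1F)
        ∷ in′ 3F ∷ out 3F ∷ shift (node 3F) (leaf 0F) ∷ in′ 2F ∷ out 2F ∷ shift (node 2F) (leaf 2F)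
        ∷ in′ 1F ∷ out 1F ∷ shift (node 1F) (leaf 1F) ∷ in′ 0F ∷ out 0F ∷ shift (node 0F) (leaf 0F) ∷ []
        where
        shift : ∀ v w → g v xor g w ≡ f v xor f w
        shift v w = xor-shift b (f v) (f w)
        in′ : ∀ e → g (node e) xor false ≡ β (entry e)
        in′ e = trans (xor-identityʳ _) (cong (_xor f (node e)) (sym (on-unit (prev6 e , fromℕ last) 15F)))
        out : ∀ e → g (node e) xor false ≡ β (leg (e , zero) 2F)
        out e = trans (xor-identityʳ _) (trans (xor-comm b (f (node e))) (cong (f (node e) xor_) (sym (on-unit (e , zero) 0F))))

      light : countF 10 (g ∘ special) ≤ 1
      light = ≤ᵇ-true (countL (map g (node 0F ∷ node 1F ∷ node 2F ∷ node 3F ∷ node 4F ∷ node 5F ∷ leaf 0F ∷ leaf 1F ∷ leaf 2F ∷ hub ∷ []) )) tree-good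
        where
        few-violations : countL (CutSearch.violations treePartners treeValues (false ∷ [])) ≤ 3
        few-violations = subst (λ bs → countL bs ≤ 3) (sym (Pointwise-≡⇒≡ same-tree)) (bound treeEdges tree-unique)
        tree-good : (countL (map g (node 0F ∷ node 1F ∷ node 2F ∷ node 3F ∷ node 4F ∷ node 5F ∷ leaf 0F ∷ leaf 1F ∷ leaf 2F ∷ hub ∷ [])) ≤ᵇ 1) ≡ true
        tree-good = CutSearch.search-sound treePartners treeValues 3 (false ∷ []) refl tree-ok few-violations

      almostConstant : AlmostConstant f
      almostConstant = let x , h = countF≤1 9 (g ∘ special) light in
        special x , b , at-special (λ v → v ≢ special x → f v ≡ b) (λ t l _ → on-unit t l)
          (λ k k≢x → xor-false⇒≡ (h k (λ p → k≢x (cong special p))))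

    β-inc : ∀ v j → β (inc v j) ≡ f v xor f (nbr v j)
    β-inc v j with dart v j | CubicGraph.end-inc Γ v j
    ... | e , false | refl = refl
    ... | e , true  | refl = xor-comm (f (CubicGraph.end Γ e false)) (f (CubicGraph.end Γ e true))

    β-spoke : ∀ e → β (spoke e) ≡ f (node e) xor f (leaf (mod3 e))
    β-spoke 0F = refl
    β-spoke 1F = refl
    β-spoke 2F = refl
    β-spoke 3F = refl
    β-spoke 4F = refl
    β-spoke 5F = refl

    module NotConstant (t : Unit) (¬c : ¬ Constant t) where

      own : Block (cyc t)
      own = cycleBlock t ¬c

      constant : ∀ s → s ≢ t → Constant s
      constant s s≢t with constant? s
      ... | yes c = c
      ... | no ¬c′ = ⊥-elim (clash (cycleBlock s ¬c′) own (λ { refl → s≢t refl }))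

      b : Bool
      b = f (unit (next t) 0F)

      -- The value of `next t` is carried round the ring, since a change between two constant units
      -- would be a second block besides `own`.
      off-t : ∀ {s} → Around t s → s ≡ t ⊎ f (unit s 0F) ≡ b
      off-t start = inj₁ refl
      off-t (after {s} a) with next s ≟ᵤ t | s ≟ᵤ t | off-t a
      ... | yes p | _        | _      = inj₁ p
      ... | no _  | yes refl | _      = inj₂ refl
      ... | no _  | no s≢t   | inj₁ p = ⊥-elim (s≢t p)
      ... | no ne | no s≢t   | inj₂ q with f (unit (prev (next s)) 0F) Bool.≟ f (unit (next s) 0F)
      ...   | yes p = inj₂ (trans (sym p) (trans (cong (λ u → f (unit u 0F)) (prev-next s)) q))
      ...   | no ¬p = ⊥-elim (clash (legBlock (next s) (subst Constant (sym (prev-next s)) (constant s s≢t)) (constant (next s) ne) ¬p) own (λ ()))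

      on-unit : ∀ s l → s ≢ t → f (unit s l) ≡ b
      on-unit s l s≢t with off-t (around t s)
      ... | inj₁ p = ⊥-elim (s≢t p)
      ... | inj₂ p = trans (constant s s≢t l) p

      -- Otherwise both edges are bichromatic and form a block besides `own`. In this way the colour
      -- `b` spreads to every vertex with two neighbours already known to have it.
      forced : ∀ w e e′ → e ≢ e′ → class e ≡ misc → class e′ ≡ misc → β e ≡ b xor f w → β e′ ≡ b xor f w → f w ≡ b
      forced w e e′ ne k k′ p p′ with f w Bool.≟ b
      ... | yes q = q
      ... | no ¬q = ⊥-elim (clash (pair e e′ ne k k′ (trans p differ) (trans p′ differ)) own (λ ()))
        where
        differ : b xor f w ≡ true
        differ = ≢⇒xor (λ r → ¬q (sym r))

      -- The node x is the only one that may be adjacent to unit t, and then only on one side.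
      record Exception : Set where
        field
          x    : Fin 6
          safe : ∀ e → e ≢ x → (prev6 e , fromℕ last) ≢ t × (e , zero) ≢ t
          side : (prev6 x , fromℕ last) ≢ t ⊎ (x , zero) ≢ t

      exception : Exception
      exception = find t refl
        where
        find : ∀ s → s ≡ t → Exception
        find (e₀ , zero) refl = record
          { x = e₀
          ; safe = λ e ne → (λ ()) , (λ p → ne (cong proj₁ p))
          ; side = inj₁ (λ ()) }
        find (e₀ , suc i) refl with suc i ≟ fromℕ last
        ... | yes p = record
          { x = next6 e₀
          ; safe = λ e ne → (λ q → ne (trans (sym (next6-prev6 e)) (cong (next6 ∘ proj₁) q))) , (λ ())
          ; side = inj₂ (λ ()) }
        -- Here `t` is neither first nor last in its strip, so no node is adjacent to it and any
        -- choice of `x` will do.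
        ... | no ¬p = record
          { x = 0F
          ; safe = λ e _ → (λ q → ¬p (sym (cong proj₂ q))) , (λ ())
          ; side = inj₂ (λ ()) }

      open Exception exception

      at-entry : ∀ e → (prev6 e , fromℕ last) ≢ t → β (entry e) ≡ b xor f (node e)
      at-entry e ne = cong (_xor f (node e)) (on-unit (prev6 e , fromℕ last) 15F ne)

      at-leg : ∀ e → (e , zero) ≢ t → β (leg (e , zero) 2F) ≡ b xor f (node e)
      at-leg e ne = trans (cong (f (node e) xor_) (on-unit (e , zero) 0F ne)) (xor-comm (f (node e)) b)

      node-off : ∀ e → e ≢ x → f (node e) ≡ b
      node-off e ne = forced (node e) (entry e) (leg (e , zero) 2F) (λ ()) refl refl
        (at-entry e (proj₁ (safe e ne))) (at-leg e (proj₂ (safe e ne)))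

      at-spoke : ∀ e i → mod3 e ≡ i → f (node e) ≡ b → β (spoke e) ≡ b xor f (leaf i)
      at-spoke e i refl p = trans (β-spoke e) (cong (_xor f (leaf i)) p)

      leaf-off : ∀ i → i ≢ mod3 x → f (leaf i) ≡ b
      leaf-off i ne = forced (leaf i) (spoke (low i)) (spoke (high i)) (low≢high i) refl refl
        (at-spoke (low i) i (mod3-low i) (node-off (low i) (λ p → ne (trans (sym (mod3-low i)) (cong mod3 p)))))
        (at-spoke (high i) i (mod3-high i) (node-off (high i) (λ p → ne (trans (sym (mod3-high i)) (cong mod3 p)))))
        where
        mod3-low : ∀ i → mod3 (low i) ≡ i
        mod3-low 0F = refl
        mod3-low 1F = refl
        mod3-low 2F = refl
        mod3-high : ∀ i → mod3 (high i) ≡ i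
        mod3-high 0F = refl
        mod3-high 1F = refl
        mod3-high 2F = refl
        low≢high : ∀ i → spoke (low i) ≢ spoke (high i)
        low≢high 0F ()
        low≢high 1F ()
        low≢high 2F ()

      at-arm : ∀ i → f (leaf i) ≡ b → β (arm i) ≡ b xor f hub
      at-arm i p = cong (_xor f hub) p

      hub-off : f hub ≡ b
      hub-off = two (mod3 x) leaf-off
        where
        both : ∀ i j → i ≢ j → f (leaf i) ≡ b → f (leaf j) ≡ b → f hub ≡ b
        both i j ne p p′ = forced hub (arm i) (arm j) (λ { refl → ne refl }) refl refl (at-arm i p) (at-arm j p′)
        two : ∀ r → (∀ i → i ≢ r → f (leaf i) ≡ b) → f hub ≡ b
        two 0F h = both 1F 2F (λ ()) (h 1F (λ ())) (h 2F (λ ()))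
        two 1F h = both 0F 2F (λ ()) (h 0F (λ ())) (h 2F (λ ()))
        two 2F h = both 0F 1F (λ ()) (h 0F (λ ())) (h 1F (λ ()))

      -- The other node at this leaf is not exceptional, and the hub is already settled by the two
      -- other leaves.
      leaf-x : f (leaf (mod3 x)) ≡ b
      leaf-x = forced (leaf (mod3 x)) (spoke (opposite x)) (arm (mod3 x)) (λ ()) refl refl
        (at-spoke (opposite x) (mod3 x) (mod3-opposite x) (node-off (opposite x) (opposite≢ x)))
        (trans (cong (f (leaf (mod3 x)) xor_) hub-off) (xor-comm (f (leaf (mod3 x))) b))
        where
        mod3-opposite : ∀ e → mod3 (opposite e) ≡ mod3 e
        mod3-opposite = from-yes (all? λ e → mod3 (opposite e) ≟ mod3 e)
        opposite≢ : ∀ e → opposite e ≢ e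
        opposite≢ = from-yes (all? λ e → ¬? (opposite e ≟ e))

      node-x : f (node x) ≡ b
      node-x = by side
        where
        spoke-x : β (spoke x) ≡ b xor f (node x)
        spoke-x = trans (β-spoke x) (trans (cong (f (node x) xor_) leaf-x) (xor-comm (f (node x)) b))
        by : (prev6 x , fromℕ last) ≢ t ⊎ (x , zero) ≢ t → f (node x) ≡ b
        by (inj₁ ne) = forced (node x) (spoke x) (entry x) (λ ()) refl refl spoke-x (at-entry x ne)
        by (inj₂ ne) = forced (node x) (spoke x) (leg (x , zero) 2F) (λ ()) refl refl spoke-x (at-leg x ne)

      outside : ∀ v → (∀ l → v ≢ unit t l) → f v ≡ b
      outside (unit s l) h = on-unit s l (λ { refl → h l refl })
      outside (node e) _ with e ≟ x
      ... | yes refl = node-x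
      ... | no ne    = node-off e ne
      outside (leaf i) _ with i ≟ mod3 x
      ... | yes refl = leaf-x
      ... | no ne    = leaf-off i ne
      outside hub _ = hub-off

      g : Vertex → Bool
      g v = b xor f v

      unitEdges : List Edge
      unitEdges = proj₁ (third t 15F) ∷ p 14F ∷ p 13F ∷ p 12F ∷ leg (next t) 1F ∷ p 11F ∷ p 10F ∷ chord t 4F
                ∷ p 9F ∷ leg (next t) 0F ∷ p 8F ∷ chord t 3F ∷ p 7F ∷ p 6F ∷ leg t 0F ∷ p 5F ∷ p 4F ∷ chord t 2F
                ∷ p 3F ∷ leg t 1F ∷ p 2F ∷ chord t 1F ∷ p 1F ∷ chord t 0F ∷ p 0F ∷ chord t 5F ∷ leg t 2F ∷ []
        where p = path t

      -- The legs into `t` get the keys 21 to 23 and the three edges out of it 24 to 26, whether the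
      -- last one is a `leg` or an `entry`.
      unitKey : Edge → ℕ
      unitKey (leg s r) = if does (s ≟ᵤ t) then 21 + toℕ r else 24 + toℕ r
      unitKey (entry e) = 26
      unitKey e         = key e

      unit-unique : Unique unitEdges
      unit-unique = unique-by unitKey unitEdges (Pointwise-≡⇒≡
        (exitKey t refl ∷ refl ∷ refl ∷ refl ∷ later 1F ∷ refl ∷ refl ∷ refl
        ∷ refl ∷ later 0F ∷ refl ∷ refl ∷ refl ∷ refl ∷ now 0F ∷ refl ∷ refl ∷ refl
        ∷ refl ∷ now 1F ∷ refl ∷ refl ∷ refl ∷ refl ∷ refl ∷ refl ∷ now 2F ∷ []))
        (from-yes (unique? (26 ∷ 14 ∷ 13 ∷ 12 ∷ 25 ∷ 11 ∷ 10 ∷ 19 ∷ 9 ∷ 24 ∷ 8 ∷ 18 ∷ 7 ∷ 6 ∷ 21 ∷ 5 ∷ 4 ∷ 17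
                            ∷ 3 ∷ 22 ∷ 2 ∷ 16 ∷ 1 ∷ 15 ∷ 0 ∷ 20 ∷ 23 ∷ [])))
        where
        now : ∀ r → unitKey (leg t r) ≡ 21 + toℕ r
        now r = cong (λ d → if d then 21 + toℕ r else 24 + toℕ r) (dec-true (t ≟ᵤ t) refl)
        other : ∀ s r → s ≢ t → unitKey (leg s r) ≡ 24 + toℕ r
        other s r ne = cong (λ d → if d then 21 + toℕ r else 24 + toℕ r) (dec-false (s ≟ᵤ t) ne)
        later : ∀ r → unitKey (leg (next t) r) ≡ 24 + toℕ r
        later r = other (next t) r (next≢ t)
        exitKey : ∀ s → s ≡ t → unitKey (proj₁ (third s 15F)) ≡ 26
        exitKey (e , i) p with view i
        ... | ‵fromℕ     = refl
        ... | ‵inject₁ j = other (e , suc j) 2F (λ q → prev≢ (e , suc j) (trans p (sym q)))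

      unitValues : List Bool
      unitValues = map (g ∘ unit t) labels

      same-unit : Pointwise _≡_ (CutSearch.violations unitPartners unitValues (false ∷ [])) (map β unitEdges)
      same-unit = ext 15F (exitOff t refl) ∷ s 14F 15F ∷ s 13F 14F ∷ s 12F 13F ∷ ext 12F (outside _ (λ l p → next≢ t (cong unitOf p))) ∷ s 11F 12F
        ∷ s 10F 11F ∷ s 10F 14F ∷ s 9F 10F ∷ ext 9F (outside _ (λ l p → next≢ t (cong unitOf p))) ∷ s 8F 9F ∷ s 8F 13F ∷ s 7F 8F
        ∷ s 6F 7F ∷ ext 6F (outside _ (λ l p → prev≢ t (cong unitOf p))) ∷ s 5F 6F ∷ s 4F 5F ∷ s 4F 11F
        ∷ s 3F 4F ∷ ext 3F (outside _ (λ l p → prev≢ t (cong unitOf p))) ∷ s 2F 3F ∷ s 2F 7F ∷ s 1F 2F ∷ s 1F 5F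
        ∷ s 0F 1F ∷ s 0F 15F ∷ ext 0F (enterOff t refl) ∷ []
        where
        unitOf : Vertex → Unit
        unitOf (unit s _) = s
        unitOf _          = t
        s : ∀ l l′ → g (unit t l) xor g (unit t l′) ≡ f (unit t l) xor f (unit t l′)
        s l l′ = xor-shift b (f (unit t l)) (f (unit t l′))
        ext : ∀ l → f (nbr (unit t l) 2F) ≡ b → g (unit t l) xor false ≡ β (inc (unit t l) 2F)
        ext l p = trans (xor-identityʳ _) (trans (xor-comm b (f (unit t l)))
                    (sym (trans (β-inc (unit t l) 2F) (cong (f (unit t l) xor_) p))))
        exitOff : ∀ s → s ≡ t → f (nbr (unit s 15F) 2F) ≡ b
        exitOff (e , i) p with view i
        ... | ‵fromℕ     = outside _ (λ l ())
        ... | ‵inject₁ j = on-unit (e , suc j) 0F (λ q → prev≢ (e , suc j) (trans p (sym q)))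
        enterOff : ∀ s → s ≡ t → f (nbr (unit s 0F) 2F) ≡ b
        enterOff (e , zero)  p = outside _ (λ l ())
        enterOff (e , suc i) p = on-unit (e , inject₁ i) 15F (λ q → prev≢ (e , suc i) (trans q (sym p)))

      light : countF 16 (g ∘ unit t) ≤ 1
      light = ≤ᵇ-true (countF 16 (g ∘ unit t)) unit-good
        where
        few-violations : countL (CutSearch.violations unitPartners unitValues (false ∷ [])) ≤ 3
        few-violations = subst (λ bs → countL bs ≤ 3) (sym (Pointwise-≡⇒≡ same-unit)) (bound unitEdges unit-unique)
        unit-good : (countF 16 (g ∘ unit t) ≤ᵇ 1) ≡ true
        unit-good = CutSearch.search-sound unitPartners unitValues 3 (false ∷ []) refl unit-ok few-violations

      almostConstant : AlmostConstant f
      almostConstant = let x , h = countF≤1 15 (g ∘ unit t) light in unit t x , b , everywhere x h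
        where
        everywhere : ∀ x → (∀ l → l ≢ x → g (unit t l) ≡ false) → ∀ v → v ≢ unit t x → f v ≡ b
        everywhere x h (unit s l) ne with s ≟ᵤ t
        ... | yes refl = xor-false⇒≡ (h l (λ { refl → ne refl }))
        ... | no s≢t   = on-unit s l s≢t
        everywhere x h (node e) _ = outside (node e) (λ l ())
        everywhere x h (leaf i) _ = outside (leaf i) (λ l ())
        everywhere x h hub      _ = outside hub (λ l ())

    almostConstant : AlmostConstant f
    almostConstant with any? (λ e → any? (λ i → ¬? (constant? (e , i))))
    ... | yes (e , i , ¬c) = NotConstant.almostConstant (e , i) ¬c
    ... | no all-constant  = AllConstant.almostConstant (λ t → decidable-stable (constant? t) (λ ¬c → all-constant (proj₁ t , proj₂ t , ¬c)))

  cut : ∀ f → countE (bichromatic f) ≤ 3 → AlmostConstant f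
  cut f few = FewBichromatic.almostConstant f (few⇒bound f few)

-- The 2-factor

-- The strips traversed lengthwise by the 2-factor.
long : Fin 6 → Bool
long 3F = false
long 5F = false
long _  = true

oddᵇ-even+ : ∀ n m → oddᵇ n ≡ false → oddᵇ (n + m) ≡ oddᵇ m
oddᵇ-even+ zero          m p = refl
oddᵇ-even+ (suc (suc n)) m p = oddᵇ-even+ n m p

oddᵇ-*16 : ∀ n → oddᵇ (n * 16) ≡ false
oddᵇ-*16 zero    = refl
oddᵇ-*16 (suc n) = oddᵇ-*16 n

degree-complement : ∀ a b c → b2n a + (b2n b + b2n c) ≡ 2 → b2n (not a) + (b2n (not b) + b2n (not c)) ≡ 1
degree-complement true  true  false _ = refl
degree-complement true  false true  _ = refl
degree-complement false true  true  _ = refl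
degree-complement false true  false ()
degree-complement false false false ()

module Factor (q : ℕ) where
  open Family q
  open CubicGraph Γ using (degV; end; graph; inc; degV⇒degIn; fromE)
  open Orbits Γ

  -- Lifts the 5-circuits leaf 0, node 0, node 1, node 2, node 3 and hub, leaf 1, node 4, node 5,
  -- leaf 2. Strips 3 and 5 are not traversed, and each of their units is spanned by its own
  -- 16-circuit.
  D : Edge → Bool
  D (path t k)         = true
  D (chord (e , i) 5F) = not (long e)
  D (chord t _)        = false
  D (leg (e , i) 2F)   = long e
  D (leg t _)          = false
  D (entry e)          = long (prev6 e)
  D (spoke 1F)         = false
  D (spoke 2F)         = false
  D (spoke _)          = true
  D (arm 0F)           = false
  D (arm _)            = true

  degree : ∀ v → degV D v ≡ 2
  degree (unit (0F , i) 0F) = refl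
  degree (unit (1F , i) 0F) = refl
  degree (unit (2F , i) 0F) = refl
  degree (unit (3F , i) 0F) = refl
  degree (unit (4F , i) 0F) = refl
  degree (unit (5F , i) 0F) = refl
  degree (unit t 1F)  = refl
  degree (unit t 2F)  = refl
  degree (unit t 3F)  = refl
  degree (unit t 4F)  = refl
  degree (unit t 5F)  = refl
  degree (unit t 6F)  = refl
  degree (unit t 7F)  = refl
  degree (unit t 8F)  = refl
  degree (unit t 9F)  = refl
  degree (unit t 10F) = refl
  degree (unit t 11F) = refl
  degree (unit t 12F) = refl
  degree (unit t 13F) = refl
  degree (unit t 14F) = refl
  degree (unit (e , i) 15F) = trans (cong (λ b → b2n (not (long e)) + (1 + b2n b)) (exit-long (view i))) (balance e)
    where
    exit-long : ∀ {i} (w : View i) → D (proj₁ (exitZ e w)) ≡ long e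
    exit-long ‵fromℕ       = cong long (prev6-next6 e)
    exit-long (‵inject₁ j) = refl
    balance : ∀ e → b2n (not (long e)) + (1 + b2n (long e)) ≡ 2
    balance = from-yes (all? λ e → b2n (not (long e)) + (1 + b2n (long e)) ℕ.≟ 2)
  degree (node 0F) = refl
  degree (node 1F) = refl
  degree (node 2F) = refl
  degree (node 3F) = refl
  degree (node 4F) = refl
  degree (node 5F) = refl
  degree (leaf 0F) = refl
  degree (leaf 1F) = refl
  degree (leaf 2F) = refl
  degree hub = refl

  twoFactor : TwoFactor graph (D ∘ fromE)
  twoFactor = degV⇒degIn D 2 degree

  matching : PerfectMatching graph (not ∘ D ∘ fromE)
  matching = degV⇒degIn (not ∘ D) 1 (λ v → degree-complement (D (inc v 0F)) (D (inc v 1F)) (D (inc v 2F)) (degree v))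

  exitV : Fin 6 → {i : Fin (suc last)} → View i → Vertex
  exitV e ‵fromℕ       = node (next6 e)
  exitV e (‵inject₁ j) = unit (e , suc j) 0F

  succU : Unit → {l : Fin 16} → View l → Vertex
  succU (e , i) ‵fromℕ       = if long e then exitV e (view i) else unit (e , i) 0F
  succU t       (‵inject₁ k) = unit t (suc k)

  outU : Unit → {l : Fin 16} → View l → Edge
  outU (e , i) ‵fromℕ       = if long e then proj₁ (exitZ e (view i)) else chord (e , i) 5F
  outU t       (‵inject₁ k) = path t k

  succ : Vertex → Vertex
  succ (unit t l) = succU t (view l)
  succ (node e)   = if long e then unit (e , zero) 0F else leaf (mod3 e)
  succ (leaf 0F)  = node 0F
  succ (leaf 1F)  = node 4F
  succ (leaf 2F)  = hub
  succ hub        = leaf 1F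

  out : Vertex → Edge
  out (unit t l) = outU t (view l)
  out (node e)   = if long e then leg (e , zero) 2F else spoke e
  out (leaf 0F)  = spoke 0F
  out (leaf 1F)  = spoke 4F
  out (leaf 2F)  = arm 2F
  out hub        = arm 1F

  joins : ∀ v → Σ Bool λ s → end (out v) s ≡ v × end (out v) (not s) ≡ succ v
  joins (unit t l) with view l
  joins (unit t .(inject₁ k)) | ‵inject₁ k = false , refl , refl
  joins (unit (e , i) .(fromℕ 15)) | ‵fromℕ with long e
  ... | false = true , refl , refl
  ... | true with view i
  ...   | ‵fromℕ     = false , cong (λ x → unit (x , fromℕ last) 15F) (prev6-next6 e) , refl
  ...   | ‵inject₁ j = false , refl , refl
  joins (node 0F) = false , refl , refl
  joins (node 1F) = false , refl , refl
  joins (node 2F) = false , refl , refl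
  joins (node 3F) = false , refl , refl
  joins (node 4F) = false , refl , refl
  joins (node 5F) = false , refl , refl
  joins (leaf 0F) = true , refl , refl
  joins (leaf 1F) = true , refl , refl
  joins (leaf 2F) = false , refl , refl
  joins hub       = true , refl , refl

  -- A left inverse of `out`, from which injectivity follows; its values off the image of `out` are
  -- arbitrary.
  source : Edge → Vertex
  source (path t k)          = unit t (inject₁ k)
  source (chord t _)         = unit t 15F
  source (leg (e , zero) _)  = node e
  source (leg (e , suc i) _) = unit (e , inject₁ i) 15F
  source (entry e)           = unit (prev6 e , fromℕ last) 15F
  source (spoke 0F)          = leaf 0F
  source (spoke 4F)          = leaf 1F
  source (spoke e)           = node e
  source (arm 1F)            = hub
  source (arm i)             = leaf i

  source-out : ∀ v → source (out v) ≡ v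
  source-out (unit t l) with view l
  source-out (unit t .(inject₁ k)) | ‵inject₁ k = refl
  source-out (unit (e , i) .(fromℕ 15)) | ‵fromℕ with long e
  ... | false = refl
  ... | true with view i
  ...   | ‵fromℕ     = cong (λ x → unit (x , fromℕ last) 15F) (prev6-next6 e)
  ...   | ‵inject₁ j = refl
  source-out (node 0F) = refl
  source-out (node 1F) = refl
  source-out (node 2F) = refl
  source-out (node 3F) = refl
  source-out (node 4F) = refl
  source-out (node 5F) = refl
  source-out (leaf 0F) = refl
  source-out (leaf 1F) = refl
  source-out (leaf 2F) = refl
  source-out hub       = refl

  out-in : ∀ v → D (out v) ≡ true
  out-in (unit t l) with view l
  out-in (unit t .(inject₁ k)) | ‵inject₁ k = refl
  out-in (unit (e , i) .(fromℕ 15)) | ‵fromℕ with long e in eq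
  ... | false = cong not eq
  ... | true with view i
  ...   | ‵fromℕ     = trans (cong long (prev6-next6 e)) eq
  ...   | ‵inject₁ j = eq
  out-in (node 0F) = refl
  out-in (node 1F) = refl
  out-in (node 2F) = refl
  out-in (node 3F) = refl
  out-in (node 4F) = refl
  out-in (node 5F) = refl
  out-in (leaf 0F) = refl
  out-in (leaf 1F) = refl
  out-in (leaf 2F) = refl
  out-in hub       = refl

  -- `S` is the number of vertices in the units of one strip. Orbits 0 and 1 are the lifted
  -- 5-circuits; the others are the 16-circuits of strips 3 and 5.
  L S orbits : ℕ
  L      = suc last
  S      = L * 16
  orbits = 2 + (L + L)

  nodeOrbit : Fin 6 → Fin orbits
  nodeOrbit 4F = 1F
  nodeOrbit 5F = 1F
  nodeOrbit _  = 0F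

  shortOrbit : Fin 6 → Fin L → Fin orbits
  shortOrbit 3F i = suc (suc (i ↑ˡ L))
  shortOrbit _  i = suc (suc (L ↑ʳ i))

  orbit : Vertex → Fin orbits
  orbit (unit (e , i) l) = if long e then nodeOrbit e else shortOrbit e i
  orbit (node e)         = nodeOrbit e
  orbit (leaf 0F)        = 0F
  orbit (leaf _)         = 1F
  orbit hub              = 1F

  -- Orbit 0 starts at leaf 0 and meets node 0, strip 0, node 1, strip 1, node 2, strip 2, node 3.
  -- Orbit 1 starts at the hub and meets leaf 1, node 4, strip 4, node 5, leaf 2.
  nodeRank : Fin 6 → ℕ
  nodeRank 0F = 1
  nodeRank 1F = 2 + S
  nodeRank 2F = 3 + (S + S)
  nodeRank 3F = 4 + (S + (S + S))
  nodeRank 4F = 2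
  nodeRank 5F = 3 + S

  offset : Fin L → Fin 16 → ℕ
  offset i l = toℕ i * 16 + toℕ l

  rank : Vertex → ℕ
  rank (unit (e , i) l) = if long e then suc (nodeRank e) + offset i l else toℕ l
  rank (node e)         = nodeRank e
  rank (leaf 0F)        = 0
  rank (leaf 1F)        = 1
  rank (leaf 2F)        = 4 + S
  rank hub              = 0

  size : Fin orbits → ℕ
  size 0F            = 4 + (S + (S + S))
  size 1F            = 4 + S
  size (suc (suc _)) = 15

  shortOrigin : Fin L ⊎ Fin L → Vertex
  shortOrigin (inj₁ i) = unit (3F , i) 0F
  shortOrigin (inj₂ i) = unit (5F , i) 0F

  origin : Fin orbits → Vertex
  origin 0F            = leaf 0F
  origin 1F            = hub
  origin (suc (suc x)) = shortOrigin (splitAt L x)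

  orbit-origin : ∀ j → orbit (origin j) ≡ j
  orbit-origin 0F            = refl
  orbit-origin 1F            = refl
  orbit-origin (suc (suc x)) = trans (go (splitAt L x)) (cong (λ y → suc (suc y)) (join-splitAt L L x))
    where
    go : ∀ s → orbit (shortOrigin s) ≡ suc (suc (join L L s))
    go (inj₁ i) = refl
    go (inj₂ i) = refl

  rank-origin : ∀ j → rank (origin j) ≡ 0
  rank-origin 0F            = refl
  rank-origin 1F            = refl
  rank-origin (suc (suc x)) = go (splitAt L x)
    where
    go : ∀ s → rank (shortOrigin s) ≡ 0
    go (inj₁ i) = refl
    go (inj₂ i) = refl

  origin-short : ∀ e i → long e ≡ false → origin (shortOrbit e i) ≡ unit (e , i) 0F
  origin-short 3F i _ = cong shortOrigin (splitAt-↑ˡ L i L)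
  origin-short 5F i _ = cong shortOrigin (splitAt-↑ʳ L L i)

  size-short : ∀ e i → size (shortOrbit e i) ≡ 15
  size-short 0F i = refl
  size-short 1F i = refl
  size-short 2F i = refl
  size-short 3F i = refl
  size-short 4F i = refl
  size-short 5F i = refl

  rank-zero : ∀ v → rank v ≡ 0 → v ≡ origin (orbit v)
  rank-zero (unit (e , i) l) p with long e in eq
  rank-zero (unit (e , i) zero) p | false = sym (origin-short e i eq)
  rank-zero (node 0F) ()
  rank-zero (node 1F) ()
  rank-zero (node 2F) ()
  rank-zero (node 3F) ()
  rank-zero (node 4F) ()
  rank-zero (node 5F) ()
  rank-zero (leaf 0F) p = refl
  rank-zero (leaf 1F) ()
  rank-zero (leaf 2F) ()
  rank-zero hub p = refl

  nodeRank-next : ∀ e → long e ≡ true → nodeRank (next6 e) ≡ suc (nodeRank e) + S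
  nodeRank-next 0F _ = refl
  nodeRank-next 1F _ = refl
  nodeRank-next 2F _ = cong (4 +_) (sym (+-assoc S S S))
  nodeRank-next 4F _ = refl
  nodeRank-next 5F ()

  nodeOrbit-next : ∀ e → long e ≡ true → nodeOrbit (next6 e) ≡ nodeOrbit e
  nodeOrbit-next 0F _ = refl
  nodeOrbit-next 1F _ = refl
  nodeOrbit-next 2F _ = refl
  nodeOrbit-next 4F _ = refl
  nodeOrbit-next 5F ()

  nodeRank≤size : ∀ e → nodeRank e ≤ size (nodeOrbit e)
  nodeRank≤size 0F = s≤s z≤n
  nodeRank≤size 1F = s≤s (s≤s (≤-trans (m≤m+n S (S + S)) (m≤n+m (S + (S + S)) 2)))
  nodeRank≤size 2F = s≤s (s≤s (s≤s (≤-trans (+-monoʳ-≤ S (m≤m+n S S)) (n≤1+n (S + (S + S))))))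
  nodeRank≤size 3F = ≤-refl
  nodeRank≤size 4F = s≤s (s≤s z≤n)
  nodeRank≤size 5F = n≤1+n (3 + S)

  suc-offset : ∀ k → suc (k * 16 + 15) ≡ suc k * 16
  suc-offset k = cong suc (+-comm (k * 16) 15)

  offset<S : ∀ i l → offset i l < S
  offset<S i l = ≤-trans (s≤s (+-mono-≤ (*-monoˡ-≤ 16 (toℕ≤pred[n] i)) (toℕ≤pred[n] l))) (≤-reflexive (suc-offset last))

  rank≤size : ∀ v → rank v ≤ size (orbit v)
  rank≤size (unit (e , i) l) with long e in eq
  ... | false = ≤-trans (toℕ≤pred[n] l) (≤-reflexive (sym (size-short e i)))
  ... | true  = ≤-trans (+-monoʳ-≤ (suc (nodeRank e)) (<⇒≤ (offset<S i l)))
                  (≤-trans (≤-reflexive (sym (nodeRank-next e eq)))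
                    (≤-trans (nodeRank≤size (next6 e)) (≤-reflexive (cong size (nodeOrbit-next e eq)))))
  rank≤size (node e)  = nodeRank≤size e
  rank≤size (leaf 0F) = z≤n
  rank≤size (leaf 1F) = s≤s z≤n
  rank≤size (leaf 2F) = ≤-refl
  rank≤size hub       = z≤n

  orbit-succ : ∀ v → orbit (succ v) ≡ orbit v
  orbit-succ (unit t l) with view l
  orbit-succ (unit (e , i) .(inject₁ k)) | ‵inject₁ k = refl
  orbit-succ (unit (e , i) .(fromℕ 15)) | ‵fromℕ with long e in eq
  ... | false rewrite eq = refl
  ... | true with view i
  ...   | ‵fromℕ     = nodeOrbit-next e eq
  ...   | ‵inject₁ j rewrite eq = refl
  orbit-succ (node 0F) = refl
  orbit-succ (node 1F) = refl
  orbit-succ (node 2F) = refl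
  orbit-succ (node 3F) = refl
  orbit-succ (node 4F) = refl
  orbit-succ (node 5F) = refl
  orbit-succ (leaf 0F) = refl
  orbit-succ (leaf 1F) = refl
  orbit-succ (leaf 2F) = refl
  orbit-succ hub       = refl

  rank-succ : ∀ v → rank (succ v) ≡ suc (rank v) ⊎ (rank v ≡ size (orbit v) × succ v ≡ origin (orbit v))
  rank-succ (unit t l) with view l
  rank-succ (unit (e , i) .(inject₁ k)) | ‵inject₁ k with long e
  ... | false = inj₁ (cong suc (sym (toℕ-inject₁ k)))
  ... | true  = inj₁ (trans (cong (suc (nodeRank e) +_) (trans (+-suc (toℕ i * 16) (toℕ k)) (cong (λ x → suc (toℕ i * 16 + x)) (sym (toℕ-inject₁ k)))))
                        (+-suc (suc (nodeRank e)) (offset i (inject₁ k))))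
  rank-succ (unit (e , i) .(fromℕ 15)) | ‵fromℕ with long e in eq
  ... | false = inj₂ (sym (size-short e i) , sym (origin-short e i eq))
  ... | true with view i
  ...   | ‵fromℕ = inj₁ (trans (nodeRank-next e eq) (trans (cong (suc (nodeRank e) +_)
                     (trans (sym (suc-offset last)) (cong (λ x → suc (x * 16 + 15)) (sym (toℕ-fromℕ last)))))
                     (+-suc (suc (nodeRank e)) (offset (fromℕ last) 15F))))
  ...   | ‵inject₁ j rewrite eq = inj₁ (trans (cong (suc (nodeRank e) +_)
                     (trans (+-identityʳ (suc (toℕ j) * 16)) (trans (sym (suc-offset (toℕ j))) (cong (λ x → suc (x * 16 + 15)) (sym (toℕ-inject₁ j))))))
                     (+-suc (suc (nodeRank e)) (offset (inject₁ j) 15F)))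
  rank-succ (node 0F) = inj₁ (+-identityʳ 2)
  rank-succ (node 1F) = inj₁ (+-identityʳ (3 + S))
  rank-succ (node 2F) = inj₁ (+-identityʳ (4 + (S + S)))
  rank-succ (node 3F) = inj₂ (refl , refl)
  rank-succ (node 4F) = inj₁ (+-identityʳ 3)
  rank-succ (node 5F) = inj₁ refl
  rank-succ (leaf 0F) = inj₁ refl
  rank-succ (leaf 1F) = inj₁ refl
  rank-succ (leaf 2F) = inj₂ (refl , refl)
  rank-succ hub       = inj₁ refl

  succ-inject₁ : ∀ t k → succ (unit t (inject₁ k)) ≡ unit t (suc k)
  succ-inject₁ t k rewrite view-inject₁ k = refl

  succ-15 : ∀ e i → long e ≡ true → succ (unit (e , i) 15F) ≡ exitV e (view i)
  succ-15 e i eq = cong (λ b → if b then exitV e (view i) else unit (e , i) 0F) eq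

  succ-inner : ∀ e i → long e ≡ true → succ (unit (e , inject₁ i) 15F) ≡ unit (e , suc i) 0F
  succ-inner e i eq = trans (succ-15 e (inject₁ i) eq) (cong (exitV e) (view-inject₁ i))

  succ-outer : ∀ e → long e ≡ true → succ (unit (e , fromℕ last) 15F) ≡ node (next6 e)
  succ-outer e eq = trans (succ-15 e (fromℕ last) eq) (cong (exitV e) (view-fromℕ last))

  pred : ∀ v → rank v ≢ 0 → ∃[ u ] succ u ≡ v
  pred (unit t (suc k)) _ = unit t (inject₁ k) , succ-inject₁ t k
  pred (unit (e , i) zero) ne with long e in eq
  ... | false = ⊥-elim (ne refl)
  pred (unit (e , zero) zero) ne | true = node e , cong (λ b → if b then unit (e , zero) 0F else leaf (mod3 e)) eq
  pred (unit (e , suc i) zero) ne | true = unit (e , inject₁ i) 15F , succ-inner e i eq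
  pred (node 0F) _ = leaf 0F , refl
  pred (node 1F) _ = unit (0F , fromℕ last) 15F , succ-outer 0F refl
  pred (node 2F) _ = unit (1F , fromℕ last) 15F , succ-outer 1F refl
  pred (node 3F) _ = unit (2F , fromℕ last) 15F , succ-outer 2F refl
  pred (node 4F) _ = leaf 1F , refl
  pred (node 5F) _ = unit (4F , fromℕ last) 15F , succ-outer 4F refl
  pred (leaf 0F) ne = ⊥-elim (ne refl)
  pred (leaf 1F) _ = hub , refl
  pred (leaf 2F) _ = node 5F , refl
  pred hub ne = ⊥-elim (ne refl)

  rotation : Rotation D orbits
  rotation = record
    { succ = succ ; out = out ; joins = joins
    ; out-inj = λ {v} {w} p → trans (sym (source-out v)) (trans (cong source p) (source-out w))
    ; out-in = out-in ; orbit = orbit ; rank = rank ; size = size ; origin = origin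
    ; orbit-origin = orbit-origin ; rank-origin = rank-origin ; rank-zero = rank-zero ; rank≤size = rank≤size
    ; orbit-succ = orbit-succ ; rank-succ = rank-succ ; pred = pred }

  -- The lengths are `5 + 3S`, `5 + S` and otherwise 16, and `S` is a multiple of 16.
  two-odd : countF orbits (λ j → oddᵇ (suc (size j))) ≡ 2
  two-odd = trans (countF≡∑ orbits (λ j → oddᵇ (suc (size j))))
    (cong₂ _+_ (cong b2n odd₀) (cong₂ _+_ (cong b2n odd₁) (∑-zero (L + L) (λ _ → 0) (λ _ → refl))))
    where
    evenS : oddᵇ S ≡ false
    evenS = oddᵇ-*16 L
    odd₁ : oddᵇ (5 + S) ≡ true
    odd₁ = trans (cong oddᵇ (+-comm 5 S)) (oddᵇ-even+ S 5 evenS)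
    odd₀ : oddᵇ (5 + (S + (S + S))) ≡ true
    odd₀ = trans (cong oddᵇ (+-comm 5 (S + (S + S)))) (trans (oddᵇ-even+ (S + (S + S)) 5 (trans (oddᵇ-even+ S (S + S) evenS) (trans (oddᵇ-even+ S S evenS) evenS))) refl)

  twoOddCircuits : HasOddCircuits graph (D ∘ fromE) 2
  twoOddCircuits = Rotation.hasOddCircuits rotation two-odd

theorem5p1 : (d : ℕ) →
    Σ Graph (λ G → NontrivialSnark G × OddnessIs G 2 × DefectAtLeast G d)
theorem5p1 d = graph
  , ((twoConnected cut simple 2<n , cubic , uncolourable 1≤uncovered) , cyclicallyConnected cut , girth)
  , ((D ∘ fromE , twoFactor , twoOddCircuits) , oddness≥2 (units * 8 + 5) even 1≤uncovered)
  , (not ∘ D ∘ fromE , matching)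
  , (λ M₁ M₂ M₃ p₁ p₂ p₃ → ≤-trans d≤length (length≤defect M₁ M₂ M₃ p₁ p₂ p₃))
  where
  open Family d
  open CubicGraph Γ using (graph; cubic; fromE; nV)
  open Cuts Γ using (twoConnected; cyclicallyConnected)
  open CutLemma d using (cut)
  open Girth d using (girth; simple)
  open Factor d using (D; twoFactor; matching; twoOddCircuits)
  open Oddness Γ using (oddness≥2; uncolourable)
  open Defect d using (length≤defect)
  -- A single uncovered edge already excludes both a 3-edge-colouring and a 2-factor without odd
  -- circuits.
  1≤uncovered : ∀ M₁ M₂ M₃ → PerfectMatching graph M₁ → PerfectMatching graph M₂ → PerfectMatching graph M₃ →
    1 ≤ uncovered graph M₁ M₂ M₃
  1≤uncovered M₁ M₂ M₃ p₁ p₂ p₃ = ≤-trans (s≤s z≤n) (length≤defect M₁ M₂ M₃ p₁ p₂ p₃)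
  2<n : 2 < nV
  2<n = s≤s (s≤s (s≤s z≤n))
  even : nV ≡ 2 * (units * 8 + 5)
  even = sym (trans (*-distribˡ-+ 2 (units * 8) 5) (cong (_+ 10) (trans (*-comm 2 (units * 8)) (*-assoc units 8 2))))
  -- With `q` chosen as `d`, the strips have `3 + d * 3` units.
  d≤length : d ≤ suc last
  d≤length = ≤-trans (m≤m*n d 3) (m≤n+m (d * 3) 3)
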